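{- Let $\mathcal{C}$ be a finite abstract simplicial complex and $\mathcal{M}$ a matroid on the same finite ground set $V$, let $1\le k\le r(\mathcal{M})$ be an integer, and let $\eta\in\{\eta_\pi,\eta_H\}$. If $\eta(\mathcal{C}[X])+r(\mathcal{M}[V\setminus X])\ge k+1$ for all $X\subseteq V$ for which $V\setminus X$ is a flat of $\mathcal{M}$ of rank at most $k-1$, then $\mathbf{RG}(\mathcal{C},\mathcal{M};k)$ is connected.
   Context: $\mathcal{C}[X]=\{\sigma\in\mathcal{C}:\sigma\subseteq X\}$, $\mathcal{M}[X]=\{A\in\mathcal{M}:A\subseteq X\}$, and $r$ denotes matroid rank. A flat of $\mathcal{M}$ is $F\subseteq V$ with $r(\mathcal{M}[F\cup\{x\}])>r(\mathcal{M}[F])$ for all $x\in V\setminus F$. $\eta_\pi(\mathcal{K})$ (resp. $\eta_H(\mathcal{K})$) is $2$ plus the largest $k\ge-2$ such that $\mathcal{K}$ is homotopically $j$-connected (resp. $\widetilde H_j(\mathcal{K};\mathbb{Q})=0$) for all $-1\le j\le k$, where $(-1)$-connectedness / $\widetilde H_{ -1}=0$ means $\mathcal{K}$ has at least one vertex; the value may be $\infty$. $\mathbf{RG}(\mathcal{C},\mathcal{M};k)$ is the graph whose vertices are the independent sets of $\mathcal{M}$ of size $k$ that are simplices of $\mathcal{C}$, two being adjacent if their union is a simplex of $\mathcal{C}$ of cardinality $k+1$. -}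

module Defs where

open import Data.Bool using (if_then_else_)
open import Data.Fin using (Fin; zero; suc)
open import Data.Fin.Properties using (any?)
open import Data.Fin.Subset using (Subset; inside; outside; _∈_; _∉_; _⊆_; _∪_; ⁅_⁆; ∣_∣; ⊥)
open import Data.Fin.Subset.Properties using (_∈?_; _⊆?_)
open import Data.List using (List; []; _∷_; _++_; map; filter)
open import Data.List.Extrema.Nat using (max)
open import Data.Nat as ℕ using (ℕ; zero; suc)
import Data.Nat.Properties as ℕ
open import Data.Product using (Σ; Σ-syntax; ∃; ∃-syntax; _×_; _,_; proj₁; proj₂)
open import Data.Rational as ℚ using (ℚ; 0ℚ; 1ℚ; ½)
import Data.Rational.Properties as ℚ
open import Data.Rational.Solver using (module +-*-Solver)
open import Data.Unit using (⊤; tt)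
open import Data.Vec using ([]; _∷_)
open import Data.Vec.Functional using (foldr)
open import Algebra.Properties.CommutativeMonoid.Sum ℚ.+-0-commutativeMonoid using (sum)
open import Relation.Binary.Construct.Closure.ReflexiveTransitive using (Star)
open import Relation.Binary.PropositionalEquality using (_≡_; refl; sym; cong; subst)
open import Relation.Nullary using (¬_; Dec; yes; no; does)
open import Relation.Nullary.Decidable using (_×-dec_; ¬?)

-- The ground set is V = Fin n; its elements need not be vertices of the complex.
record Complex (n : ℕ) : Set₁ where
  field
    Face        : Subset n → Set
    face?       : ∀ σ → Dec (Face σ)
    down-closed : ∀ {σ τ} → τ ⊆ σ → Face σ → Face τ

open Complex public

infix 8 _↾_

_↾_ : ∀ {n} → Complex n → Subset n → Complex n
(K ↾ X) .Face σ = Face K σ × σ ⊆ X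
(K ↾ X) .face? σ = face? K σ ×-dec (σ ⊆? X)
(K ↾ X) .down-closed τ⊆σ (σ∈K , σ⊆X) = down-closed K τ⊆σ σ∈K , λ v∈τ → σ⊆X (τ⊆σ v∈τ)

subsets : ∀ n → List (Subset n)
subsets zero    = [] ∷ []
subsets (suc n) = map (outside ∷_) (subsets n) ++ map (inside ∷_) (subsets n)

rank : ∀ {n} → Complex n → ℕ
rank {n} K = max 0 (map ∣_∣ (filter (face? K) (subsets n)))

record Matroid (n : ℕ) : Set₁ where
  field
    indep   : Complex n
    empty   : Face indep ⊥
    augment : ∀ {A B} → Face indep A → Face indep B → ∣ A ∣ ℕ.< ∣ B ∣ →
              ∃[ x ] x ∈ B × x ∉ A × Face indep (A ∪ ⁅ x ⁆)

open Matroid public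

IsFlat : ∀ {n} → Matroid n → Subset n → Set
IsFlat M F = ∀ x → x ∉ F → rank (indep M ↾ (F ∪ ⁅ x ⁆)) ℕ.> rank (indep M ↾ F)

-- A j-chain is given by its coefficients on the faces with j + 1 elements,
-- each oriented by the order of Fin n, and extended by 0.
IsChain : ∀ {n} → Complex n → ℕ → (Subset n → ℚ) → Set
IsChain K j c = ∀ σ → ¬ (Face K σ × ∣ σ ∣ ≡ suc j) → c σ ≡ 0ℚ

-- (-1)^p, where p is the number of elements of τ below v; if v ∉ τ, then p
-- is the position of v in the increasing enumeration of τ ∪ {v}.
sign : ∀ {n} → Subset n → Fin n → ℚ
sign (_       ∷ τ) zero    = 1ℚ
sign (outside ∷ τ) (suc v) = sign τ v
sign (inside  ∷ τ) (suc v) = ℚ.- sign τ v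

-- The boundary ∂[v₀,…,vⱼ] = Σᵢ (-1)^i [v₀,…,v̂ᵢ,…,vⱼ], read off at the
-- coefficient of τ. At τ = ∅ it is the augmentation map.
∂ : ∀ {n} → (Subset n → ℚ) → (Subset n → ℚ)
∂ c τ = sum λ v → if does (v ∈? τ) then 0ℚ else sign τ v ℚ.* c (τ ∪ ⁅ v ⁆)

ReducedHomologyVanishes : ∀ {n} → Complex n → ℕ → Set
ReducedHomologyVanishes K j =
  ∀ z → IsChain K j z → (∀ τ → ∂ z τ ≡ 0ℚ) →
  ∃[ b ] IsChain K (suc j) b × (∀ σ → ∂ b σ ≡ z σ)

-- Cauchy sequences of rationals, compared by _≈ᴿ_.
record ℝ : Set where
  field
    seq    : ℕ → ℚ
    cauchy : ∀ ε → 0ℚ ℚ.< ε →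
             ∃[ N ] ∀ k l → N ℕ.≤ k → N ℕ.≤ l → ℚ.∣ seq k ℚ.- seq l ∣ ℚ.≤ ε

open ℝ public

fromℚ : ℚ → ℝ
fromℚ q .seq _ = q
fromℚ q .cauchy ε 0<ε = 0 , λ _ _ _ _ →
  subst (λ p → ℚ.∣ p ∣ ℚ.≤ ε) (sym (ℚ.+-inverseʳ q)) (ℚ.<⇒≤ 0<ε)

infixl 6 _+ᴿ_

_+ᴿ_ : ℝ → ℝ → ℝ
(x +ᴿ y) .seq k = seq x k ℚ.+ seq y k
(x +ᴿ y) .cauchy ε 0<ε = N , bound
  where
  δ : ℚ
  δ = ½ ℚ.* ε

  0<δ : 0ℚ ℚ.< δ
  0<δ = subst (ℚ._< δ) (ℚ.*-zeroʳ ½) (ℚ.*-monoʳ-<-pos ½ 0<ε)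

  Nˣ Nʸ N : ℕ
  Nˣ = proj₁ (cauchy x δ 0<δ)
  Nʸ = proj₁ (cauchy y δ 0<δ)
  N  = Nˣ ℕ.⊔ Nʸ

  regroup : ∀ a b c d → (a ℚ.+ b) ℚ.- (c ℚ.+ d) ≡ (a ℚ.- c) ℚ.+ (b ℚ.- d)
  regroup = solve 4 (λ a b c d → (a :+ b) :- (c :+ d) := (a :- c) :+ (b :- d)) refl
    where open +-*-Solver

  halves : δ ℚ.+ δ ≡ ε
  halves = solve 1 (λ e → con ½ :* e :+ con ½ :* e := e) refl ε
    where open +-*-Solver

  bound : ∀ k l → N ℕ.≤ k → N ℕ.≤ l →
          ℚ.∣ (seq x k ℚ.+ seq y k) ℚ.- (seq x l ℚ.+ seq y l) ∣ ℚ.≤ ε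
  bound k l N≤k N≤l = begin
    ℚ.∣ (seq x k ℚ.+ seq y k) ℚ.- (seq x l ℚ.+ seq y l) ∣
      ≡⟨ cong ℚ.∣_∣ (regroup (seq x k) (seq y k) (seq x l) (seq y l)) ⟩
    ℚ.∣ (seq x k ℚ.- seq x l) ℚ.+ (seq y k ℚ.- seq y l) ∣
      ≤⟨ ℚ.∣p+q∣≤∣p∣+∣q∣ (seq x k ℚ.- seq x l) (seq y k ℚ.- seq y l) ⟩
    ℚ.∣ seq x k ℚ.- seq x l ∣ ℚ.+ ℚ.∣ seq y k ℚ.- seq y l ∣
      ≤⟨ ℚ.+-mono-≤
           (proj₂ (cauchy x δ 0<δ) k l (ℕ.m⊔n≤o⇒m≤o Nˣ Nʸ N≤k) (ℕ.m⊔n≤o⇒m≤o Nˣ Nʸ N≤l))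
           (proj₂ (cauchy y δ 0<δ) k l (ℕ.m⊔n≤o⇒n≤o Nˣ Nʸ N≤k) (ℕ.m⊔n≤o⇒n≤o Nˣ Nʸ N≤l)) ⟩
    δ ℚ.+ δ
      ≡⟨ halves ⟩
    ε ∎
    where open ℚ.≤-Reasoning

infix 4 _≤ᴿ_ _<ᴿ_ _≈ᴿ_

_≤ᴿ_ : ℝ → ℝ → Set
x ≤ᴿ y = ∀ ε → 0ℚ ℚ.< ε → ∃[ N ] ∀ k → N ℕ.≤ k → seq x k ℚ.≤ seq y k ℚ.+ ε

_<ᴿ_ : ℝ → ℝ → Set
x <ᴿ y = ∃[ ε ] 0ℚ ℚ.< ε × ∃[ N ] ∀ k → N ℕ.≤ k → seq x k ℚ.+ ε ℚ.≤ seq y k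

_≈ᴿ_ : ℝ → ℝ → Set
x ≈ᴿ y = x ≤ᴿ y × y ≤ᴿ x

0ᴿ 1ᴿ : ℝ
0ᴿ = fromℚ 0ℚ
1ᴿ = fromℚ 1ℚ

sumᴿ : ∀ {n} → (Fin n → ℝ) → ℝ
sumᴿ = foldr _+ᴿ_ 0ᴿ

-- Points in barycentric coordinates. By down-closure, `support` says that
-- {v : 0 < coord v} is a face; this phrasing does not require the sign of a
-- real number to be decidable.
record ‖_‖ {n} (K : Complex n) : Set where
  field
    coord   : Fin n → ℝ
    nonneg  : ∀ v → 0ᴿ ≤ᴿ coord v
    total   : sumᴿ coord ≈ᴿ 1ᴿ
    support : ∀ σ → (∀ {v} → v ∈ σ → 0ᴿ <ᴿ coord v) → Face K σ

open ‖_‖ public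

-- Distance at most ε in the sup metric.
Within : ∀ {n} → ℚ → (Fin n → ℝ) → (Fin n → ℝ) → Set
Within ε x y = ∀ v → x v ≤ᴿ y v +ᴿ fromℚ ε × y v ≤ᴿ x v +ᴿ fromℚ ε

-- Realisations of finite complexes are compact metric spaces, so continuity
-- is uniform continuity (which is also Bishop's definition on such spaces).
-- It implies that the map respects equality of points.
record ContinuousMap {m n} (K : Complex m) (L : Complex n) : Set where
  field
    apply      : ‖ K ‖ → ‖ L ‖
    continuous : ∀ ε → 0ℚ ℚ.< ε → ∃[ δ ] 0ℚ ℚ.< δ ×
                 (∀ x y → Within δ (coord x) (coord y) →
                          Within ε (coord (apply x)) (coord (apply y)))

open ContinuousMap public

-- ‖ Δ d ‖ is the d-dimensional ball and ‖ ∂Δ d ‖ its boundary sphere.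
Δ : ∀ d → Complex (suc d)
Δ d .Face _ = ⊤
Δ d .face? _ = yes tt
Δ d .down-closed _ _ = tt

∂Δ : ∀ d → Complex (suc d)
∂Δ d .Face σ = ∃[ v ] v ∉ σ
∂Δ d .face? σ = any? λ v → ¬? (v ∈? σ)
∂Δ d .down-closed τ⊆σ (v , v∉σ) = v , λ v∈τ → v∉σ (τ⊆σ v∈τ)

∂Δ⊆Δ : ∀ {d} → ‖ ∂Δ d ‖ → ‖ Δ d ‖
∂Δ⊆Δ x = record
  { coord = coord x ; nonneg = nonneg x ; total = total x ; support = λ _ _ → tt }

-- Every continuous map from the j-sphere extends to the (j+1)-ball.
SpheresExtend : ∀ {n} → Complex n → ℕ → Set
SpheresExtend K j =
  (f : ContinuousMap (∂Δ (suc j)) K) →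
  Σ[ g ∈ ContinuousMap (Δ (suc j)) K ]
    (∀ x v → coord (apply g (∂Δ⊆Δ x)) v ≈ᴿ coord (apply f x) v)

data Kind : Set where
  homotopical homological : Kind

-- Shifted by one: index 0 is degree -1, index suc j is degree j.
ConnectedAt : Kind → ∀ {n} → Complex n → ℕ → Set
ConnectedAt _           K zero    = ∃[ v ] Face K ⁅ v ⁆
ConnectedAt homotopical K (suc j) = SpheresExtend K j
ConnectedAt homological K (suc j) = ReducedHomologyVanishes K j

-- η takes values in ℕ ∪ {∞} and is not computable from K, so it is
-- represented by its lower cut: m ≤ η(K) iff K is connected in all degrees
-- from -1 to m - 2.
infix 4 _≤η[_]_

_≤η[_]_ : ℕ → Kind → ∀ {n} → Complex n → Set
m ≤η[ κ ] K = ∀ i → i ℕ.< m → ConnectedAt κ K i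

infix 4 η[_]_+_≥_

η[_]_+_≥_ : Kind → ∀ {n} → Complex n → ℕ → ℕ → Set
η[ κ ] K + r ≥ t = ∃[ m ] m ≤η[ κ ] K × m ℕ.+ r ℕ.≥ t

record RGVertex {n} (C : Complex n) (M : Matroid n) (k : ℕ) (σ : Subset n) : Set where
  field
    independent : Face (indep M) σ
    simplex     : Face C σ
    size        : ∣ σ ∣ ≡ k

record RGAdjacent {n} (C : Complex n) (M : Matroid n) (k : ℕ) (σ τ : Subset n) : Set where
  field
    source     : RGVertex C M k σ
    target     : RGVertex C M k τ
    union-face : Face C (σ ∪ τ)
    union-size : ∣ σ ∪ τ ∣ ≡ k ℕ.+ 1

-- A connected graph is nonempty.
RGConnected : ∀ {n} → Complex n → Matroid n → ℕ → Set
RGConnected C M k =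
  ∃ (RGVertex C M k) ×
  (∀ {σ τ} → RGVertex C M k σ → RGVertex C M k τ → Star (RGAdjacent C M k) σ τ)

{-# OPTIONS --safe #-}

-- Let M be truncated to rank k and let N be its dual. A face of C containing a
-- basis of M is the same as a rainbow simplex of the join N * C, where v in N
-- and v in C have the same colour: the rainbow simplex of A is (V ∖ A) * A. For
-- every nonempty I ⊆ V the restriction of N * C to the colours I is acyclic up
-- to dimension |I| - 1: if V ∖ I is a flat of rank < k, this is the hypothesis
-- combined with the homology of matroids, and otherwise N restricted to I is a
-- cone. The acyclic carrier method then gives a chain map from the simplex on V
-- to N * C that sends I into the colours I, so by Sperner's lemma a rainbow
-- simplex exists, and it gives a chain homotopy between any two such maps. Each
-- simplex with |V| + 1 vertices has at most two rainbow facets, and these lie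
-- in the same component of the graph; hence the signed number of rainbow
-- simplices in one component is the same for homotopic maps, and there is only
-- one component.
--
-- The homotopical case reduces to the homological one. By induction on
-- simplices, a map from the cone over a skeleton of K to K is constructed that
-- does not enlarge supports on the base. A simplicial approximation on a fine
-- subdivision of the cone over a cycle z is a chain of K, and its boundary is z
-- because the approximation is a Sperner labelling on the base.
module Submission where

open import Defs
open import Data.Bool using (true; false; if_then_else_)
open import Data.Empty using (⊥-elim)
open import Data.Fin using (Fin; zero; suc)
open import Data.Fin.Subset using (Subset; inside; outside; _∈_; _∉_; _⊆_; _∩_; _∪_; ⁅_⁆; ∣_∣; ⊥; ⊤; ∁)
open import Data.Fin.Subset.Properties
open import Data.Nat as ℕ using (ℕ; zero; suc; _+_; _∸_; _≤_)
import Data.Nat.Properties as ℕ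
import Data.Integer as ℤ
import Data.Integer.Properties as ℤ
import Data.Rational.Unnormalised as ℚᵘ
import Data.Rational.Unnormalised.Properties as ℚᵘ
import Data.Bool.Properties as Bool
open import Data.Product using (Σ-syntax; ∃; ∃-syntax; _×_; _,_; proj₁; proj₂)
open import Data.Rational as ℚ using (ℚ; 0ℚ; 1ℚ; ½)
import Data.Rational.Properties as ℚ
open import Data.Rational.Solver using (module +-*-Solver)
open import Data.Fin.Properties using (any?; all?; ¬∀⟶∃¬)
open import Data.List as List using (List; []; _∷_)
open import Data.List.Extrema.Nat using (xs≤max; argmax-sel)
import Data.List.Membership.Propositional as List
import Data.List.Membership.DecPropositional as DecMembership
open import Data.List.Membership.Propositional.Properties using (∈-map⁺; ∈-map⁻; ∈-++⁺ˡ; ∈-++⁺ʳ; ∈-filter⁺; ∈-filter⁻; ∈-cartesianProduct⁺)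
import Data.List.Relation.Unary.All as All
open import Data.List.Relation.Unary.Any using (here; there)
open import Data.Sum using (_⊎_; inj₁; inj₂; [_,_]′) renaming (map to ⊎-map)
open import Data.Vec using (Vec; []; _∷_; here; there; tail; tabulate)
import Data.Vec as Vec
import Data.Vec.Membership.Propositional as Vec
import Data.Vec.Relation.Unary.Any as AnyV
open import Data.Vec.Properties using (lookup⇒[]=; []=⇒lookup; lookup∘tabulate; ≡-dec)
open import Algebra.Properties.CommutativeMonoid.Sum ℚ.+-0-commutativeMonoid using (sum; sum-cong-≗)
open import Relation.Binary.Construct.Closure.ReflexiveTransitive using (Star; _◅_; _◅◅_) renaming (ε to nil)
open import Relation.Binary.Definitions using (DecidableEquality; Symmetric)
open import Function using (_∘_; id)
open import Relation.Binary.PropositionalEquality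
open import Relation.Nullary using (¬_; Dec; yes; no; does; contradiction)
open import Relation.Nullary.Decidable using (dec-true; map′; _×-dec_; _⊎-dec_; _→-dec_; ¬?)

-- The constant k + 1 is exactly what two uses of acyclic carriers require. Over a flat `∁ I` of
-- rank ρ, a basis extending a maximal independent subset of the flat leaves |I| - k + ρ elements of
-- I uncovered, so the join over I is acyclic in sizes below η + |I| - k + ρ, hence up to size |I|.
-- Size |I| - 1 serves the chain map, size |I| the homotopy. In the homotopical case the obstacle is
-- constructive. Whether a real coordinate vanishes is undecidable, so maps cannot be glued by cases
-- along a closed subset. The retraction used instead moves points, and a map on the cone cannot be
-- kept equal to the identity on the base. That supports do not grow there survives every gluing,
-- and Sperner's lemma needs no more. Labels are only taken at rational points, where membership in
-- the cone is decidable. In the estimates powers of ½ take the place of 1/k.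

private
  variable
    m n : ℕ

open +-*-Solver using (solve; _:+_; _:-_; _:*_; :-_; _:=_; con)

-- Chains and boundaries

lin-0 : ∀ a b → 0ℚ ≡ a ℚ.* 0ℚ ℚ.+ b ℚ.* 0ℚ
lin-0 = solve 2 (λ a b → con 0ℚ := a :* con 0ℚ :+ b :* con 0ℚ) refl

lin-+ : ∀ a b x y x' y' → (a ℚ.* x ℚ.+ b ℚ.* y) ℚ.+ (a ℚ.* x' ℚ.+ b ℚ.* y') ≡ a ℚ.* (x ℚ.+ x') ℚ.+ b ℚ.* (y ℚ.+ y')
lin-+ = solve 6 (λ a b x y x' y' → (a :* x :+ b :* y) :+ (a :* x' :+ b :* y') := a :* (x :+ x') :+ b :* (y :+ y')) refl

lin-neg : ∀ a b x y → ℚ.- (a ℚ.* x ℚ.+ b ℚ.* y) ≡ a ℚ.* (ℚ.- x) ℚ.+ b ℚ.* (ℚ.- y)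
lin-neg = solve 4 (λ a b x y → :- (a :* x :+ b :* y) := a :* (:- x) :+ b :* (:- y)) refl

-- Sums, differences and negatives are fed to the operators below as linear combinations, so that
-- each operator needs only one linearity lemma.
+≡lin : ∀ x y → x ℚ.+ y ≡ 1ℚ ℚ.* x ℚ.+ 1ℚ ℚ.* y
+≡lin = solve 2 (λ x y → x :+ y := con 1ℚ :* x :+ con 1ℚ :* y) refl

-≡lin : ∀ x y → x ℚ.- y ≡ 1ℚ ℚ.* x ℚ.+ ℚ.- 1ℚ ℚ.* y
-≡lin = solve 2 (λ x y → x :- y := con 1ℚ :* x :+ con (ℚ.- 1ℚ) :* y) refl

neg≡lin : ∀ x → ℚ.- x ≡ ℚ.- 1ℚ ℚ.* x ℚ.+ 0ℚ ℚ.* x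
neg≡lin = solve 1 (λ x → :- x := con (ℚ.- 1ℚ) :* x :+ con 0ℚ :* x) refl

Chain : ℕ → Set
Chain n = Subset n → ℚ

-- The recursion splits off the vertex `zero`; moving past it costs the sign in the last clause.
-- Inductions on subsets then replace the finite sum and `sign` in `∂`.
∂ʳ : Chain n → Chain n
∂ʳ c []            = 0ℚ
∂ʳ c (outside ∷ τ) = c (inside ∷ τ) ℚ.+ ∂ʳ (c ∘ (outside ∷_)) τ
∂ʳ c (inside ∷ τ)  = ℚ.- ∂ʳ (c ∘ (inside ∷_)) τ

sum-neg : (f : Fin n → ℚ) → sum (λ v → ℚ.- f v) ≡ ℚ.- sum f
sum-neg {zero}  f = refl
sum-neg {suc n} f = trans (cong (ℚ.- f zero ℚ.+_) (sum-neg (f ∘ suc)))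
                          (sym (ℚ.neg-distrib-+ (f zero) (sum (f ∘ suc))))

∂≗∂ʳ : (c : Chain n) → ∀ τ → ∂ c τ ≡ ∂ʳ c τ
∂≗∂ʳ c [] = refl
∂≗∂ʳ c (outside ∷ τ) = cong₂ ℚ._+_
  (trans (ℚ.*-identityˡ _) (cong (c ∘ (inside ∷_)) (∪-identityʳ τ)))
  (∂≗∂ʳ (c ∘ (outside ∷_)) τ)
∂≗∂ʳ c (inside ∷ τ) = trans (ℚ.+-identityˡ _)
  (trans (sum-cong-≗ term)
    (trans (sum-neg λ v → if does (v ∈? τ) then 0ℚ else sign τ v ℚ.* c (inside ∷ (τ ∪ ⁅ v ⁆)))
           (cong ℚ.-_ (∂≗∂ʳ (c ∘ (inside ∷_)) τ))))
  where
  term : ∀ v → (if does (v ∈? τ) then 0ℚ else (ℚ.- sign τ v) ℚ.* c (inside ∷ (τ ∪ ⁅ v ⁆))) ≡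
               ℚ.- (if does (v ∈? τ) then 0ℚ else sign τ v ℚ.* c (inside ∷ (τ ∪ ⁅ v ⁆)))
  term v with does (v ∈? τ)
  ... | true  = refl
  ... | false = sym (ℚ.neg-distribˡ-* (sign τ v) _)

∂ʳ-cong : {c d : Chain n} → (∀ σ → c σ ≡ d σ) → ∀ τ → ∂ʳ c τ ≡ ∂ʳ d τ
∂ʳ-cong c≗d []            = refl
∂ʳ-cong c≗d (outside ∷ τ) = cong₂ ℚ._+_ (c≗d _) (∂ʳ-cong (c≗d ∘ (outside ∷_)) τ)
∂ʳ-cong c≗d (inside ∷ τ)  = cong ℚ.-_ (∂ʳ-cong (c≗d ∘ (inside ∷_)) τ)

∂ʳ-linear : ∀ a b (c d : Chain n) τ →
            ∂ʳ (λ σ → a ℚ.* c σ ℚ.+ b ℚ.* d σ) τ ≡ a ℚ.* ∂ʳ c τ ℚ.+ b ℚ.* ∂ʳ d τ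
∂ʳ-linear a b c d [] = lin-0 a b
∂ʳ-linear a b c d (outside ∷ τ) = trans (cong (a ℚ.* c (inside ∷ τ) ℚ.+ b ℚ.* d (inside ∷ τ) ℚ.+_)
         (∂ʳ-linear a b (c ∘ (outside ∷_)) (d ∘ (outside ∷_)) τ))
  (lin-+
    a b (c (inside ∷ τ)) (d (inside ∷ τ)) (∂ʳ (c ∘ (outside ∷_)) τ) (∂ʳ (d ∘ (outside ∷_)) τ))
∂ʳ-linear a b c d (inside ∷ τ) = trans (cong ℚ.-_ (∂ʳ-linear a b (c ∘ (inside ∷_)) (d ∘ (inside ∷_)) τ))
  (lin-neg
    a b (∂ʳ (c ∘ (inside ∷_)) τ) (∂ʳ (d ∘ (inside ∷_)) τ))

∂ʳ-0 : {c : Chain n} → (∀ σ → c σ ≡ 0ℚ) → ∀ τ → ∂ʳ c τ ≡ 0ℚ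
∂ʳ-0 c≡0 []            = refl
∂ʳ-0 c≡0 (outside ∷ τ) = cong₂ ℚ._+_ (c≡0 _) (∂ʳ-0 (c≡0 ∘ (outside ∷_)) τ)
∂ʳ-0 c≡0 (inside ∷ τ)  = cong ℚ.-_ (∂ʳ-0 (c≡0 ∘ (inside ∷_)) τ)

-- Joins with a matroid complex

∣p∪⁅x⁆∣ : ∀ (p : Subset n) {x} → x ∉ p → ∣ p ∪ ⁅ x ⁆ ∣ ≡ suc ∣ p ∣
∣p∪⁅x⁆∣ (outside ∷ p) {zero}  x∉p = cong (suc ∘ ∣_∣) (∪-identityʳ p)
∣p∪⁅x⁆∣ (inside  ∷ p) {zero}  x∉p = contradiction here x∉p
∣p∪⁅x⁆∣ (outside ∷ p) {suc x} x∉p = ∣p∪⁅x⁆∣ p (x∉p ∘ there)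
∣p∪⁅x⁆∣ (inside  ∷ p) {suc x} x∉p = cong suc (∣p∪⁅x⁆∣ p (x∉p ∘ there))

-- Two-variable chains model chains on the join of two complexes; D is the
-- boundary of the join, the vertices of the first factor coming first.
BiChain : ℕ → ℕ → Set
BiChain m n = Subset m → Subset n → ℚ

D : BiChain m n → BiChain m n
D z []            σ = ∂ʳ (z []) σ
D z (outside ∷ τ) σ = z (inside ∷ τ) σ ℚ.+ D (z ∘ (outside ∷_)) τ σ
D z (inside ∷ τ)  σ = ℚ.- D (z ∘ (inside ∷_)) τ σ

D-cong : {z w : BiChain m n} → (∀ τ σ → z τ σ ≡ w τ σ) → ∀ τ σ → D z τ σ ≡ D w τ σ
D-cong z≗w []            σ = ∂ʳ-cong (z≗w []) σ
D-cong z≗w (outside ∷ τ) σ = cong₂ ℚ._+_ (z≗w _ σ) (D-cong (z≗w ∘ (outside ∷_)) τ σ)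
D-cong z≗w (inside ∷ τ)  σ = cong ℚ.-_ (D-cong (z≗w ∘ (inside ∷_)) τ σ)

D-0 : {z : BiChain m n} → (∀ τ σ → z τ σ ≡ 0ℚ) → ∀ τ σ → D z τ σ ≡ 0ℚ
D-0 z≡0 []            σ = ∂ʳ-0 (z≡0 []) σ
D-0 z≡0 (outside ∷ τ) σ = cong₂ ℚ._+_ (z≡0 _ σ) (D-0 (z≡0 ∘ (outside ∷_)) τ σ)
D-0 z≡0 (inside ∷ τ)  σ = cong ℚ.-_ (D-0 (z≡0 ∘ (inside ∷_)) τ σ)

D-linear : ∀ a b (z w : BiChain m n) τ σ →
           D (λ τ σ → a ℚ.* z τ σ ℚ.+ b ℚ.* w τ σ) τ σ ≡ a ℚ.* D z τ σ ℚ.+ b ℚ.* D w τ σ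
D-linear a b z w [] σ = ∂ʳ-linear a b (z []) (w []) σ
D-linear a b z w (outside ∷ τ) σ = trans (cong (a ℚ.* z (inside ∷ τ) σ ℚ.+ b ℚ.* w (inside ∷ τ) σ ℚ.+_)
         (D-linear a b (z ∘ (outside ∷_)) (w ∘ (outside ∷_)) τ σ))
  (lin-+
    a b (z (inside ∷ τ) σ) (w (inside ∷ τ) σ)
    (D (z ∘ (outside ∷_)) τ σ) (D (w ∘ (outside ∷_)) τ σ))
D-linear a b z w (inside ∷ τ) σ = trans (cong ℚ.-_ (D-linear a b (z ∘ (inside ∷_)) (w ∘ (inside ∷_)) τ σ))
  (lin-neg
    a b (D (z ∘ (inside ∷_)) τ σ) (D (w ∘ (inside ∷_)) τ σ))

D-+ : (z w : BiChain m n) → ∀ τ σ → D (λ τ σ → z τ σ ℚ.+ w τ σ) τ σ ≡ D z τ σ ℚ.+ D w τ σ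
D-+ z w τ σ = trans (D-cong (λ τ σ → +≡lin (z τ σ) (w τ σ)) τ σ)
                    (trans (D-linear 1ℚ 1ℚ z w τ σ) (sym (+≡lin (D z τ σ) (D w τ σ))))

D-neg : (z : BiChain m n) → ∀ τ σ → D (λ τ σ → ℚ.- z τ σ) τ σ ≡ ℚ.- D z τ σ
D-neg z τ σ = trans (D-cong (λ τ σ → neg≡lin (z τ σ)) τ σ)
                    (trans (D-linear (ℚ.- 1ℚ) 0ℚ z z τ σ) (sym (neg≡lin (D z τ σ))))

-- Degrees are counted by cardinality: a chain of size s has dimension s - 1.
IsChainOf : Complex n → ℕ → Chain n → Set
IsChainOf K s c = ∀ σ → ¬ (Face K σ × ∣ σ ∣ ≡ s) → c σ ≡ 0ℚ

Fills : Complex n → ℕ → Set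
Fills K s = ∀ z → IsChainOf K s z → (∀ τ → ∂ʳ z τ ≡ 0ℚ) →
            ∃[ b ] IsChainOf K (suc s) b × (∀ σ → ∂ʳ b σ ≡ z σ)

IsBiChainOf : Complex m → Complex n → ℕ → BiChain m n → Set
IsBiChainOf N K s z = ∀ τ σ → ¬ (Face N τ × Face K σ × ∣ τ ∣ + ∣ σ ∣ ≡ s) → z τ σ ≡ 0ℚ

JoinFills : Complex m → Complex n → ℕ → Set
JoinFills N K s = ∀ z → IsBiChainOf N K s z → (∀ τ σ → D z τ σ ≡ 0ℚ) →
                  ∃[ b ] IsBiChainOf N K (suc s) b × (∀ τ σ → D b τ σ ≡ z τ σ)

delete link : Complex (suc n) → Complex n
delete N .Face τ = Face N (outside ∷ τ)
delete N .face? τ = face? N (outside ∷ τ)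
delete N .down-closed τ⊆σ = down-closed N (s⊆s τ⊆σ)
link N .Face τ = Face N (inside ∷ τ)
link N .face? τ = face? N (inside ∷ τ)
link N .down-closed τ⊆σ = down-closed N (s⊆s τ⊆σ)

-x≡0⇒x≡0 : ∀ {x} → ℚ.- x ≡ 0ℚ → x ≡ 0ℚ
-x≡0⇒x≡0 {x} eq = trans (solve 1 (λ x → x := :- (:- x)) refl x) (cong ℚ.-_ eq)

module _ (N : Complex (suc m)) (K : Complex n) where

  -- `N` is the union of its deletion and the cone with apex `zero` over its link. The part of a
  -- cycle at the apex is a cycle over the link; coning a filling of that part pushes the cycle into
  -- the deletion.
  JoinFills-step : ∀ {s} → JoinFills (delete N) K s →
                   (∀ s' → s ≡ suc s' → JoinFills (link N) K s') → JoinFills N K s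
  JoinFills-step {s} fill-del fill-link z z-on Dz≡0 = b , b-on , Db≡z
    where
    z₀ z₁ : BiChain m n
    z₀ = z ∘ (outside ∷_)
    z₁ = z ∘ (inside ∷_)

    Dz₁≡0 : ∀ τ σ → D z₁ τ σ ≡ 0ℚ
    Dz₁≡0 τ σ = -x≡0⇒x≡0 (Dz≡0 (inside ∷ τ) σ)

    fill₁ : ∀ s → (∀ s' → s ≡ suc s' → JoinFills (link N) K s') → IsBiChainOf N K s z →
            ∃[ w ] IsBiChainOf (link N) K s w × (∀ τ σ → D w τ σ ≡ z₁ τ σ)
    -- A chain of size 0 has no simplex through the apex.
    fill₁ zero    _    on = (λ _ _ → 0ℚ) , (λ _ _ _ → refl) ,
      λ τ σ → trans (D-0 (λ _ _ → refl) τ σ) (sym (on (inside ∷ τ) σ λ { (_ , _ , ()) }))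
    fill₁ (suc s) fill on = fill s refl z₁
      (λ τ σ ¬f → on (inside ∷ τ) σ λ { (f , g , eq) → ¬f (f , g , ℕ.suc-injective eq) }) Dz₁≡0

    w = proj₁ (fill₁ s fill-link z-on)
    w-on = proj₁ (proj₂ (fill₁ s fill-link z-on))
    Dw≡z₁ = proj₂ (proj₂ (fill₁ s fill-link z-on))

    -- `z` plus the boundary of the cone over `w`: the terms through the apex cancel.
    y : BiChain m n
    y τ σ = z₀ τ σ ℚ.+ w τ σ

    y-on : IsBiChainOf (delete N) K s y
    y-on τ σ ¬f = cong₂ ℚ._+_ (z-on (outside ∷ τ) σ ¬f)
      (w-on τ σ λ { (f , g) → ¬f (down-closed N (out⊆ ⊆-refl) f , g) })

    Dy≡0 : ∀ τ σ → D y τ σ ≡ 0ℚ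
    Dy≡0 τ σ = trans (D-+ z₀ w τ σ) (trans (cong (D z₀ τ σ ℚ.+_) (Dw≡z₁ τ σ))
      (trans (ℚ.+-comm (D z₀ τ σ) (z₁ τ σ)) (Dz≡0 (outside ∷ τ) σ)))

    u = proj₁ (fill-del y y-on Dy≡0)
    u-on = proj₁ (proj₂ (fill-del y y-on Dy≡0))
    Du≡y = proj₂ (proj₂ (fill-del y y-on Dy≡0))

    b : BiChain (suc m) n
    b (outside ∷ τ) σ = u τ σ
    b (inside ∷ τ)  σ = ℚ.- w τ σ

    b-on : IsBiChainOf N K (suc s) b
    b-on (outside ∷ τ) σ ¬f = u-on τ σ ¬f
    b-on (inside ∷ τ)  σ ¬f = cong ℚ.-_
      (w-on τ σ λ { (f , g , eq) → ¬f (f , g , cong suc eq) })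

    Db≡z : ∀ τ σ → D b τ σ ≡ z τ σ
    Db≡z (outside ∷ τ) σ = trans (cong (ℚ.- w τ σ ℚ.+_) (Du≡y τ σ))
      (solve 2 (λ w z → :- w :+ (z :+ w) := z) refl (w τ σ) (z₀ τ σ))
    Db≡z (inside ∷ τ)  σ = trans (cong ℚ.-_ (trans (D-neg w τ σ) (cong ℚ.-_ (Dw≡z₁ τ σ))))
      (solve 1 (λ z → :- (:- z) := z) refl (z₁ τ σ))

  JoinFills-cone : (∀ τ → Face N (outside ∷ τ) → Face N (inside ∷ τ)) → ∀ s → JoinFills N K s
  JoinFills-cone apex s z z-on Dz≡0 = b , b-on , Db≡z
    where
    b : BiChain (suc m) n
    b (outside ∷ τ) σ = 0ℚ
    b (inside ∷ τ)  σ = z (outside ∷ τ) σ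

    b-on : IsBiChainOf N K (suc s) b
    b-on (outside ∷ τ) σ ¬f = refl
    b-on (inside ∷ τ)  σ ¬f = z-on (outside ∷ τ) σ
      λ { (f , g , eq) → ¬f (apex τ f , g , cong suc eq) }

    Db≡z : ∀ τ σ → D b τ σ ≡ z τ σ
    Db≡z (outside ∷ τ) σ = trans (cong (z (outside ∷ τ) σ ℚ.+_) (D-0 (λ _ _ → refl) τ σ))
                                 (ℚ.+-identityʳ _)
    Db≡z (inside ∷ τ)  σ = trans
      (solve 2 (λ d z → :- d := z :- (z :+ d)) refl
        (D (z ∘ (outside ∷_)) τ σ) (z (inside ∷ τ) σ))
      (trans (cong (λ e → z (inside ∷ τ) σ ℚ.- e) (Dz≡0 (outside ∷ τ) σ)) (ℚ.+-identityʳ _))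

-- Deleting or contracting an earlier vertex leaves `x` a cone point, so `JoinFills-step` reduces to
-- the case that `x` is the first vertex.
JoinFills-coloop : (N : Complex m) (K : Complex n) (x : Fin m) →
                   (∀ τ → Face N τ → Face N (τ ∪ ⁅ x ⁆)) → ∀ s → JoinFills N K s
JoinFills-coloop {suc m} N K zero coloop =
  JoinFills-cone N K λ τ f → subst (Face N ∘ (inside ∷_)) (∪-identityʳ τ) (coloop (outside ∷ τ) f)
JoinFills-coloop {suc m} N K (suc x) coloop s = JoinFills-step N K
  (JoinFills-coloop (delete N) K x (coloop ∘ (outside ∷_)) s)
  (λ s' _ → JoinFills-coloop (link N) K x (coloop ∘ (inside ∷_)) s')

Augments : Complex n → Set
Augments N = ∀ {A B} → Face N A → Face N B → ∣ A ∣ ℕ.< ∣ B ∣ →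
             ∃[ x ] x ∈ B × x ∉ A × Face N (A ∪ ⁅ x ⁆)

module _ {N : Complex n} (aug : Augments N) where

  -- The inclusion in `A ∪ B` keeps later exchanges inside prescribed sets, such as the complement
  -- of a dual face.
  extend : ∀ {A B} → Face N A → Face N B → ∣ A ∣ ≤ ∣ B ∣ →
           ∃[ A' ] A ⊆ A' × A' ⊆ A ∪ B × Face N A' × ∣ A' ∣ ≡ ∣ B ∣
  extend {A} {B} fA fB A≤B = go (∣ B ∣ ∸ ∣ A ∣) fA (ℕ.m+[n∸m]≡n A≤B)
    where
    go : ∀ d {A} → Face N A → ∣ A ∣ + d ≡ ∣ B ∣ →
         ∃[ A' ] A ⊆ A' × A' ⊆ A ∪ B × Face N A' × ∣ A' ∣ ≡ ∣ B ∣
    go zero    {A} fA eq = A , id , p⊆p∪q B , fA , trans (sym (ℕ.+-identityʳ _)) eq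
    go (suc d) {A} fA eq with aug fA fB (subst (∣ A ∣ ℕ.<_) eq (ℕ.m<m+n ∣ A ∣ (ℕ.s≤s ℕ.z≤n)))
    ... | x , x∈B , x∉A , fAx with go d fAx (trans (cong (_+ d) (∣p∪⁅x⁆∣ A x∉A)) (trans (sym (ℕ.+-suc _ d)) eq))
    ... | A' , Ax⊆A' , A'⊆ , fA' , eq' = A' , Ax⊆A' ∘ p⊆p∪q ⁅ x ⁆ , A'⊆A∪B , fA' , eq'
      where
      A'⊆A∪B : A' ⊆ A ∪ B
      A'⊆A∪B y∈A' with x∈p∪q⁻ (A ∪ ⁅ x ⁆) B (A'⊆ y∈A')
      ... | inj₂ y∈B = q⊆p∪q A B y∈B
      ... | inj₁ y∈Ax with x∈p∪q⁻ A ⁅ x ⁆ y∈Ax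
      ...   | inj₁ y∈A = p⊆p∪q B y∈A
      ...   | inj₂ y∈x = q⊆p∪q A B (subst (_∈ B) (sym (x∈⁅y⁆⇒x≡y x y∈x)) x∈B)

delete-augments : {N : Complex (suc n)} → Augments N → Augments (delete N)
delete-augments aug fA fB A<B with aug fA fB A<B
... | suc x , there x∈B , x∉A , f = x , x∈B , x∉A ∘ there , f

link-augments : {N : Complex (suc n)} → Augments N → Augments (link N)
link-augments aug fA fB A<B with aug fA fB (ℕ.s≤s A<B)
... | zero  , _         , x∉A , f = contradiction here x∉A
... | suc x , there x∈B , x∉A , f = x , x∈B , x∉A ∘ there , f

-- Deletion and contraction of the first element. A loop has an empty link. If some independent set
-- avoiding the element is as large as `B`, the deletion keeps the bound, and in the link `s` and
-- the rank both drop by one. Otherwise the element extends every face that avoids it, and the join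
-- is a cone.
JoinFills-matroid : (N : Complex m) → Augments N → (K : Complex n) → ∀ {a} → (∀ p → p ℕ.< a → Fills K p) →
                    ∀ {B} → Face N B → ∀ s → s ℕ.< a + ∣ B ∣ → JoinFills N K s
JoinFills-matroid {zero} N aug K {a} fill {[]} fB s s< z z-on Dz≡0
  with fill s (subst (s ℕ.<_) (ℕ.+-identityʳ a) s<) (z [])
         (λ σ ¬f → z-on [] σ (¬f ∘ proj₂)) (Dz≡0 [])
... | b , b-on , ∂b≡z = (λ _ → b) ,
  (λ { [] σ ¬f → b-on σ λ { (f , eq) → ¬f (fB , f , eq) } }) , λ { [] σ → ∂b≡z σ }
JoinFills-matroid {suc m} N aug K {a} fill {B} fB s s< with face? N (inside ∷ ⊥)
... | no loop = JoinFills-step N K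
  (JoinFills-matroid (delete N) (delete-augments {N = N} aug) K fill (proj₁ (outside-B B fB)) s
    (subst (λ b → s ℕ.< a + b) (proj₂ (outside-B B fB)) s<))
  (λ s' _ z z-on _ → (λ _ _ → 0ℚ) , (λ _ _ _ → refl) ,
    λ τ σ → trans (D-0 (λ _ _ → refl) τ σ)
                  (sym (z-on τ σ λ { (f , _) → loop (down-closed N (s⊆s (⊆-min τ)) f) })))
  where
  outside-B : ∀ B → Face N B → Face N (outside ∷ tail B) × ∣ B ∣ ≡ ∣ tail B ∣
  outside-B (outside ∷ B) f = f , refl
  outside-B (inside  ∷ B) f = contradiction (down-closed N (s⊆s (⊆-min B)) f) loop
... | yes nonloop with anySubset? (λ A → face? (delete N) A ×-dec (∣ B ∣ ℕ.≤? ∣ A ∣))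
...   | yes (A , fA , B≤A) = JoinFills-step N K
  (JoinFills-matroid (delete N) (delete-augments {N = N} aug) K fill fA s (ℕ.<-≤-trans s< (ℕ.+-monoʳ-≤ a B≤A)))
  (contract B fB s<)
  where
  contract : ∀ B → Face N B → s ℕ.< a + ∣ B ∣ → ∀ s' → s ≡ suc s' → JoinFills (link N) K s'
  contract B fB s< s' refl with ∣ B ∣ ℕ.≟ 0
  -- No rank is left to lose; the drop of `s` is enough.
  ... | yes B≡0 = JoinFills-matroid (link N) (link-augments {N = N} aug) K fill nonloop s'
          (ℕ.<-≤-trans (ℕ.<-trans (ℕ.n<1+n s') s<) (ℕ.+-monoʳ-≤ a (subst (_≤ _) (sym B≡0) ℕ.z≤n)))
  ... | no B≢0 with extend {N = N} aug nonloop fB (subst (_≤ ∣ B ∣) (sym (cong suc (∣⊥∣≡0 m))) (ℕ.n≢0⇒n>0 B≢0))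
  ...   | outside ∷ A' , ⊆A' , _ , fA' , eq = contradiction (⊆A' here) λ ()
  ...   | inside  ∷ A' , ⊆A' , _ , fA' , eq =
    JoinFills-matroid (link N) (link-augments {N = N} aug) K fill fA' s'
      (ℕ.≤-pred (subst (suc s' ℕ.<_) (trans (cong (a +_) (sym eq)) (ℕ.+-suc a ∣ A' ∣)) s<))
...   | no no-big = JoinFills-cone N K apex s
  where
  small : ∀ τ → Face N (outside ∷ τ) → ∣ τ ∣ ℕ.< ∣ B ∣
  small τ f = ℕ.≰⇒> λ B≤τ → no-big (τ , f , B≤τ)

  -- An extension to size |B| must contain the first element, as independent sets avoiding it are
  -- smaller.
  apex : ∀ τ → Face N (outside ∷ τ) → Face N (inside ∷ τ)
  apex τ f with extend {N = N} aug f fB (ℕ.<⇒≤ (small τ f))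
  ... | inside  ∷ A' , τ⊆A' , _ , fA' , eq = down-closed N (s⊆s (drop-∷-⊆ τ⊆A')) fA'
  ... | outside ∷ A' , τ⊆A' , _ , fA' , eq = contradiction (subst (∣ A' ∣ ℕ.<_) (sym eq) (small A' fA')) (ℕ.<-irrefl refl)

-- Cones and acyclic carriers

-- Left exterior multiplication by the vertex `v`: simplices containing `v` go to 0, the others to
-- their cone with apex `v`.
wedge : Fin n → Chain n → Chain n
wedge zero    c (outside ∷ τ) = 0ℚ
wedge zero    c (inside ∷ τ)  = c (outside ∷ τ)
wedge (suc v) c (outside ∷ τ) = wedge v (c ∘ (outside ∷_)) τ
wedge (suc v) c (inside ∷ τ)  = ℚ.- wedge v (c ∘ (inside ∷_)) τ

wedge-cong : ∀ v {c d : Chain n} → (∀ σ → c σ ≡ d σ) → ∀ τ → wedge v c τ ≡ wedge v d τ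
wedge-cong zero    c≗d (outside ∷ τ) = refl
wedge-cong zero    c≗d (inside ∷ τ)  = c≗d (outside ∷ τ)
wedge-cong (suc v) c≗d (outside ∷ τ) = wedge-cong v (c≗d ∘ (outside ∷_)) τ
wedge-cong (suc v) c≗d (inside ∷ τ)  = cong ℚ.-_ (wedge-cong v (c≗d ∘ (inside ∷_)) τ)

wedge-linear : ∀ v a b (c d : Chain n) τ →
               wedge v (λ σ → a ℚ.* c σ ℚ.+ b ℚ.* d σ) τ ≡ a ℚ.* wedge v c τ ℚ.+ b ℚ.* wedge v d τ
wedge-linear zero    a b c d (outside ∷ τ) =
  lin-0 a b
wedge-linear zero    a b c d (inside ∷ τ)  = refl
wedge-linear (suc v) a b c d (outside ∷ τ) = wedge-linear v a b (c ∘ (outside ∷_)) (d ∘ (outside ∷_)) τ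
wedge-linear (suc v) a b c d (inside ∷ τ)  =
  trans (cong ℚ.-_ (wedge-linear v a b (c ∘ (inside ∷_)) (d ∘ (inside ∷_)) τ))
    (lin-neg
      a b (wedge v (c ∘ (inside ∷_)) τ) (wedge v (d ∘ (inside ∷_)) τ))

wedge-0 : ∀ v (c : Chain n) τ → (∀ ρ → τ ≡ ρ ∪ ⁅ v ⁆ → ∣ τ ∣ ≡ suc ∣ ρ ∣ → c ρ ≡ 0ℚ) → wedge v c τ ≡ 0ℚ
wedge-0 zero    c (outside ∷ τ) h = refl
wedge-0 zero    c (inside ∷ τ)  h = h (outside ∷ τ) (cong (inside ∷_) (sym (∪-identityʳ τ))) refl
wedge-0 (suc v) c (outside ∷ τ) h = wedge-0 v (c ∘ (outside ∷_)) τ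
  λ ρ eq → h (outside ∷ ρ) (cong (outside ∷_) eq)
wedge-0 (suc v) c (inside ∷ τ)  h = cong ℚ.-_ (wedge-0 v (c ∘ (inside ∷_)) τ
  λ ρ eq size → h (inside ∷ ρ) (cong (inside ∷_) eq) (cong suc size))

-- The Leibniz rule, with the augmentation sending `v` to 1. Coning is thus a contracting homotopy.
∂-wedge : ∀ v (c : Chain n) τ → ∂ʳ (wedge v c) τ ≡ c τ ℚ.- wedge v (∂ʳ c) τ
∂-wedge zero c (outside ∷ τ) = cong (c (outside ∷ τ) ℚ.+_) (∂ʳ-0 (λ _ → refl) τ)
∂-wedge zero c (inside ∷ τ) =
  solve 2 (λ x y → :- y := x :- (x :+ y)) refl (c (inside ∷ τ)) (∂ʳ (c ∘ (outside ∷_)) τ)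
∂-wedge (suc v) c (outside ∷ τ) = trans
  (cong (ℚ.- wedge v (c ∘ (inside ∷_)) τ ℚ.+_) (∂-wedge v (c ∘ (outside ∷_)) τ))
  (trans
    (solve 3 (λ w x y → :- w :+ (x :- y) := x :- (con 1ℚ :* w :+ con 1ℚ :* y)) refl
      (wedge v (c ∘ (inside ∷_)) τ) (c (outside ∷ τ)) (wedge v (∂ʳ (c ∘ (outside ∷_))) τ))
    (cong (λ w → c (outside ∷ τ) ℚ.- w)
      (trans (sym (wedge-linear v 1ℚ 1ℚ (c ∘ (inside ∷_)) (∂ʳ (c ∘ (outside ∷_))) τ))
        (wedge-cong v (λ σ → cong₂ ℚ._+_ (ℚ.*-identityˡ (c (inside ∷ σ)))
                                         (ℚ.*-identityˡ (∂ʳ (c ∘ (outside ∷_)) σ))) τ))))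
∂-wedge (suc v) c (inside ∷ τ) = trans
  (cong ℚ.-_ (trans (∂ʳ-cong -1* τ) (∂ʳ-linear (ℚ.- 1ℚ) 0ℚ w₁ w₁ τ)))
  (trans (cong (λ x → ℚ.- (ℚ.- 1ℚ ℚ.* x ℚ.+ 0ℚ ℚ.* x)) (∂-wedge v (c ∘ (inside ∷_)) τ))
    (trans
      (solve 2 (λ x y → :- (con (ℚ.- 1ℚ) :* (x :- y) :+ con 0ℚ :* (x :- y)) :=
                        x :- (:- (con (ℚ.- 1ℚ) :* y :+ con 0ℚ :* y))) refl
        (c (inside ∷ τ)) (wedge v ∂c₁ τ))
      (cong (λ x → c (inside ∷ τ) ℚ.- (ℚ.- x))
        (trans (sym (wedge-linear v (ℚ.- 1ℚ) 0ℚ ∂c₁ ∂c₁ τ))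
               (wedge-cong v (λ σ → sym (neg≡lin (∂c₁ σ))) τ)))))
  where
  w₁ = wedge v (c ∘ (inside ∷_))
  ∂c₁ = ∂ʳ (c ∘ (inside ∷_))

  -1* : ∀ σ → ℚ.- w₁ σ ≡ ℚ.- 1ℚ ℚ.* w₁ σ ℚ.+ 0ℚ ℚ.* w₁ σ
  -1* σ = neg≡lin (w₁ σ)

cycle-∂-wedge : ∀ v {c : Chain n} → (∀ τ → ∂ʳ c τ ≡ 0ℚ) → ∀ τ → ∂ʳ (wedge v c) τ ≡ c τ
cycle-∂-wedge v {c} ∂c≡0 τ = trans (∂-wedge v c τ)
  (trans (cong (λ x → c τ ℚ.- x) (wedge-0 v (∂ʳ c) τ λ ρ _ _ → ∂c≡0 ρ)) (ℚ.+-identityʳ (c τ)))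

-- The closure condition is imposed only on faces of size `s`, so that at size 0 a single vertex of
-- `K` is enough.
Fills-coloop : (K : Complex n) (x : Fin n) → ∀ s →
               (∀ σ → Face K σ → ∣ σ ∣ ≡ s → Face K (σ ∪ ⁅ x ⁆)) → Fills K s
Fills-coloop K x s coloop z z-on ∂z≡0 = wedge x z , on , cycle-∂-wedge x ∂z≡0
  where
  on : IsChainOf K (suc s) (wedge x z)
  on σ ¬f = wedge-0 x z σ λ ρ eq size → z-on ρ λ { (f , ∣ρ∣≡s) →
    ¬f (subst (Face K) (sym eq) (coloop ρ f ∣ρ∣≡s) , trans size (cong suc ∣ρ∣≡s)) }

-- δ f I is the signed sum of the values of f at the facets of I.
δ : (Subset n → ℚ) → Subset n → ℚ
δ f []            = 0ℚ
δ f (outside ∷ I) = δ (f ∘ (outside ∷_)) I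
δ f (inside ∷ I)  = f (outside ∷ I) ℚ.- δ (f ∘ (inside ∷_)) I

δ-cong : {f g : Subset n → ℚ} → ∀ I → (∀ J → J ⊆ I → ∣ I ∣ ≡ suc ∣ J ∣ → f J ≡ g J) → δ f I ≡ δ g I
δ-cong []            h = refl
δ-cong (outside ∷ I) h = δ-cong I λ J J⊆I → h (outside ∷ J) (s⊆s J⊆I)
δ-cong (inside ∷ I)  h = cong₂ ℚ._-_ (h (outside ∷ I) (out⊆ ⊆-refl) refl)
  (δ-cong I λ J J⊆I eq → h (inside ∷ J) (s⊆s J⊆I) (cong suc eq))

δ-const0 : ∀ (I : Subset n) → δ (λ _ → 0ℚ) I ≡ 0ℚ
δ-const0 []            = refl
δ-const0 (outside ∷ I) = δ-const0 I
δ-const0 (inside ∷ I)  = cong (λ x → 0ℚ ℚ.- x) (δ-const0 I)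

δ-0 : {f : Subset n → ℚ} → ∀ I → (∀ J → J ⊆ I → ∣ I ∣ ≡ suc ∣ J ∣ → f J ≡ 0ℚ) → δ f I ≡ 0ℚ
δ-0 I h = trans (δ-cong I h) (δ-const0 I)

δ-linear : ∀ a b (f g : Subset n → ℚ) I →
           δ (λ J → a ℚ.* f J ℚ.+ b ℚ.* g J) I ≡ a ℚ.* δ f I ℚ.+ b ℚ.* δ g I
δ-linear a b f g [] = lin-0 a b
δ-linear a b f g (outside ∷ I) = δ-linear a b (f ∘ (outside ∷_)) (g ∘ (outside ∷_)) I
δ-linear a b f g (inside ∷ I) = trans
  (cong (λ x → a ℚ.* f (outside ∷ I) ℚ.+ b ℚ.* g (outside ∷ I) ℚ.- x)
    (δ-linear a b (f ∘ (inside ∷_)) (g ∘ (inside ∷_)) I))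
  (solve 6 (λ a b x y x' y' → (a :* x :+ b :* y) :- (a :* x' :+ b :* y') :=
                              a :* (x :- x') :+ b :* (y :- y')) refl
    a b (f (outside ∷ I)) (g (outside ∷ I)) (δ (f ∘ (inside ∷_)) I) (δ (g ∘ (inside ∷_)) I))

δ-sub : ∀ (f g : Subset n → ℚ) I → δ (λ J → f J ℚ.- g J) I ≡ δ f I ℚ.- δ g I
δ-sub f g I = trans (δ-cong I λ J _ _ → -≡lin (f J) (g J))
  (trans (δ-linear 1ℚ (ℚ.- 1ℚ) f g I) (sym (-≡lin (δ f I) (δ g I))))

δδ : (f : Subset n → ℚ) → ∀ I → δ (δ f) I ≡ 0ℚ
δδ f []            = refl
δδ f (outside ∷ I) = δδ (f ∘ (outside ∷_)) I
δδ f (inside ∷ I)  = trans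
  (cong (λ x → δ (f ∘ (outside ∷_)) I ℚ.- x)
    (trans (δ-sub (f ∘ (outside ∷_)) (δ (f ∘ (inside ∷_))) I)
           (cong (λ x → δ (f ∘ (outside ∷_)) I ℚ.- x) (δδ (f ∘ (inside ∷_)) I))))
  (solve 1 (λ x → x :- (x :- con 0ℚ) := con 0ℚ) refl (δ (f ∘ (outside ∷_)) I))

D-sub : (z w : BiChain m n) → ∀ τ σ → D (λ τ σ → z τ σ ℚ.- w τ σ) τ σ ≡ D z τ σ ℚ.- D w τ σ
D-sub z w τ σ = trans (D-+ z (λ τ σ → ℚ.- w τ σ) τ σ) (cong (D z τ σ ℚ.+_) (D-neg w τ σ))

Family : ℕ → ℕ → ℕ → Set
Family k m n = Subset k → BiChain m n

D-δ : ∀ {k} (P : Family k m n) I τ σ →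
      D (λ τ σ → δ (λ J → P J τ σ) I) τ σ ≡ δ (λ J → D (P J) τ σ) I
D-δ P []            τ σ = D-0 (λ _ _ → refl) τ σ
D-δ P (outside ∷ I) τ σ = D-δ (P ∘ (outside ∷_)) I τ σ
D-δ P (inside ∷ I)  τ σ = trans
  (D-sub (P (outside ∷ I)) (λ τ σ → δ (λ J → P (inside ∷ J) τ σ) I) τ σ)
  (cong (λ x → D (P (outside ∷ I)) τ σ ℚ.- x) (D-δ (P ∘ (inside ∷_)) I τ σ))

-- Acyclic carriers: a family with prescribed D P = g + s δ P is constructed by
-- induction on the faces I of the simplex, e being the degree of P.
module Carrier {k} (N : Subset k → Complex m) (K : Subset k → Complex n)
  (N-mono : ∀ {I J} → I ⊆ J → ∀ τ → Face (N I) τ → Face (N J) τ)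
  (K-mono : ∀ {I J} → I ⊆ J → ∀ σ → Face (K I) σ → Face (K J) σ)
  (e : ℕ)
  (fill : ∀ I t → ∣ I ∣ ≡ suc t → JoinFills (N I) (K I) (t + e))
  (g : Family k m n) (s : ℚ)
  (g-on : ∀ I t → ∣ I ∣ ≡ suc t → IsBiChainOf (N I) (K I) (t + e) (g I))
  -- With δδ = 0 this makes g + s δP a cycle at I as soon as D P = g + s δP holds on the facets of
  -- I.
  (g-cocycle : ∀ I τ σ → D (g I) τ σ ℚ.+ s ℚ.* δ (λ J → g J τ σ) I ≡ 0ℚ)
  (p : BiChain m n)
  (p-on : IsBiChainOf (N ⊥) (K ⊥) e p)
  (Dp≡g : ∀ τ σ → D p τ σ ≡ g ⊥ τ σ)
  where

  rhs : Family k m n → Family k m n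
  rhs P I τ σ = g I τ σ ℚ.+ s ℚ.* δ (λ J → P J τ σ) I

  Good : Family k m n → Subset k → Set
  Good P I = IsBiChainOf (N I) (K I) (∣ I ∣ + e) (P I) × (∀ τ σ → D (P I) τ σ ≡ rhs P I τ σ)

  module Step (t : ℕ) (P : Family k m n) (good : ∀ I → ∣ I ∣ ≤ t → Good P I) where

    rhs-on : ∀ I → ∣ I ∣ ≡ suc t → IsBiChainOf (N I) (K I) (t + e) (rhs P I)
    rhs-on I eq τ σ ¬f = trans
      (cong₂ (λ x y → x ℚ.+ s ℚ.* y) (g-on I t eq τ σ ¬f)
        (δ-0 I λ J J⊆I eq' → proj₁ (good J (ℕ.≤-reflexive (size J eq'))) τ σ
          λ { (f , h , sz) → ¬f (N-mono J⊆I τ f , K-mono J⊆I σ h ,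
                                 trans sz (cong (_+ e) (size J eq'))) }))
      (solve 1 (λ s → con 0ℚ :+ s :* con 0ℚ := con 0ℚ) refl s)
      where
      size : ∀ J → ∣ I ∣ ≡ suc ∣ J ∣ → ∣ J ∣ ≡ t
      size J eq' = ℕ.suc-injective (trans (sym eq') eq)

    Drhs≡0 : ∀ I → ∣ I ∣ ≡ suc t → ∀ τ σ → D (rhs P I) τ σ ≡ 0ℚ
    Drhs≡0 I eq τ σ = begin
      D (rhs P I) τ σ
        ≡⟨ D-cong (λ τ σ → cong (ℚ._+ s ℚ.* δP τ σ) (sym (ℚ.*-identityˡ (g I τ σ)))) τ σ ⟩
      D (λ τ σ → 1ℚ ℚ.* g I τ σ ℚ.+ s ℚ.* δP τ σ) τ σ
        ≡⟨ D-linear 1ℚ s (g I) δP τ σ ⟩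
      1ℚ ℚ.* D (g I) τ σ ℚ.+ s ℚ.* D δP τ σ
        ≡⟨ cong₂ (λ x y → x ℚ.+ s ℚ.* y) (ℚ.*-identityˡ (D (g I) τ σ)) (D-δ P I τ σ) ⟩
      D (g I) τ σ ℚ.+ s ℚ.* δ (λ J → D (P J) τ σ) I
        ≡⟨ cong (λ x → D (g I) τ σ ℚ.+ s ℚ.* x) Dδ≡ ⟩
      D (g I) τ σ ℚ.+ s ℚ.* δ (λ J → g J τ σ) I
        ≡⟨ g-cocycle I τ σ ⟩
      0ℚ ∎
      where
      open ≡-Reasoning
      δP : BiChain m n
      δP τ σ = δ (λ J → P J τ σ) I

      Dδ≡ : δ (λ J → D (P J) τ σ) I ≡ δ (λ J → g J τ σ) I
      Dδ≡ = begin
        δ (λ J → D (P J) τ σ) I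
          ≡⟨ δ-cong I (λ J _ eq' → trans
               (proj₂ (good J (ℕ.≤-reflexive (ℕ.suc-injective (trans (sym eq') eq)))) τ σ)
               (cong (ℚ._+ s ℚ.* δ (λ J → P J τ σ) J) (sym (ℚ.*-identityˡ (g J τ σ))))) ⟩
        δ (λ J → 1ℚ ℚ.* g J τ σ ℚ.+ s ℚ.* δ (λ J → P J τ σ) J) I
          ≡⟨ δ-linear 1ℚ s (λ J → g J τ σ) (δ (λ J → P J τ σ)) I ⟩
        1ℚ ℚ.* δ (λ J → g J τ σ) I ℚ.+ s ℚ.* δ (δ (λ J → P J τ σ)) I
          ≡⟨ cong (λ x → 1ℚ ℚ.* δ (λ J → g J τ σ) I ℚ.+ s ℚ.* x) (δδ (λ J → P J τ σ) I) ⟩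
        1ℚ ℚ.* δ (λ J → g J τ σ) I ℚ.+ s ℚ.* 0ℚ
          ≡⟨ solve 2 (λ x s → con 1ℚ :* x :+ s :* con 0ℚ := x) refl (δ (λ J → g J τ σ) I) s ⟩
        δ (λ J → g J τ σ) I ∎

    filling : ∀ I (eq : ∣ I ∣ ≡ suc t) → ∃[ b ] IsBiChainOf (N I) (K I) (suc (t + e)) b × (∀ τ σ → D b τ σ ≡ rhs P I τ σ)
    filling I eq = fill I t eq (rhs P I) (rhs-on I eq) (Drhs≡0 I eq)

    P⁺ : Family k m n
    P⁺ I with ∣ I ∣ ℕ.≟ suc t
    ... | yes eq = proj₁ (filling I eq)
    ... | no  _  = P I

    P⁺-old : ∀ I → ∣ I ∣ ≤ t → P⁺ I ≡ P I
    P⁺-old I I≤t with ∣ I ∣ ℕ.≟ suc t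
    ... | yes eq = contradiction (subst (_≤ t) eq I≤t) (ℕ.<-irrefl refl)
    ... | no  _  = refl

    rhs⁺ : ∀ I → ∣ I ∣ ≤ suc t → ∀ τ σ → rhs P I τ σ ≡ rhs P⁺ I τ σ
    rhs⁺ I I≤ τ σ = cong (λ x → g I τ σ ℚ.+ s ℚ.* x) (δ-cong I λ J _ eq →
      sym (cong (λ c → c τ σ) (P⁺-old J (ℕ.≤-pred (subst (_≤ suc t) eq I≤)))))

    good⁺ : ∀ I → ∣ I ∣ ≤ suc t → Good P⁺ I
    good⁺ I I≤ with ∣ I ∣ ℕ.≟ suc t | P⁺-old I | rhs⁺ I I≤
    ... | yes eq | _ | r =
      (λ τ σ ¬f → proj₁ (proj₂ (filling I eq)) τ σ
        λ { (f , h , sz) → ¬f (f , h , trans sz (cong (_+ e) (sym eq))) }) ,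
      λ τ σ → trans (proj₂ (proj₂ (filling I eq)) τ σ) (r τ σ)
    ... | no neq | _ | r = proj₁ (good I I≤t) , λ τ σ → trans (proj₂ (good I I≤t) τ σ) (r τ σ)
      where
      I≤t = ℕ.≤-pred (ℕ.≤∧≢⇒< I≤ neq)

  ∣I∣≡0⇒I≡⊥ : ∀ {l} (I : Subset l) → ∣ I ∣ ≡ 0 → I ≡ ⊥
  ∣I∣≡0⇒I≡⊥ []            eq = refl
  ∣I∣≡0⇒I≡⊥ (outside ∷ I) eq = cong (outside ∷_) (∣I∣≡0⇒I≡⊥ I eq)

  build : ∀ t → ∃[ P ] P ⊥ ≡ p × (∀ I → ∣ I ∣ ≤ t → Good P I)
  build zero = (λ _ → p) , refl , λ I I≤0 → start I (∣I∣≡0⇒I≡⊥ I (ℕ.n≤0⇒n≡0 I≤0))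
    where
    start : ∀ I → I ≡ ⊥ → Good (λ _ → p) I
    start I refl =
      (λ τ σ ¬f → p-on τ σ λ { (f , h , sz) → ¬f (f , h , trans sz (cong (_+ e) (sym (∣⊥∣≡0 k)))) }) ,
      λ τ σ → trans (Dp≡g τ σ) (trans
        (solve 2 (λ x s → x := x :+ s :* con 0ℚ) refl (g ⊥ τ σ) s)
        (cong (λ x → g ⊥ τ σ ℚ.+ s ℚ.* x) (sym (δ-0 {n = k} {f = λ _ → p τ σ} ⊥ λ J _ eq → contradiction (trans (sym (∣⊥∣≡0 k)) eq) λ ()))))
  build (suc t) with build t
  ... | P , P⊥≡p , good = P⁺ , trans (P⁺-old ⊥ (subst (_≤ t) (sym (∣⊥∣≡0 k)) ℕ.z≤n)) P⊥≡p , good⁺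
    where open Step t P good

  abstract
    family : ∃[ P ] P ⊥ ≡ p × (∀ I → Good P I)
    family with build k
    ... | P , P⊥≡p , good = P , P⊥≡p , λ I → good I (∣p∣≤n I)

-- Projection of a join to the colours

ε : Subset n → ℚ
ε []            = 1ℚ
ε (outside ∷ τ) = ε τ
ε (inside ∷ τ)  = ℚ.- ε τ

ε²≡1 : (τ : Subset n) → ε τ ℚ.* ε τ ≡ 1ℚ
ε²≡1 []            = refl
ε²≡1 (outside ∷ τ) = ε²≡1 τ
ε²≡1 (inside ∷ τ)  = trans (solve 1 (λ x → (:- x) :* (:- x) := x :* x) refl (ε τ)) (ε²≡1 τ)

-- `ε τ` is the parity sign of |τ|, the price of carrying one vertex across `τ`. It appears when a
-- vertex of the second factor is moved to the front.
twist : BiChain m n → BiChain m n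
twist z τ σ = ε τ ℚ.* z τ σ

D-outside : ∀ (z : BiChain m (suc n)) τ σ →
            D z τ (outside ∷ σ) ≡ ε τ ℚ.* z τ (inside ∷ σ) ℚ.+ D (λ τ σ → z τ (outside ∷ σ)) τ σ
D-outside z [] σ = cong (ℚ._+ ∂ʳ (z [] ∘ (outside ∷_)) σ) (sym (ℚ.*-identityˡ (z [] (inside ∷ σ))))
D-outside z (outside ∷ τ) σ = trans
  (cong (z (inside ∷ τ) (outside ∷ σ) ℚ.+_) (D-outside (z ∘ (outside ∷_)) τ σ))
  (solve 3 (λ a b c → a :+ (b :+ c) := b :+ (a :+ c)) refl
    (z (inside ∷ τ) (outside ∷ σ)) (ε τ ℚ.* z (outside ∷ τ) (inside ∷ σ))
    (D (λ τ σ → z (outside ∷ τ) (outside ∷ σ)) τ σ))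
D-outside z (inside ∷ τ) σ = trans
  (cong ℚ.-_ (D-outside (z ∘ (inside ∷_)) τ σ))
  (solve 3 (λ e a b → :- (e :* a :+ b) := (:- e) :* a :+ (:- b)) refl
    (ε τ) (z (inside ∷ τ) (inside ∷ σ)) (D (λ τ σ → z (inside ∷ τ) (outside ∷ σ)) τ σ))

D-inside : ∀ (z : BiChain m (suc n)) τ σ →
           D z τ (inside ∷ σ) ≡ ℚ.- (ε τ ℚ.* D (twist (λ τ σ → z τ (inside ∷ σ))) τ σ)
D-inside z [] σ = cong ℚ.-_ (trans (sym (ℚ.*-identityˡ (∂ʳ (z [] ∘ (inside ∷_)) σ)))
  (cong (1ℚ ℚ.*_) (∂ʳ-cong (λ σ → sym (ℚ.*-identityˡ (z [] (inside ∷ σ)))) σ)))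
D-inside z (outside ∷ τ) σ = trans
  (cong (z₁₁ ℚ.+_) (D-inside (z ∘ (outside ∷_)) τ σ))
  (trans (cong (ℚ._+ (ℚ.- (ε τ ℚ.* d))) (trans (sym (ℚ.*-identityˡ z₁₁)) (cong (ℚ._* z₁₁) (sym (ε²≡1 τ)))))
    (solve 3 (λ e x d → (e :* e) :* x :+ :- (e :* d) := :- (e :* ((:- e) :* x :+ d))) refl (ε τ) z₁₁ d))
  where
  z₁₁ = z (inside ∷ τ) (inside ∷ σ)
  d = D (twist (λ τ σ → z (outside ∷ τ) (inside ∷ σ))) τ σ
D-inside z (inside ∷ τ) σ = trans
  (cong ℚ.-_ (D-inside (z ∘ (inside ∷_)) τ σ))
  (trans (solve 2 (λ e d → :- (:- (e :* d)) := :- ((:- e) :* (:- (:- d)))) refl (ε τ) d)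
    (cong (λ x → ℚ.- (ℚ.- ε τ ℚ.* ℚ.- x))
      (trans (sym (D-neg (twist z₁) τ σ))
        (D-cong (λ τ σ → ℚ.neg-distribˡ-* (ε τ) (z₁ τ σ)) τ σ))))
  where
  z₁ = λ τ σ → z (inside ∷ τ) (inside ∷ σ)
  d = D (twist z₁) τ σ

-- The simplicial map from the join of two copies of the vertex set to the
-- simplex on it that identifies the two copies of each vertex.
π : BiChain n n → Chain n
π z []            = z [] []
π z (outside ∷ U) = π (λ τ σ → z (outside ∷ τ) (outside ∷ σ)) U
π z (inside ∷ U)  = π (λ τ σ → z (inside ∷ τ) (outside ∷ σ)) U ℚ.+
                    π (twist λ τ σ → z (outside ∷ τ) (inside ∷ σ)) U

π-linear : ∀ a b (z w : BiChain n n) U →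
           π (λ τ σ → a ℚ.* z τ σ ℚ.+ b ℚ.* w τ σ) U ≡ a ℚ.* π z U ℚ.+ b ℚ.* π w U

π-cong : {z w : BiChain n n} → (∀ τ σ → z τ σ ≡ w τ σ) → ∀ U → π z U ≡ π w U
π-cong z≗w []            = z≗w [] []
π-cong z≗w (outside ∷ U) = π-cong (λ τ σ → z≗w _ _) U
π-cong z≗w (inside ∷ U)  = cong₂ ℚ._+_ (π-cong (λ τ σ → z≗w _ _) U)
                                       (π-cong (λ τ σ → cong (ε τ ℚ.*_) (z≗w _ _)) U)

π-linear a b z w [] = refl
π-linear a b z w (outside ∷ U) =
  π-linear a b (λ τ σ → z (outside ∷ τ) (outside ∷ σ)) (λ τ σ → w (outside ∷ τ) (outside ∷ σ)) U
π-linear a b z w (inside ∷ U) = trans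
  (cong₂ ℚ._+_ (π-linear a b z₁₀ w₁₀ U)
    (trans (π-cong distrib U) (π-linear a b (twist z₀₁) (twist w₀₁) U)))
  (lin-+
    a b (π z₁₀ U) (π w₁₀ U) (π (twist z₀₁) U) (π (twist w₀₁) U))
  where
  z₁₀ = λ τ σ → z (inside ∷ τ) (outside ∷ σ)
  w₁₀ = λ τ σ → w (inside ∷ τ) (outside ∷ σ)
  z₀₁ = λ τ σ → z (outside ∷ τ) (inside ∷ σ)
  w₀₁ = λ τ σ → w (outside ∷ τ) (inside ∷ σ)

  distrib : ∀ τ σ → ε τ ℚ.* (a ℚ.* z₀₁ τ σ ℚ.+ b ℚ.* w₀₁ τ σ) ≡
                    a ℚ.* twist z₀₁ τ σ ℚ.+ b ℚ.* twist w₀₁ τ σ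
  distrib τ σ = solve 5 (λ e a b x y → e :* (a :* x :+ b :* y) := a :* (e :* x) :+ b :* (e :* y)) refl
    (ε τ) a b (z₀₁ τ σ) (w₀₁ τ σ)

π-0 : (z : BiChain n n) → ∀ U →
      (∀ τ σ → (∀ {x} → x ∈ U → x ∈ τ ⊎ x ∈ σ) → ∣ τ ∣ + ∣ σ ∣ ≡ ∣ U ∣ → z τ σ ≡ 0ℚ) → π z U ≡ 0ℚ
π-0 z [] h = h [] [] (λ ()) refl
π-0 z (outside ∷ U) h = π-0 _ U λ τ σ cover → h (outside ∷ τ) (outside ∷ σ)
  λ { (there x∈U) → ⊎-map there there (cover x∈U) }
π-0 z (inside ∷ U) h = cong₂ ℚ._+_
  (π-0 _ U λ τ σ cover size → h (inside ∷ τ) (outside ∷ σ)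
    (λ { here → inj₁ here ; (there x∈U) → ⊎-map there there (cover x∈U) }) (cong suc size))
  (π-0 _ U λ τ σ cover size → trans
    (cong (ε τ ℚ.*_) (h (outside ∷ τ) (inside ∷ σ)
      (λ { here → inj₂ here ; (there x∈U) → ⊎-map there there (cover x∈U) })
      (trans (ℕ.+-suc ∣ τ ∣ ∣ σ ∣) (cong suc size))))
    (ℚ.*-zeroʳ (ε τ)))

-- The pairs that project onto all of V without repetition are the (∁ σ, σ), so the top coefficient
-- sees rainbow simplices only.
π-⊤-cong : {z w : BiChain n n} → (∀ σ → z (∁ σ) σ ≡ w (∁ σ) σ) → π z ⊤ ≡ π w ⊤
π-⊤-cong {zero}  h = h []
π-⊤-cong {suc n} h = cong₂ ℚ._+_ (π-⊤-cong λ σ → h (outside ∷ σ))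
                                 (π-⊤-cong λ σ → cong (ε (∁ σ) ℚ.*_) (h (inside ∷ σ)))

-- A simplex with a repeated colour projects to 0, and so must its boundary: `z₁₁`, which collects
-- the simplices through both copies of the first vertex, enters twice with opposite signs.
π-D : (z : BiChain n n) → ∀ U → π (D z) U ≡ ∂ʳ (π z) U
π-D z [] = refl
π-D z (outside ∷ U) = begin
  π (λ τ σ → D z (outside ∷ τ) (outside ∷ σ)) U
    ≡⟨ π-cong (λ τ σ → cong₂ ℚ._+_ (sym (ℚ.*-identityˡ (z₁₀ τ σ)))
         (trans (D-outside (z ∘ (outside ∷_)) τ σ)
                (sym (trans (ℚ.*-identityˡ _) (cong₂ ℚ._+_ (ℚ.*-identityˡ (twist z₀₁ τ σ)) (ℚ.*-identityˡ (D z₀₀ τ σ))))))) U ⟩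
  π (λ τ σ → 1ℚ ℚ.* z₁₀ τ σ ℚ.+ 1ℚ ℚ.* (1ℚ ℚ.* twist z₀₁ τ σ ℚ.+ 1ℚ ℚ.* D z₀₀ τ σ)) U
    ≡⟨ π-linear 1ℚ 1ℚ z₁₀ (λ τ σ → 1ℚ ℚ.* twist z₀₁ τ σ ℚ.+ 1ℚ ℚ.* D z₀₀ τ σ) U ⟩
  1ℚ ℚ.* π z₁₀ U ℚ.+ 1ℚ ℚ.* π (λ τ σ → 1ℚ ℚ.* twist z₀₁ τ σ ℚ.+ 1ℚ ℚ.* D z₀₀ τ σ) U
    ≡⟨ cong (λ x → 1ℚ ℚ.* π z₁₀ U ℚ.+ 1ℚ ℚ.* x) (π-linear 1ℚ 1ℚ (twist z₀₁) (D z₀₀) U) ⟩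
  1ℚ ℚ.* π z₁₀ U ℚ.+ 1ℚ ℚ.* (1ℚ ℚ.* π (twist z₀₁) U ℚ.+ 1ℚ ℚ.* π (D z₀₀) U)
    ≡⟨ solve 3 (λ a b c → con 1ℚ :* a :+ con 1ℚ :* (con 1ℚ :* b :+ con 1ℚ :* c) := (a :+ b) :+ c) refl
         (π z₁₀ U) (π (twist z₀₁) U) (π (D z₀₀) U) ⟩
  (π z₁₀ U ℚ.+ π (twist z₀₁) U) ℚ.+ π (D z₀₀) U
    ≡⟨ cong (π z₁₀ U ℚ.+ π (twist z₀₁) U ℚ.+_) (π-D z₀₀ U) ⟩
  ∂ʳ (π z) (outside ∷ U) ∎
  where
  open ≡-Reasoning
  z₁₀ = λ τ σ → z (inside ∷ τ) (outside ∷ σ)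
  z₀₁ = λ τ σ → z (outside ∷ τ) (inside ∷ σ)
  z₀₀ = λ τ σ → z (outside ∷ τ) (outside ∷ σ)
π-D z (inside ∷ U) = begin
  π (λ τ σ → D z (inside ∷ τ) (outside ∷ σ)) U ℚ.+ π (twist λ τ σ → D z (outside ∷ τ) (inside ∷ σ)) U
    ≡⟨ cong₂ ℚ._+_ (trans (π-cong first U) (π-linear (ℚ.- 1ℚ) (ℚ.- 1ℚ) (twist z₁₁) (D z₁₀) U))
                   (trans (π-cong second U) (π-linear 1ℚ (ℚ.- 1ℚ) (twist z₁₁) (D (twist z₀₁)) U)) ⟩
  (ℚ.- 1ℚ ℚ.* π (twist z₁₁) U ℚ.+ ℚ.- 1ℚ ℚ.* π (D z₁₀) U) ℚ.+
  (1ℚ ℚ.* π (twist z₁₁) U ℚ.+ ℚ.- 1ℚ ℚ.* π (D (twist z₀₁)) U)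
    ≡⟨ cong₂ (λ x y → (ℚ.- 1ℚ ℚ.* π (twist z₁₁) U ℚ.+ ℚ.- 1ℚ ℚ.* x) ℚ.+
                      (1ℚ ℚ.* π (twist z₁₁) U ℚ.+ ℚ.- 1ℚ ℚ.* y))
             (π-D z₁₀ U) (π-D (twist z₀₁) U) ⟩
  (ℚ.- 1ℚ ℚ.* π (twist z₁₁) U ℚ.+ ℚ.- 1ℚ ℚ.* ∂ʳ (π z₁₀) U) ℚ.+
  (1ℚ ℚ.* π (twist z₁₁) U ℚ.+ ℚ.- 1ℚ ℚ.* ∂ʳ (π (twist z₀₁)) U)
    ≡⟨ solve 3 (λ t x y → (con (ℚ.- 1ℚ) :* t :+ con (ℚ.- 1ℚ) :* x) :+ (con 1ℚ :* t :+ con (ℚ.- 1ℚ) :* y) :=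
                          :- (con 1ℚ :* x :+ con 1ℚ :* y)) refl
         (π (twist z₁₁) U) (∂ʳ (π z₁₀) U) (∂ʳ (π (twist z₀₁)) U) ⟩
  ℚ.- (1ℚ ℚ.* ∂ʳ (π z₁₀) U ℚ.+ 1ℚ ℚ.* ∂ʳ (π (twist z₀₁)) U)
    ≡⟨ cong ℚ.-_ (trans (sym (∂ʳ-linear 1ℚ 1ℚ (π z₁₀) (π (twist z₀₁)) U))
         (∂ʳ-cong (λ V → cong₂ ℚ._+_ (ℚ.*-identityˡ (π z₁₀ V)) (ℚ.*-identityˡ (π (twist z₀₁) V))) U)) ⟩
  ∂ʳ (π z) (inside ∷ U) ∎
  where
  open ≡-Reasoning
  z₁₁ = λ τ σ → z (inside ∷ τ) (inside ∷ σ)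
  z₁₀ = λ τ σ → z (inside ∷ τ) (outside ∷ σ)
  z₀₁ = λ τ σ → z (outside ∷ τ) (inside ∷ σ)

  first : ∀ τ σ → D z (inside ∷ τ) (outside ∷ σ) ≡ ℚ.- 1ℚ ℚ.* twist z₁₁ τ σ ℚ.+ ℚ.- 1ℚ ℚ.* D z₁₀ τ σ
  first τ σ = trans (cong ℚ.-_ (D-outside (z ∘ (inside ∷_)) τ σ))
    (solve 2 (λ x y → :- (x :+ y) := con (ℚ.- 1ℚ) :* x :+ con (ℚ.- 1ℚ) :* y) refl
      (twist z₁₁ τ σ) (D z₁₀ τ σ))

  second : ∀ τ σ → ε τ ℚ.* D z (outside ∷ τ) (inside ∷ σ) ≡
                   1ℚ ℚ.* twist z₁₁ τ σ ℚ.+ ℚ.- 1ℚ ℚ.* D (twist z₀₁) τ σ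
  second τ σ = trans (cong (λ x → ε τ ℚ.* (z₁₁ τ σ ℚ.+ x)) (D-inside (z ∘ (outside ∷_)) τ σ))
    (trans (solve 3 (λ e x d → e :* (x :+ :- (e :* d)) := con 1ℚ :* (e :* x) :+ (e :* e) :* (con (ℚ.- 1ℚ) :* d)) refl
             (ε τ) (z₁₁ τ σ) (D (twist z₀₁) τ σ))
      (cong (1ℚ ℚ.* twist z₁₁ τ σ ℚ.+_)
        (trans (cong (ℚ._* (ℚ.- 1ℚ ℚ.* D (twist z₀₁) τ σ)) (ε²≡1 τ))
               (ℚ.*-identityˡ (ℚ.- 1ℚ ℚ.* D (twist z₀₁) τ σ)))))

-- A carrier-preserving chain map of a simplex that is the identity on the
-- empty face is the identity (the algebraic form of Sperner's lemma).
degree-one : (X : Subset n → Chain n) → (∀ I U → U ≢ I → X I U ≡ 0ℚ) → X ⊥ ⊥ ≡ 1ℚ →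
             (∀ I U → ∂ʳ (X I) U ≡ δ (λ J → X J U) I) → X ⊤ ⊤ ≡ 1ℚ
degree-one {zero}  X diag X⊥≡1 chain-map = X⊥≡1
degree-one {suc n} X diag X⊥≡1 chain-map = trans step
  (degree-one (λ I U → X (outside ∷ I) (outside ∷ U))
    (λ I U U≢I → diag _ _ (U≢I ∘ cong tail)) X⊥≡1
    λ I U → trans
      (sym (trans (cong (ℚ._+ ∂ʳ (X (outside ∷ I) ∘ (outside ∷_)) U) (diag (outside ∷ I) (inside ∷ U) λ ()))
                  (ℚ.+-identityˡ _)))
      (chain-map (outside ∷ I) (outside ∷ U)))
  where
  open ≡-Reasoning
  -- The two sides of the chain map equation are compared at the facet that omits `zero`, where one
  -- term survives on each side.
  step : X ⊤ ⊤ ≡ X (outside ∷ ⊤) (outside ∷ ⊤)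
  step = begin
    X ⊤ ⊤
      ≡⟨ sym (ℚ.+-identityʳ (X ⊤ ⊤)) ⟩
    X ⊤ ⊤ ℚ.+ 0ℚ
      ≡⟨ cong (X ⊤ ⊤ ℚ.+_) (sym (∂ʳ-0 {c = X ⊤ ∘ (outside ∷_)} (λ U → diag ⊤ (outside ∷ U) λ ()) ⊤)) ⟩
    ∂ʳ (X ⊤) (outside ∷ ⊤)
      ≡⟨ chain-map ⊤ (outside ∷ ⊤) ⟩
    X (outside ∷ ⊤) (outside ∷ ⊤) ℚ.- δ (λ J → X (inside ∷ J) (outside ∷ ⊤)) ⊤
      ≡⟨ cong (λ x → X (outside ∷ ⊤) (outside ∷ ⊤) ℚ.- x) (δ-0 ⊤ λ J _ _ → diag (inside ∷ J) (outside ∷ ⊤) λ ()) ⟩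
    X (outside ∷ ⊤) (outside ∷ ⊤) ℚ.- 0ℚ
      ≡⟨ ℚ.+-identityʳ _ ⟩
    X (outside ∷ ⊤) (outside ∷ ⊤) ∎

-- Colourful simplices

∁-involutive : (p : Subset n) → ∁ (∁ p) ≡ p
∁-involutive []            = refl
∁-involutive (outside ∷ p) = cong (outside ∷_) (∁-involutive p)
∁-involutive (inside ∷ p)  = cong (inside ∷_) (∁-involutive p)

∣p∣<∣q∣⇒∃x∈q∖p : ∀ (p q : Subset n) → ∣ p ∣ ℕ.< ∣ q ∣ → ∃[ x ] x ∈ q × x ∉ p
∣p∣<∣q∣⇒∃x∈q∖p p q p<q with any? (λ x → (x ∈? q) ×-dec ¬? (x ∈? p))
... | yes found = found
... | no  none  = contradiction (p⊆q⇒∣p∣≤∣q∣ q⊆p) (ℕ.<⇒≱ p<q)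
  where
  q⊆p : q ⊆ p
  q⊆p {x} x∈q with x ∈? p
  ... | yes x∈p = x∈p
  ... | no  x∉p = contradiction (x , x∈q , x∉p) none

p⊆q∧∣q∣≤∣p∣⇒p≡q : ∀ {p q : Subset n} → p ⊆ q → ∣ q ∣ ≤ ∣ p ∣ → p ≡ q
p⊆q∧∣q∣≤∣p∣⇒p≡q {p = p} {q} p⊆q q≤p = ⊆-antisym p⊆q q⊆p
  where
  q⊆p : q ⊆ p
  q⊆p {x} x∈q with x ∈? p
  ... | yes x∈p = x∈p
  ... | no  x∉p = contradiction (p⊂q⇒∣p∣<∣q∣ (p⊆q , x , x∈q , x∉p)) (ℕ.≤⇒≯ q≤p)

fullSimplex : Subset n → Complex n
fullSimplex A .Face σ = σ ⊆ A
fullSimplex A .face? σ = σ ⊆? A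
fullSimplex A .down-closed τ⊆σ σ⊆A = σ⊆A ∘ τ⊆σ

fullSimplex-augments : ∀ (A I : Subset n) → Augments (fullSimplex A ↾ I)
fullSimplex-augments A I {S} {T} (S⊆A , S⊆I) (T⊆A , T⊆I) S<T with ∣p∣<∣q∣⇒∃x∈q∖p S T S<T
... | x , x∈T , x∉S = x , x∈T , x∉S , insert S⊆A T⊆A , insert S⊆I T⊆I
  where
  insert : ∀ {U} → S ⊆ U → T ⊆ U → S ∪ ⁅ x ⁆ ⊆ U
  insert S⊆U T⊆U y∈ with x∈p∪q⁻ S ⁅ x ⁆ y∈
  ... | inj₁ y∈S = S⊆U y∈S
  ... | inj₂ y∈x = subst (_∈ _) (sym (x∈⁅y⁆⇒x≡y x y∈x)) (T⊆U x∈T)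

∪⁅⁆⊆ : ∀ {p q : Subset n} {x} → p ⊆ q → x ∈ q → p ∪ ⁅ x ⁆ ⊆ q
∪⁅⁆⊆ {p = p} {x = x} p⊆q x∈q y∈ with x∈p∪q⁻ p ⁅ x ⁆ y∈
... | inj₁ y∈p = p⊆q y∈p
... | inj₂ y∈x = subst (_∈ _) (sym (x∈⁅y⁆⇒x≡y x y∈x)) x∈q

-- The empty simplex with coefficient 1, the generator in degree -1.
unit : Chain n
unit []            = 1ℚ
unit (outside ∷ σ) = unit σ
unit (inside ∷ σ)  = 0ℚ

unit-0 : ∀ (σ : Subset n) → ∣ σ ∣ ≢ 0 → unit σ ≡ 0ℚ
unit-0 []            σ≢0 = contradiction refl σ≢0
unit-0 (outside ∷ σ) σ≢0 = unit-0 σ σ≢0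
unit-0 (inside ∷ σ)  σ≢0 = refl

∂ʳ-unit : ∀ (σ : Subset n) → ∂ʳ unit σ ≡ 0ℚ
∂ʳ-unit []            = refl
∂ʳ-unit (outside ∷ σ) = trans (ℚ.+-identityˡ (∂ʳ unit σ)) (∂ʳ-unit σ)
∂ʳ-unit (inside ∷ σ)  = cong ℚ.-_ (∂ʳ-0 (λ _ → refl) σ)

unit² : BiChain m n
unit² τ σ = unit τ ℚ.* unit σ

D-unit² : ∀ (τ : Subset m) (σ : Subset n) → D unit² τ σ ≡ 0ℚ
D-unit² []            σ = trans (∂ʳ-cong (λ σ → ℚ.*-identityˡ (unit σ)) σ) (∂ʳ-unit σ)
D-unit² (outside ∷ τ) σ = cong₂ ℚ._+_ (ℚ.*-zeroˡ (unit σ)) (D-unit² τ σ)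
D-unit² (inside ∷ τ)  σ = cong ℚ.-_ (D-0 (λ _ σ → ℚ.*-zeroˡ (unit σ)) τ σ)

π-unit² : ∀ n → π {n} unit² ⊥ ≡ 1ℚ
π-unit² zero    = refl
π-unit² (suc n) = π-unit² n

π-δ : ∀ {k} (P : Family k n n) I U → π (λ τ σ → δ (λ J → P J τ σ) I) U ≡ δ (λ J → π (P J) U) I
π-δ P []            U = π-0 _ U λ _ _ _ _ → refl
π-δ P (outside ∷ I) U = π-δ (P ∘ (outside ∷_)) I U
π-δ P (inside ∷ I)  U = trans
  (π-cong (λ τ σ → -≡lin (P (outside ∷ I) τ σ) (δ (λ J → P (inside ∷ J) τ σ) I)) U)
  (trans (π-linear 1ℚ (ℚ.- 1ℚ) (P (outside ∷ I)) (λ τ σ → δ (λ J → P (inside ∷ J) τ σ) I) U)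
    (trans (sym (-≡lin (π (P (outside ∷ I)) U) (π (λ τ σ → δ (λ J → P (inside ∷ J) τ σ) I) U)))
      (cong (λ x → π (P (outside ∷ I)) U ℚ.- x) (π-δ (P ∘ (inside ∷_)) I U))))

∂ʳ-⊤ : (c : Chain n) → ∂ʳ c ⊤ ≡ 0ℚ
∂ʳ-⊤ {zero}  c = refl
∂ʳ-⊤ {suc n} c = cong ℚ.-_ (∂ʳ-⊤ (c ∘ (inside ∷_)))

∂ʳ-scale : ∀ a {c d : Chain n} τ → (∀ v → v ∉ τ → d (τ ∪ ⁅ v ⁆) ≡ a ℚ.* c (τ ∪ ⁅ v ⁆)) →
           ∂ʳ d τ ≡ a ℚ.* ∂ʳ c τ
∂ʳ-scale a []            h = sym (ℚ.*-zeroʳ a)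
∂ʳ-scale a {c} {d} (outside ∷ τ) h = trans
  (cong₂ ℚ._+_ (subst (λ ρ → d (inside ∷ ρ) ≡ a ℚ.* c (inside ∷ ρ)) (∪-identityʳ τ) (h zero λ ()))
               (∂ʳ-scale a τ λ v v∉τ → h (suc v) (v∉τ ∘ drop-there)))
  (sym (ℚ.*-distribˡ-+ a (c (inside ∷ τ)) (∂ʳ (c ∘ (outside ∷_)) τ)))
∂ʳ-scale a {c} (inside ∷ τ)  h = trans
  (cong ℚ.-_ (∂ʳ-scale a τ λ v v∉τ → h (suc v) (v∉τ ∘ drop-there)))
  (ℚ.neg-distribʳ-* a (∂ʳ (c ∘ (inside ∷_)) τ))

-- A coefficient of the boundary depends only on cofaces, so a weight that is constant on the
-- cofaces of (τ, σ) comes out as a factor.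
D-scale : ∀ a {z w : BiChain m n} τ σ →
          (∀ v → v ∉ τ → w (τ ∪ ⁅ v ⁆) σ ≡ a ℚ.* z (τ ∪ ⁅ v ⁆) σ) →
          (∀ v → v ∉ σ → w τ (σ ∪ ⁅ v ⁆) ≡ a ℚ.* z τ (σ ∪ ⁅ v ⁆)) →
          D w τ σ ≡ a ℚ.* D z τ σ
D-scale a []            σ h h' = ∂ʳ-scale a σ h'
D-scale a {z} {w} (outside ∷ τ) σ h h' = trans
  (cong₂ ℚ._+_ (subst (λ ρ → w (inside ∷ ρ) σ ≡ a ℚ.* z (inside ∷ ρ) σ) (∪-identityʳ τ) (h zero λ ()))
               (D-scale a τ σ (λ v v∉τ → h (suc v) (v∉τ ∘ drop-there)) h'))
  (sym (ℚ.*-distribˡ-+ a (z (inside ∷ τ) σ) (D (z ∘ (outside ∷_)) τ σ)))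
D-scale a {z} (inside ∷ τ)  σ h h' = trans
  (cong ℚ.-_ (D-scale a τ σ (λ v v∉τ → h (suc v) (v∉τ ∘ drop-there)) h'))
  (ℚ.neg-distribʳ-* a (D (z ∘ (inside ∷_)) τ σ))

-- A face I with t + 1 vertices is filled at size t + e: e = 0 serves the construction of chain
-- maps, e = 1 that of homotopies between them.
Fillable : Complex n → Complex n → ℕ → Set
Fillable N K e = ∀ I t → ∣ I ∣ ≡ suc t → JoinFills (N ↾ I) (K ↾ I) (t + e)

↾-mono : (K : Complex n) → ∀ {I J} → I ⊆ J → ∀ σ → Face (K ↾ I) σ → Face (K ↾ J) σ
↾-mono K I⊆J σ (f , σ⊆I) = f , I⊆J ∘ σ⊆I

-- A chain map from the simplex on the vertex set to the join N * K that maps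
-- the face I into the restriction to the two copies of I.
record ColouredMap (N K : Complex n) : Set where
  field
    Φ      : Family n n n
    on     : ∀ I → IsBiChainOf (N ↾ I) (K ↾ I) ∣ I ∣ (Φ I)
    atom   : Φ ⊥ ≡ unit²
    DΦ     : ∀ I τ σ → D (Φ I) τ σ ≡ δ (λ J → Φ J τ σ) I

  -- The projection to the colours turns `Φ` into a carrier-preserving chain map of the simplex, to
  -- which the algebraic Sperner lemma applies.
  degree : π (Φ ⊤) ⊤ ≡ 1ℚ
  degree = degree-one (π ∘ Φ) diag (trans (cong (λ z → π z ⊥) atom) (π-unit² n))
    λ I U → trans (sym (π-D (Φ I) U)) (trans (π-cong (DΦ I) U) (π-δ Φ I U))
    where
    diag : ∀ I U → U ≢ I → π (Φ I) U ≡ 0ℚ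
    diag I U U≢I = π-0 (Φ I) U λ τ σ cover size → on I τ σ λ { ((_ , τ⊆I) , (_ , σ⊆I) , size') →
      U≢I (p⊆q∧∣q∣≤∣p∣⇒p≡q (λ x∈U → [ (λ x∈τ → τ⊆I x∈τ) , (λ x∈σ → σ⊆I x∈σ) ]′ (cover x∈U))
                           (ℕ.≤-reflexive (trans (sym size') size))) }

open ColouredMap

abstract
  colouredMap : ∀ (N K : Complex n) → Fillable N K 0 → Face N ⊥ → Face K ⊥ → ColouredMap N K
  colouredMap {n} N K fill fN fK = record
    { Φ    = proj₁ family
    ; on   = λ I τ σ ¬f → proj₁ (proj₂ (proj₂ family) I) τ σ
               λ { (f , h , size) → ¬f (f , h , trans size (ℕ.+-identityʳ ∣ I ∣)) }
    ; atom = proj₁ (proj₂ family)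
    ; DΦ   = λ I τ σ → trans (proj₂ (proj₂ (proj₂ family) I) τ σ)
               (solve 1 (λ x → con 0ℚ :+ con 1ℚ :* x := x) refl (δ (λ J → proj₁ family J τ σ) I))
    }
    where
    unit²-on : IsBiChainOf (N ↾ ⊥) (K ↾ ⊥) 0 unit²
    unit²-on τ σ ¬f with ∣ τ ∣ ℕ.≟ 0 | ∣ σ ∣ ℕ.≟ 0
    ... | no τ≢0 | _ = trans (cong (ℚ._* unit σ) (unit-0 τ τ≢0)) (ℚ.*-zeroˡ (unit σ))
    ... | yes _ | no σ≢0 = trans (cong (unit τ ℚ.*_) (unit-0 σ σ≢0)) (ℚ.*-zeroʳ (unit τ))
    ... | yes τ≡0 | yes σ≡0 = ⊥-elim (¬f
      ((down-closed N (empty⊆ τ τ≡0) fN , empty⊆ τ τ≡0) , (down-closed K (empty⊆ σ σ≡0) fK , empty⊆ σ σ≡0) ,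
       trans (cong (_+ ∣ σ ∣) τ≡0) σ≡0))
      where
      empty⊆ : ∀ (ρ : Subset n) → ∣ ρ ∣ ≡ 0 → ρ ⊆ ⊥
      empty⊆ ρ ρ≡0 {x} x∈ρ with ∣p∣<∣q∣⇒∃x∈q∖p ρ ⁅ x ⁆ (subst₂ ℕ._<_ (sym ρ≡0) (sym (∣⁅x⁆∣≡1 x)) (ℕ.s≤s ℕ.z≤n))
      ... | y , y∈x , y∉ρ = contradiction (subst (_∈ ρ) (sym (x∈⁅y⁆⇒x≡y x y∈x)) x∈ρ) y∉ρ

    open Carrier {k = n} (N ↾_) (K ↾_) (↾-mono N) (↾-mono K) 0 fill (λ _ _ _ → 0ℚ) 1ℚ
      (λ _ _ _ _ _ _ → refl)
      (λ I τ σ → cong₂ ℚ._+_ (D-0 (λ _ _ → refl) τ σ) (trans (ℚ.*-identityˡ _) (δ-const0 I)))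
      unit² unit²-on D-unit²

-- Each colour occurs in exactly one factor, so the join over I is a full simplex and any colour of
-- I is a cone point. This yields a coloured map concentrated on the single rainbow simplex of `A`.
simplices-fillable : (A : Subset n) → ∀ e → Fillable (fullSimplex (∁ A)) (fullSimplex A) e
simplices-fillable {n} A e I t size with ∣p∣<∣q∣⇒∃x∈q∖p (⊥ {n}) I (subst₂ ℕ._<_ (sym (∣⊥∣≡0 n)) (sym size) (ℕ.s≤s ℕ.z≤n))
... | x , x∈I , _ with x ∈? A
... | yes x∈A = JoinFills-matroid (fullSimplex (∁ A) ↾ I) (fullSimplex-augments (∁ A) I) (fullSimplex A ↾ I) {suc (t + e)}
  (λ p _ → Fills-coloop (fullSimplex A ↾ I) x p λ { σ (σ⊆A , σ⊆I) _ → ∪⁅⁆⊆ σ⊆A x∈A , ∪⁅⁆⊆ σ⊆I x∈I })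
  {⊥} (⊆-min _ , ⊆-min _) (t + e) (ℕ.s≤s (ℕ.m≤m+n (t + e) _))
... | no  x∉A = JoinFills-coloop (fullSimplex (∁ A) ↾ I) (fullSimplex A ↾ I) x
  (λ { τ (τ⊆A , τ⊆I) → ∪⁅⁆⊆ τ⊆A (x∉p⇒x∈∁p x∉A) , ∪⁅⁆⊆ τ⊆I x∈I }) (t + e)

module Colourful (N K : Complex n) (fN : Face N ⊥) (fK : Face K ⊥) where

  Rainbow : Subset n → Set
  Rainbow σ = Face N (∁ σ) × Face K σ

  rainbow-exists : Fillable N K 0 → ∃ Rainbow
  rainbow-exists fill with anySubset? (λ σ → face? N (∁ σ) ×-dec face? K σ)
  ... | yes found = found
  -- Without rainbow simplices the top coefficient, which is 1, would be 0.
  ... | no  none  = contradiction (trans (sym (degree F)) (trans (π-⊤-cong vanish) (π-0 {n} (λ _ _ → 0ℚ) ⊤ λ _ _ _ _ → refl))) λ ()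
    where
    F = colouredMap N K fill fN fK

    vanish : ∀ σ → Φ F ⊤ (∁ σ) σ ≡ 0ℚ
    vanish σ = on F ⊤ (∁ σ) σ λ { ((f , _) , (g , _) , _) → none (σ , f , g) }

  -- If (τ, σ) has all colours and exactly one of them twice, its rainbow facets are those of σ and
  -- of ∁ τ, and ∁ τ is contained in σ. The invariance of `χ` gives both the same weight.
  module _ (fill : Fillable N K 1) (χ : Subset n → ℚ)
    (χ-invariant : ∀ {ρ σ} → ρ ⊆ σ → Face K σ → Face N (∁ ρ) → χ ρ ≡ χ σ) where

    private
      module Homotopy (A B : Subset n) (rA : Rainbow A) (rB : Rainbow B) where

        -- `F A` takes values in the simplex of `A`, so `A` is the only rainbow simplex it can hit.
        F : (A : Subset n) → ColouredMap (fullSimplex (∁ A)) (fullSimplex A)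
        F A = colouredMap (fullSimplex (∁ A)) (fullSimplex A) (simplices-fillable A 0) (⊆-min (∁ A)) (⊆-min A)

        FA FB : Family n n n
        FA = Φ (F A)
        FB = Φ (F B)

        F-on : ∀ A → Rainbow A → ∀ I → IsBiChainOf (N ↾ I) (K ↾ I) ∣ I ∣ (Φ (F A) I)
        F-on A (fN , fK) I τ σ ¬f = on (F A) I τ σ λ { ((τ⊆∁A , τ⊆I) , (σ⊆A , σ⊆I) , size) →
          ¬f ((down-closed N τ⊆∁A fN , τ⊆I) , (down-closed K σ⊆A fK , σ⊆I) , size) }

        g : Family n n n
        g I τ σ = FB I τ σ ℚ.- FA I τ σ

        g-on : ∀ I t → ∣ I ∣ ≡ suc t → IsBiChainOf (N ↾ I) (K ↾ I) (t + 1) (g I)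
        g-on I t size τ σ ¬f = cong₂ ℚ._-_ (F-on B rB I τ σ ¬f') (F-on A rA I τ σ ¬f')
          where
          ¬f' : ¬ (Face (N ↾ I) τ × Face (K ↾ I) σ × ∣ τ ∣ + ∣ σ ∣ ≡ ∣ I ∣)
          ¬f' (f , h , eq) = ¬f (f , h , trans eq (trans size (ℕ.+-comm 1 t)))

        g-cocycle : ∀ I τ σ → D (g I) τ σ ℚ.+ ℚ.- 1ℚ ℚ.* δ (λ J → g J τ σ) I ≡ 0ℚ
        g-cocycle I τ σ = trans
          (cong₂ (λ x y → x ℚ.+ ℚ.- 1ℚ ℚ.* y)
            (trans (D-sub (FB I) (FA I) τ σ) (cong₂ ℚ._-_ (DΦ (F B) I τ σ) (DΦ (F A) I τ σ)))
            (δ-sub (λ J → FB J τ σ) (λ J → FA J τ σ) I))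
          (solve 2 (λ x y → (x :- y) :+ con (ℚ.- 1ℚ) :* (x :- y) := con 0ℚ) refl
            (δ (λ J → FB J τ σ) I) (δ (λ J → FA J τ σ) I))

        open Carrier {k = n} (N ↾_) (K ↾_) (↾-mono N) (↾-mono K) 1 fill g (ℚ.- 1ℚ) g-on g-cocycle
          (λ _ _ → 0ℚ) (λ _ _ _ → refl)
          (λ τ σ → trans (D-0 (λ _ _ → refl) τ σ) (sym (trans
            (cong₂ (λ (z w : BiChain n n) → z τ σ ℚ.- w τ σ) (atom (F B)) (atom (F A))) (ℚ.+-inverseʳ (unit² τ σ)))))

        P : Family n n n
        P = proj₁ family

        P-good : ∀ I → Good P I
        P-good = proj₂ (proj₂ family)

        -- A proper face J carries too few colours, so among rainbow simplices only the two ends of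
        -- the homotopy remain.
        no-rainbow : ∀ σ → δ (λ J → P J (∁ σ) σ) ⊤ ≡ 0ℚ
        no-rainbow σ = δ-0 {f = λ J → P J (∁ σ) σ} ⊤ λ J _ size → proj₁ (P-good J) (∁ σ) σ
          λ { ((_ , ∁σ⊆J) , (_ , σ⊆J) , _) → ℕ.<-irrefl (refl {x = ∣ J ∣})
            (ℕ.≤-trans (ℕ.≤-reflexive (sym size)) (p⊆q⇒∣p∣≤∣q∣ (all ∁σ⊆J σ⊆J))) }
          where
          all : ∀ {J} → ∁ σ ⊆ J → σ ⊆ J → ⊤ ⊆ J
          all ∁σ⊆J σ⊆J {x} _ with x ∈? σ
          ... | yes x∈σ = σ⊆J x∈σ
          ... | no  x∉σ = ∁σ⊆J (x∉p⇒x∈∁p x∉σ)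

        Pχ : BiChain n n
        Pχ τ σ = χ (∁ τ) ℚ.* P ⊤ τ σ

        -- Both rainbow facets of a simplex with n + 1 vertices get the same weight.
        DPχ : ∀ σ → D Pχ (∁ σ) σ ≡ χ σ ℚ.* D (P ⊤) (∁ σ) σ
        DPχ σ = D-scale (χ σ) {z = P ⊤} {w = Pχ} (∁ σ) σ left right
          where
          vanishing : ∀ τ → P ⊤ τ σ ≡ 0ℚ → Pχ τ σ ≡ χ σ ℚ.* P ⊤ τ σ
          vanishing τ P≡0 = trans (cong (χ (∁ τ) ℚ.*_) P≡0) (trans (ℚ.*-zeroʳ (χ (∁ τ)))
            (sym (trans (cong (χ σ ℚ.*_) P≡0) (ℚ.*-zeroʳ (χ σ)))))

          right : ∀ v → v ∉ σ → Pχ (∁ σ) (σ ∪ ⁅ v ⁆) ≡ χ σ ℚ.* P ⊤ (∁ σ) (σ ∪ ⁅ v ⁆)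
          right v _ = cong (λ ρ → χ ρ ℚ.* P ⊤ (∁ σ) (σ ∪ ⁅ v ⁆)) (∁-involutive σ)

          left : ∀ v → v ∉ ∁ σ → Pχ (∁ σ ∪ ⁅ v ⁆) σ ≡ χ σ ℚ.* P ⊤ (∁ σ ∪ ⁅ v ⁆) σ
          left v _ = cases (face? N τ) (face? K σ)
            where
            τ = ∁ σ ∪ ⁅ v ⁆

            smaller : ∁ τ ⊆ σ
            smaller x∈ = x∉∁p⇒x∈p λ x∈∁σ → x∈∁p⇒x∉p x∈ (p⊆p∪q ⁅ v ⁆ x∈∁σ)

            cases : Dec (Face N τ) → Dec (Face K σ) → Pχ τ σ ≡ χ σ ℚ.* P ⊤ τ σ
            cases (yes f) (yes h) = cong (ℚ._* P ⊤ τ σ)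
              (χ-invariant smaller h (subst (Face N) (sym (∁-involutive τ)) f))
            cases (no ¬f) _       = vanishing τ (proj₁ (P-good ⊤) τ σ λ { ((f , _) , _) → ¬f f })
            cases (yes _) (no ¬h) = vanishing τ (proj₁ (P-good ⊤) τ σ λ { (_ , (h , _) , _) → ¬h h })

        localised : ∀ C σ → χ σ ℚ.* Φ (F C) ⊤ (∁ σ) σ ≡ χ C ℚ.* Φ (F C) ⊤ (∁ σ) σ
        localised C σ = cases ((∁ σ ⊆? ∁ C) ×-dec (σ ⊆? C))
          where
          cases : Dec (∁ σ ⊆ ∁ C × σ ⊆ C) → χ σ ℚ.* Φ (F C) ⊤ (∁ σ) σ ≡ χ C ℚ.* Φ (F C) ⊤ (∁ σ) σ
          cases (yes (∁σ⊆∁C , σ⊆C)) = cong (λ ρ → χ ρ ℚ.* Φ (F C) ⊤ (∁ σ) σ)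
                                        (⊆-antisym σ⊆C (∁p⊆∁q⇒p⊇q ∁σ⊆∁C))
          cases (no ¬f) = trans (cong (χ σ ℚ.*_) Φ≡0) (trans (ℚ.*-zeroʳ (χ σ))
            (sym (trans (cong (χ C ℚ.*_) Φ≡0) (ℚ.*-zeroʳ (χ C)))))
            where
            Φ≡0 : Φ (F C) ⊤ (∁ σ) σ ≡ 0ℚ
            Φ≡0 = on (F C) ⊤ (∁ σ) σ λ { ((f , _) , (h , _) , _) → ¬f (f , h) }

        -- The weighted count of rainbow simplices of `FB ⊤` minus that of `FA ⊤` is the top
        -- coefficient of a boundary, and a chain on n vertices has nothing above ⊤.
        difference : χ B ℚ.- χ A ≡ 0ℚ
        difference = begin
          χ B ℚ.- χ A
            ≡⟨ cong₂ (λ x y → x ℚ.+ y)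
                 (trans (sym (ℚ.*-identityʳ (χ B))) (cong (χ B ℚ.*_) (sym (degree (F B)))))
                 (trans (sym (ℚ.*-identityʳ (ℚ.- χ A))) (cong (ℚ.- χ A ℚ.*_) (sym (degree (F A))))) ⟩
          χ B ℚ.* π (FB ⊤) ⊤ ℚ.+ ℚ.- χ A ℚ.* π (FA ⊤) ⊤
            ≡⟨ sym (π-linear (χ B) (ℚ.- χ A) (FB ⊤) (FA ⊤) ⊤) ⟩
          π (λ τ σ → χ B ℚ.* FB ⊤ τ σ ℚ.+ ℚ.- χ A ℚ.* FA ⊤ τ σ) ⊤
            ≡⟨ π-⊤-cong (λ σ → sym (pointwise σ)) ⟩
          π (D Pχ) ⊤
            ≡⟨ π-D Pχ ⊤ ⟩
          ∂ʳ (π Pχ) ⊤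
            ≡⟨ ∂ʳ-⊤ (π Pχ) ⟩
          0ℚ ∎
          where
          open ≡-Reasoning
          pointwise : ∀ σ → D Pχ (∁ σ) σ ≡ χ B ℚ.* FB ⊤ (∁ σ) σ ℚ.+ ℚ.- χ A ℚ.* FA ⊤ (∁ σ) σ
          pointwise σ = begin
            D Pχ (∁ σ) σ
              ≡⟨ DPχ σ ⟩
            χ σ ℚ.* D (P ⊤) (∁ σ) σ
              ≡⟨ cong (χ σ ℚ.*_) (proj₂ (P-good ⊤) (∁ σ) σ) ⟩
            χ σ ℚ.* (g ⊤ (∁ σ) σ ℚ.+ ℚ.- 1ℚ ℚ.* δ (λ J → P J (∁ σ) σ) ⊤)
              ≡⟨ cong (λ x → χ σ ℚ.* (g ⊤ (∁ σ) σ ℚ.+ ℚ.- 1ℚ ℚ.* x)) (no-rainbow σ) ⟩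
            χ σ ℚ.* (g ⊤ (∁ σ) σ ℚ.+ ℚ.- 1ℚ ℚ.* 0ℚ)
              ≡⟨ solve 3 (λ c x y → c :* ((x :- y) :+ con (ℚ.- 1ℚ) :* con 0ℚ) := c :* x :- c :* y) refl
                   (χ σ) (FB ⊤ (∁ σ) σ) (FA ⊤ (∁ σ) σ) ⟩
            χ σ ℚ.* FB ⊤ (∁ σ) σ ℚ.- χ σ ℚ.* FA ⊤ (∁ σ) σ
              ≡⟨ cong₂ ℚ._-_ (localised B σ) (localised A σ) ⟩
            χ B ℚ.* FB ⊤ (∁ σ) σ ℚ.- χ A ℚ.* FA ⊤ (∁ σ) σ
              ≡⟨ cong (χ B ℚ.* FB ⊤ (∁ σ) σ ℚ.+_) (ℚ.neg-distribˡ-* (χ A) (FA ⊤ (∁ σ) σ)) ⟩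
            χ B ℚ.* FB ⊤ (∁ σ) σ ℚ.+ ℚ.- χ A ℚ.* FA ⊤ (∁ σ) σ ∎

    rainbow-invariant : ∀ {A B} → Rainbow A → Rainbow B → χ A ≡ χ B
    rainbow-invariant {A} {B} rA rB = begin
      χ A                     ≡⟨ solve 2 (λ a b → a := b :- (b :- a)) refl (χ A) (χ B) ⟩
      χ B ℚ.- (χ B ℚ.- χ A)   ≡⟨ cong (λ x → χ B ℚ.- x) (Homotopy.difference A B rA rB) ⟩
      χ B ℚ.- 0ℚ              ≡⟨ ℚ.+-identityʳ (χ B) ⟩
      χ B ∎
      where open ≡-Reasoning

-- Rank and the dual matroid

∣p∪q∣≤∣p∣+∣q∣ : ∀ (p q : Subset n) → ∣ p ∪ q ∣ ≤ ∣ p ∣ + ∣ q ∣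
∣p∪q∣≤∣p∣+∣q∣ []            []            = ℕ.z≤n
∣p∪q∣≤∣p∣+∣q∣ (outside ∷ p) (outside ∷ q) = ∣p∪q∣≤∣p∣+∣q∣ p q
∣p∪q∣≤∣p∣+∣q∣ (outside ∷ p) (inside ∷ q)  =
  ℕ.≤-trans (ℕ.s≤s (∣p∪q∣≤∣p∣+∣q∣ p q)) (ℕ.≤-reflexive (sym (ℕ.+-suc ∣ p ∣ ∣ q ∣)))
∣p∪q∣≤∣p∣+∣q∣ (inside ∷ p)  (outside ∷ q) = ℕ.s≤s (∣p∪q∣≤∣p∣+∣q∣ p q)
∣p∪q∣≤∣p∣+∣q∣ (inside ∷ p)  (inside ∷ q)  =
  ℕ.s≤s (ℕ.≤-trans (∣p∪q∣≤∣p∣+∣q∣ p q) (ℕ.+-monoʳ-≤ ∣ p ∣ (ℕ.n≤1+n ∣ q ∣)))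

disjoint⇒∣p∣+∣q∣≡∣p∪q∣ : ∀ (p q : Subset n) → (∀ {x} → x ∈ p → x ∉ q) → ∣ p ∣ + ∣ q ∣ ≡ ∣ p ∪ q ∣
disjoint⇒∣p∣+∣q∣≡∣p∪q∣ []            []            dis = refl
disjoint⇒∣p∣+∣q∣≡∣p∪q∣ (outside ∷ p) (outside ∷ q) dis =
  disjoint⇒∣p∣+∣q∣≡∣p∪q∣ p q λ x∈p x∈q → dis (there x∈p) (there x∈q)
disjoint⇒∣p∣+∣q∣≡∣p∪q∣ (outside ∷ p) (inside ∷ q)  dis = trans (ℕ.+-suc ∣ p ∣ ∣ q ∣)
  (cong suc (disjoint⇒∣p∣+∣q∣≡∣p∪q∣ p q λ x∈p x∈q → dis (there x∈p) (there x∈q)))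
disjoint⇒∣p∣+∣q∣≡∣p∪q∣ (inside ∷ p)  (outside ∷ q) dis =
  cong suc (disjoint⇒∣p∣+∣q∣≡∣p∪q∣ p q λ x∈p x∈q → dis (there x∈p) (there x∈q))
disjoint⇒∣p∣+∣q∣≡∣p∪q∣ (inside ∷ p)  (inside ∷ q)  dis = contradiction here (dis here)

disjoint-bound : ∀ (p q r s : Subset n) → (∀ {x} → x ∈ p → x ∉ q) →
                 (∀ {x} → x ∈ p → x ∈ r ⊎ x ∈ s) → (∀ {x} → x ∈ q → x ∈ r ⊎ x ∈ s) →
                 ∣ p ∣ + ∣ q ∣ ≤ ∣ r ∣ + ∣ s ∣
disjoint-bound p q r s dis p⊆ q⊆ = begin
  ∣ p ∣ + ∣ q ∣ ≡⟨ disjoint⇒∣p∣+∣q∣≡∣p∪q∣ p q dis ⟩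
  ∣ p ∪ q ∣     ≤⟨ p⊆q⇒∣p∣≤∣q∣ (λ x∈ → x∈p∪q⁺ ([ p⊆ , q⊆ ]′ (x∈p∪q⁻ p q x∈))) ⟩
  ∣ r ∪ s ∣     ≤⟨ ∣p∪q∣≤∣p∣+∣q∣ r s ⟩
  ∣ r ∣ + ∣ s ∣ ∎
  where open ℕ.≤-Reasoning

shrink : ∀ (p : Subset n) k → k ≤ ∣ p ∣ → ∃[ q ] q ⊆ p × ∣ q ∣ ≡ k
shrink []            zero    k≤ = [] , id , refl
shrink (outside ∷ p) k       k≤ with shrink p k k≤
... | q , q⊆p , eq = outside ∷ q , s⊆s q⊆p , eq
shrink {suc n} (inside ∷ p) zero k≤ = ⊥ , ⊆-min (inside ∷ p) , ∣⊥∣≡0 (suc n)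
shrink (inside ∷ p)  (suc k) (ℕ.s≤s k≤) with shrink p k k≤
... | q , q⊆p , eq = inside ∷ q , s⊆s q⊆p , cong suc eq

∈-subsets : ∀ (σ : Subset n) → σ List.∈ subsets n
∈-subsets []            = here refl
∈-subsets (outside ∷ σ) = ∈-++⁺ˡ (∈-map⁺ (outside ∷_) (∈-subsets σ))
∈-subsets {suc n} (inside ∷ σ) =
  ∈-++⁺ʳ (List.map (outside ∷_) (subsets n)) (∈-map⁺ (inside ∷_) (∈-subsets σ))

comprehension : {P : Fin n → Set} → (∀ x → Dec (P x)) → Subset n
comprehension P? = tabulate (does ∘ P?)

module _ {P : Fin n → Set} (P? : ∀ x → Dec (P x)) where

  ∈-comprehension⁺ : ∀ {x} → P x → x ∈ comprehension P?
  ∈-comprehension⁺ {x} px = lookup⇒[]= x _ (trans (lookup∘tabulate (does ∘ P?) x) (dec-true (P? x) px))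

  ∈-comprehension⁻ : ∀ {x} → x ∈ comprehension P? → P x
  ∈-comprehension⁻ {x} x∈ with P? x | trans (sym (lookup∘tabulate (does ∘ P?) x)) ([]=⇒lookup x∈)
  ... | yes px | _ = px

∣σ∣≤rank : (K : Complex n) → ∀ {σ} → Face K σ → ∣ σ ∣ ≤ rank K
∣σ∣≤rank {n} K {σ} f = All.lookup (xs≤max 0 (List.map ∣_∣ (List.filter (face? K) (subsets n))))
  (∈-map⁺ ∣_∣ (∈-filter⁺ (face? K) (∈-subsets σ) f))

rank-attained : (K : Complex n) → Face K ⊥ → ∃[ σ ] Face K σ × ∣ σ ∣ ≡ rank K
rank-attained {n} K f⊥ with argmax-sel id 0 (List.map ∣_∣ (List.filter (face? K) (subsets n)))
... | inj₁ r≡0 = ⊥ , f⊥ , trans (∣⊥∣≡0 n) (sym r≡0)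
... | inj₂ r∈ with ∈-map⁻ ∣_∣ r∈
...   | σ , σ∈ , eq = σ , proj₂ (∈-filter⁻ (face? K) {xs = subsets n} σ∈) , sym eq

module Spanning (M : Matroid n) (k : ℕ) where

  Spans : Subset n → Set
  Spans A = ∃[ Z ] (Face (indep M) Z × Z ⊆ A × ∣ Z ∣ ≡ k)

  spans? : ∀ A → Dec (Spans A)
  spans? A = anySubset? λ Z → face? (indep M) Z ×-dec ((Z ⊆? A) ×-dec (∣ Z ∣ ℕ.≟ k))

  Spans-mono : ∀ {A B} → A ⊆ B → Spans A → Spans B
  Spans-mono A⊆B (Z , f , Z⊆A , size) = Z , f , A⊆B ∘ Z⊆A , size

  -- The dual of the truncation of M to rank k.
  dual : Complex n
  dual .Face τ = Spans (∁ τ)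
  dual .face? τ = spans? (∁ τ)
  dual .down-closed τ⊆σ = Spans-mono (p⊆q⇒∁p⊇∁q τ⊆σ)

  -- From bases T outside A and Y outside B, the part of Y outside A is extended by elements of T to
  -- a basis Z, which still avoids A. If Z contained all of B outside A, then Y and B, which are
  -- disjoint, would both lie in the union of Z and A, and |B| would be at most |A|.
  dual-augments : Augments dual
  dual-augments {A} {B} (T , fT , T⊆∁A , ∣T∣) (Y , fY , Y⊆∁B , ∣Y∣) A<B
    with extend {N = indep M} (augment M) (down-closed (indep M) (p∩q⊆p Y (∁ A)) fY) fT
           (ℕ.≤-trans (∣p∩q∣≤∣p∣ Y (∁ A)) (ℕ.≤-reflexive (trans ∣Y∣ (sym ∣T∣))))
  ... | Z , Y₀⊆Z , Z⊆Y₀∪T , fZ , ∣Z∣ with any? (λ x → (x ∈? B) ×-dec (¬? (x ∈? A) ×-dec ¬? (x ∈? Z)))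
  ... | yes (x , x∈B , x∉A , x∉Z) = x , x∈B , x∉A , Z , fZ , Z⊆ , trans ∣Z∣ ∣T∣
    where
    Z⊆ : Z ⊆ ∁ (A ∪ ⁅ x ⁆)
    Z⊆ {y} y∈Z = x∉p⇒x∈∁p λ y∈ → [ (λ y∈A → [ (λ y∈Y₀ → x∈∁p⇒x∉p (p∩q⊆q Y (∁ A) y∈Y₀) y∈A)
                                              , (λ y∈T → x∈∁p⇒x∉p (T⊆∁A y∈T) y∈A)
                                              ]′ (x∈p∪q⁻ (Y ∩ ∁ A) T (Z⊆Y₀∪T y∈Z)))
                                    , (λ y∈x → x∉Z (subst (_∈ Z) (x∈⁅y⁆⇒x≡y x y∈x) y∈Z))
                                    ]′ (x∈p∪q⁻ A ⁅ x ⁆ y∈)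
  ... | no none = contradiction
      (ℕ.+-cancelˡ-≤ k ∣ B ∣ ∣ A ∣ (subst₂ _≤_ (cong (_+ ∣ B ∣) ∣Y∣) (cong (_+ ∣ A ∣) (trans ∣Z∣ ∣T∣))
        (disjoint-bound Y B Z A (λ x∈Y → x∈∁p⇒x∉p (Y⊆∁B x∈Y)) Y⊆Z∪A B⊆Z∪A)))
      (ℕ.<⇒≱ A<B)
    where
    Y⊆Z∪A : ∀ {x} → x ∈ Y → x ∈ Z ⊎ x ∈ A
    Y⊆Z∪A {x} x∈Y with x ∈? A
    ... | yes x∈A = inj₂ x∈A
    ... | no  x∉A = inj₁ (Y₀⊆Z (x∈p∩q⁺ (x∈Y , x∉p⇒x∈∁p x∉A)))

    B⊆Z∪A : ∀ {x} → x ∈ B → x ∈ Z ⊎ x ∈ A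
    B⊆Z∪A {x} x∈B with x ∈? A | x ∈? Z
    ... | yes x∈A | _       = inj₂ x∈A
    ... | no  _   | yes x∈Z = inj₁ x∈Z
    ... | no  x∉A | no  x∉Z = contradiction (x , x∈B , x∉A , x∉Z) none

↾-augments : {N : Complex n} → Augments N → ∀ I → Augments (N ↾ I)
↾-augments aug I (fA , A⊆I) (fB , B⊆I) A<B with aug fA fB A<B
... | x , x∈B , x∉A , f = x , x∈B , x∉A , f , ∪⁅⁆⊆ A⊆I (B⊆I x∈B)

-- AcyclicBelow K a says that a ≤ η_H(K).
AcyclicBelow : Complex n → ℕ → Set
AcyclicBelow K a = (0 ℕ.< a → Face K ⊥) × (∀ p → p ℕ.< a → Fills K p)

HomologicalHypothesis : Complex n → Matroid n → ℕ → Set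
HomologicalHypothesis {n} C M k = ∀ (X : Subset n) → IsFlat M (∁ X) → rank (indep M ↾ ∁ X) ≤ k ∸ 1 →
  ∃[ a ] AcyclicBelow (C ↾ X) a × a + rank (indep M ↾ ∁ X) ℕ.≥ k + 1

module _ (C : Complex n) (M : Matroid n) (k : ℕ) (1≤k : 1 ≤ k) (k≤rank : k ≤ rank (indep M))
  (hyp : HomologicalHypothesis C M k) where

  open Spanning M k

  basis : Spans ⊤
  basis with rank-attained (indep M) (empty M)
  ... | S , fS , ∣S∣ with shrink S k (subst (k ≤_) (sym ∣S∣) k≤rank)
  ...   | T , T⊆S , ∣T∣ = T , down-closed (indep M) T⊆S fS , ⊆⊤ , ∣T∣

  dual-nonempty : Face dual ⊥
  dual-nonempty = Spans-mono (λ _ → x∉p⇒x∈∁p ∉⊥) basis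

  fillable : ∀ I s → ∣ I ∣ ≢ 0 → s ≤ ∣ I ∣ → JoinFills (dual ↾ I) (C ↾ I) s
  fillable I s I≢0 s≤I = cases (k ℕ.≤? ρ) (all? flat-at?)
    where
    ρ = rank (indep M ↾ ∁ I)

    FlatAt : Fin n → Set
    FlatAt x = x ∉ ∁ I → rank (indep M ↾ (∁ I ∪ ⁅ x ⁆)) ℕ.> ρ

    flat-at? : ∀ x → Dec (FlatAt x)
    flat-at? x = ¬? (x ∈? ∁ I) →-dec (ρ ℕ.<? rank (indep M ↾ (∁ I ∪ ⁅ x ⁆)))

    attained = rank-attained (indep M ↾ ∁ I) (empty M , ⊆-min (∁ I))

    G = proj₁ attained

    fG : Face (indep M) G
    fG = proj₁ (proj₁ (proj₂ attained))

    G⊆∁I : G ⊆ ∁ I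
    G⊆∁I = proj₂ (proj₁ (proj₂ attained))

    ∣G∣ : ∣ G ∣ ≡ ρ
    ∣G∣ = proj₂ (proj₂ attained)

    nonempty : ∃[ x ] x ∈ I × x ∉ ⊥
    nonempty = ∣p∣<∣q∣⇒∃x∈q∖p ⊥ I (subst (ℕ._< ∣ I ∣) (sym (∣⊥∣≡0 n)) (ℕ.n≢0⇒n>0 I≢0))

    avoid : ∀ {x τ} {Z : Subset n} → Z ⊆ ∁ τ → x ∉ Z → Z ⊆ ∁ (τ ∪ ⁅ x ⁆)
    avoid {x} {τ} {Z} Z⊆∁τ x∉Z y∈Z = x∉p⇒x∈∁p λ y∈ →
      [ x∈∁p⇒x∉p (Z⊆∁τ y∈Z) , (λ y∈x → x∉Z (subst (_∈ Z) (x∈⁅y⁆⇒x≡y x y∈x) y∈Z)) ]′ (x∈p∪q⁻ τ ⁅ x ⁆ y∈)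

    -- A basis inside ∁ I survives the removal of any part of I, so every element of I is a cone
    -- point.
    spanning-case : k ≤ ρ → JoinFills (dual ↾ I) (C ↾ I) s
    spanning-case k≤ρ with shrink G k (subst (k ≤_) (sym ∣G∣) k≤ρ) | nonempty
    ... | Z , Z⊆G , ∣Z∣ | x , x∈I , _ = JoinFills-coloop (dual ↾ I) (C ↾ I) x
      (λ { τ (_ , τ⊆I) → (Z , down-closed (indep M) Z⊆G fG ,
             avoid (λ y∈Z → p⊆q⇒∁p⊇∁q τ⊆I (G⊆∁I (Z⊆G y∈Z)))
                   (λ x∈Z → x∈∁p⇒x∉p (G⊆∁I (Z⊆G x∈Z)) x∈I) , ∣Z∣) ,
           ∪⁅⁆⊆ τ⊆I x∈I }) s

    nonflat-case : ρ ℕ.< k → ∀ x → ¬ FlatAt x → JoinFills (dual ↾ I) (C ↾ I) s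
    nonflat-case ρ<k x ¬flat with x ∈? ∁ I
    ... | yes x∈∁I = contradiction (λ x∉∁I → contradiction x∈∁I x∉∁I) ¬flat
    ... | no  x∉∁I = JoinFills-coloop (dual ↾ I) (C ↾ I) x coloop s
      where
      coloop : ∀ τ → Face (dual ↾ I) τ → Face (dual ↾ I) (τ ∪ ⁅ x ⁆)
      coloop τ ((Z₀ , fZ₀ , Z₀⊆∁τ , ∣Z₀∣) , τ⊆I)
        with extend {N = indep M} (augment M) fG fZ₀ (subst₂ _≤_ (sym ∣G∣) (sym ∣Z₀∣) (ℕ.<⇒≤ ρ<k))
      ... | Z , G⊆Z , Z⊆G∪Z₀ , fZ , ∣Z∣ = (Z , fZ , avoid Z⊆∁τ x∉Z , trans ∣Z∣ ∣Z₀∣) ,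
                                           ∪⁅⁆⊆ τ⊆I (x∉∁p⇒x∈p x∉∁I)
        where
        Z⊆∁τ : Z ⊆ ∁ τ
        Z⊆∁τ y∈Z = [ (λ y∈G → p⊆q⇒∁p⊇∁q τ⊆I (G⊆∁I y∈G)) , (λ y∈Z₀ → Z₀⊆∁τ y∈Z₀) ]′
                     (x∈p∪q⁻ G Z₀ (Z⊆G∪Z₀ y∈Z))

        x∉Z : x ∉ Z
        x∉Z x∈Z = ¬flat λ _ → ℕ.≤-trans
          (ℕ.≤-reflexive (sym (trans (∣p∪⁅x⁆∣ G (λ x∈G → x∉∁I (G⊆∁I x∈G))) (cong suc ∣G∣))))
          (∣σ∣≤rank (indep M ↾ (∁ I ∪ ⁅ x ⁆)) {G ∪ ⁅ x ⁆}
            (down-closed (indep M) (∪⁅⁆⊆ G⊆Z x∈Z) fZ ,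
             ∪⁅⁆⊆ (λ y∈G → p⊆p∪q ⁅ x ⁆ (G⊆∁I y∈G)) (q⊆p∪q (∁ I) ⁅ x ⁆ (x∈⁅x⁆ x))))

    -- The part of I outside a basis Z is a face of the dual. Taking Z to contain the ρ elements of
    -- `G`, which lie outside I, makes this face as large as the hypothesis requires.
    flat-case : ρ ℕ.< k → IsFlat M (∁ I) → JoinFills (dual ↾ I) (C ↾ I) s
    flat-case ρ<k flat with hyp I flat (ℕ.∸-monoˡ-≤ 1 ρ<k) | basis
    ... | a , (_ , fills) , a+ρ≥ | T , fT , _ , ∣T∣
      with extend {N = indep M} (augment M) fG fT (subst₂ _≤_ (sym ∣G∣) (sym ∣T∣) (ℕ.<⇒≤ ρ<k))
    ... | Z , G⊆Z , _ , fZ , ∣Z∣ = JoinFills-matroid (dual ↾ I) (↾-augments {N = dual} dual-augments I) (C ↾ I)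
      fills {I ∩ ∁ Z} ((Z , fZ , (λ x∈Z → x∉p⇒x∈∁p λ x∈B → x∈∁p⇒x∉p (p∩q⊆q I (∁ Z) x∈B) x∈Z) ,
                        trans ∣Z∣ ∣T∣) , p∩q⊆p I (∁ Z)) s s<
      where
      B = I ∩ ∁ Z

      I+ρ≤ : ∣ I ∣ + ρ ≤ ∣ B ∣ + k
      I+ρ≤ = subst₂ _≤_ (cong (∣ I ∣ +_) ∣G∣) (cong (∣ B ∣ +_) (trans ∣Z∣ ∣T∣))
        (disjoint-bound I G B Z (λ x∈I x∈G → x∈∁p⇒x∉p (G⊆∁I x∈G) x∈I) I⊆ (λ x∈G → inj₂ (G⊆Z x∈G)))
        where
        I⊆ : ∀ {x} → x ∈ I → x ∈ B ⊎ x ∈ Z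
        I⊆ {x} x∈I with x ∈? Z
        ... | yes x∈Z = inj₂ x∈Z
        ... | no  x∉Z = inj₁ (x∈p∩q⁺ (x∈I , x∉p⇒x∈∁p x∉Z))

      -- The summand 1 in k + 1 makes the bound strict at s = |I|, the size that the homotopy needs.
      s< : s ℕ.< a + ∣ B ∣
      s< = ℕ.+-cancelʳ-≤ ρ (suc s) (a + ∣ B ∣) (begin
        suc s + ρ           ≤⟨ ℕ.s≤s (ℕ.+-monoˡ-≤ ρ s≤I) ⟩
        suc (∣ I ∣ + ρ)     ≤⟨ ℕ.s≤s I+ρ≤ ⟩
        suc (∣ B ∣ + k)     ≡⟨ trans (sym (ℕ.+-suc ∣ B ∣ k)) (cong (∣ B ∣ +_) (ℕ.+-comm 1 k)) ⟩
        ∣ B ∣ + (k + 1)     ≤⟨ ℕ.+-monoʳ-≤ ∣ B ∣ a+ρ≥ ⟩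
        ∣ B ∣ + (a + ρ)     ≡⟨ sym (ℕ.+-assoc ∣ B ∣ a ρ) ⟩
        ∣ B ∣ + a + ρ       ≡⟨ cong (_+ ρ) (ℕ.+-comm ∣ B ∣ a) ⟩
        a + ∣ B ∣ + ρ       ∎)
        where open ℕ.≤-Reasoning

    cases : Dec (k ≤ ρ) → Dec (∀ x → FlatAt x) → JoinFills (dual ↾ I) (C ↾ I) s
    cases (yes k≤ρ) _          = spanning-case k≤ρ
    cases (no k≰ρ)  (yes flat) = flat-case (ℕ.≰⇒> k≰ρ) flat
    cases (no k≰ρ)  (no ¬flat) with ¬∀⟶∃¬ n FlatAt flat-at? ¬flat
    ... | x , ¬flat-x = nonflat-case (ℕ.≰⇒> k≰ρ) x ¬flat-x

  -- The hypothesis at the flat of loops provides a vertex of C.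
  C-nonempty : Face C ⊥
  C-nonempty = proj₁ (proj₁ (proj₁ (proj₂ at-loops)) (ℕ.<-≤-trans 0<k+1 k+1≤a))
    where
    loop? : ∀ x → Dec (¬ Face (indep M) ⁅ x ⁆)
    loop? x = ¬? (face? (indep M) ⁅ x ⁆)

    L = comprehension loop?

    rank-L : rank (indep M ↾ ∁ (∁ L)) ≡ 0
    rank-L with rank-attained (indep M ↾ ∁ (∁ L)) (empty M , ⊆-min _)
    ... | S , (fS , S⊆L) , ∣S∣ with ∣ S ∣ ℕ.≟ 0
    ...   | yes S≡0 = trans (sym ∣S∣) S≡0
    ...   | no  S≢0 with ∣p∣<∣q∣⇒∃x∈q∖p ⊥ S (subst (ℕ._< ∣ S ∣) (sym (∣⊥∣≡0 n)) (ℕ.n≢0⇒n>0 S≢0))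
    ...     | x , x∈S , _ = contradiction
      (down-closed (indep M) (λ y∈x → subst (_∈ S) (sym (x∈⁅y⁆⇒x≡y x y∈x)) x∈S) fS)
      (∈-comprehension⁻ loop? (subst (x ∈_) (∁-involutive L) (S⊆L x∈S)))

    flat-L : IsFlat M (∁ (∁ L))
    flat-L x x∉ = subst (rank (indep M ↾ (∁ (∁ L) ∪ ⁅ x ⁆)) ℕ.>_) (sym rank-L)
      (subst (_≤ rank (indep M ↾ (∁ (∁ L) ∪ ⁅ x ⁆))) (∣⁅x⁆∣≡1 x)
        (∣σ∣≤rank (indep M ↾ (∁ (∁ L) ∪ ⁅ x ⁆)) {⁅ x ⁆} (nonloop , q⊆p∪q (∁ (∁ L)) ⁅ x ⁆)))
      where
      nonloop : Face (indep M) ⁅ x ⁆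
      nonloop with face? (indep M) ⁅ x ⁆
      ... | yes f = f
      ... | no ¬f = contradiction (subst (x ∈_) (sym (∁-involutive L)) (∈-comprehension⁺ loop? ¬f)) x∉

    at-loops = hyp (∁ L) flat-L (subst (_≤ k ∸ 1) (sym rank-L) ℕ.z≤n)

    0<k+1 : 0 ℕ.< k + 1
    0<k+1 = subst (0 ℕ.<_) (ℕ.+-comm 1 k) (ℕ.s≤s ℕ.z≤n)

    k+1≤a : k + 1 ≤ proj₁ at-loops
    k+1≤a = subst (k + 1 ≤_) (trans (cong (proj₁ at-loops +_) rank-L) (ℕ.+-identityʳ _)) (proj₂ (proj₂ at-loops))

-- The reconfiguration graph

_≟ˢ_ : DecidableEquality (Subset n)
_≟ˢ_ = ≡-dec Bool._≟_

-- Union-find: merging the classes of the two ends of each edge in turn.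
component-labels : {X : Set} → DecidableEquality X → {R : X → X → Set} →
  (∀ x y → Dec (R x y)) → Symmetric R → (es : List (X × X)) →
  Σ[ ℓ ∈ (X → X) ] (∀ {x y} → (x , y) List.∈ es → R x y → ℓ x ≡ ℓ y) × (∀ x y → ℓ x ≡ ℓ y → Star R x y)
component-labels _≟_ R? R-sym [] = id , (λ ()) , λ { x _ refl → nil }
component-labels {X} _≟_ {R} R? R-sym ((a , b) ∷ es) with component-labels _≟_ R? R-sym es | R? a b
... | ℓ , sound , complete | no ¬r = ℓ , (λ { (here refl) r → contradiction r ¬r ; (there e∈) → sound e∈ }) , complete
... | ℓ , sound , complete | yes r = ℓ' , sound' , complete'
  where
  ℓ' : X → X
  ℓ' x = if does (ℓ x ≟ ℓ b) then ℓ a else ℓ x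

  sound' : ∀ {x y} → (x , y) List.∈ ((a , b) ∷ es) → R x y → ℓ' x ≡ ℓ' y
  sound' (there e∈) r' = cong (λ c → if does (c ≟ ℓ b) then ℓ a else c) (sound e∈ r')
  sound' (here refl) _ with ℓ a ≟ ℓ b | ℓ b ≟ ℓ b
  ... | yes _ | yes _ = refl
  ... | no  _ | yes _ = refl
  ... | _     | no ≢  = contradiction refl ≢

  complete' : ∀ x y → ℓ' x ≡ ℓ' y → Star R x y
  complete' x y eq with ℓ x ≟ ℓ b | ℓ y ≟ ℓ b
  ... | yes x~b | yes y~b = complete x y (trans x~b (sym y~b))
  ... | no  _   | no  _   = complete x y eq
  ... | yes x~b | no  _   = complete x b x~b ◅◅ (R-sym r ◅ complete a y eq)
  ... | no  _   | yes y~b = complete x a eq ◅◅ (r ◅ complete b y (sym y~b))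

module Reconfiguration (C : Complex n) (M : Matroid n) (k : ℕ) where

  open RGVertex
  open RGAdjacent

  vertex? : ∀ σ → Dec (RGVertex C M k σ)
  vertex? σ = map′ (λ { (i , s , z) → record { independent = i ; simplex = s ; size = z } })
                   (λ v → independent v , simplex v , size v)
                   (face? (indep M) σ ×-dec (face? C σ ×-dec (∣ σ ∣ ℕ.≟ k)))

  adjacent? : ∀ σ τ → Dec (RGAdjacent C M k σ τ)
  adjacent? σ τ = map′
    (λ { (s , t , f , z) → record { source = s ; target = t ; union-face = f ; union-size = z } })
    (λ a → source a , target a , union-face a , union-size a)
    (vertex? σ ×-dec (vertex? τ ×-dec (face? C (σ ∪ τ) ×-dec (∣ σ ∪ τ ∣ ℕ.≟ k + 1))))

  adjacent-sym : Symmetric (RGAdjacent C M k)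
  adjacent-sym {σ} {τ} a = record
    { source = target a ; target = source a
    ; union-face = subst (Face C) (∪-comm σ τ) (union-face a)
    ; union-size = trans (cong ∣_∣ (∪-comm τ σ)) (union-size a) }

  -- Basis exchange towards `τ` stays inside `F`, so the union of consecutive vertices is a face of
  -- `C`. Hence all bases contained in one face belong to one component.
  connected-in-simplex : ∀ {F} → Face C F → ∀ {σ τ} → σ ⊆ F → τ ⊆ F →
                         RGVertex C M k σ → RGVertex C M k τ → Star (RGAdjacent C M k) σ τ
  connected-in-simplex {F} fF {σ₀} {τ} σ₀⊆F τ⊆F vσ₀ vτ = go ∣ σ₀ ∩ ∁ τ ∣ σ₀⊆F vσ₀ ℕ.≤-refl
    where
    go : ∀ d {σ} → σ ⊆ F → RGVertex C M k σ → ∣ σ ∩ ∁ τ ∣ ≤ d → Star (RGAdjacent C M k) σ τ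
    go d {σ} σ⊆F vσ σ∖τ≤d with any? (λ x → (x ∈? σ) ×-dec ¬? (x ∈? τ))
    ... | no none = subst (Star (RGAdjacent C M k) σ)
            (p⊆q∧∣q∣≤∣p∣⇒p≡q σ⊆τ (ℕ.≤-reflexive (trans (size vτ) (sym (size vσ))))) nil
      where
      σ⊆τ : σ ⊆ τ
      σ⊆τ {x} x∈σ with x ∈? τ
      ... | yes x∈τ = x∈τ
      ... | no  x∉τ = contradiction (x , x∈σ , x∉τ) none
    ... | yes (x , x∈σ , x∉τ) = exchange d σ∖τ≤d
      where
      S = σ ∩ ∁ ⁅ x ⁆

      x∉S : x ∉ S
      x∉S x∈S = x∈∁p⇒x∉p (p∩q⊆q σ (∁ ⁅ x ⁆) x∈S) (x∈⁅x⁆ x)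

      σ⊆S∪x : σ ⊆ S ∪ ⁅ x ⁆
      σ⊆S∪x {y} y∈σ with y ∈? ⁅ x ⁆
      ... | yes y∈x = q⊆p∪q S ⁅ x ⁆ y∈x
      ... | no  y∉x = p⊆p∪q ⁅ x ⁆ (x∈p∩q⁺ (y∈σ , x∉p⇒x∈∁p y∉x))

      suc∣S∣ : suc ∣ S ∣ ≡ k
      suc∣S∣ = trans (sym (∣p∪⁅x⁆∣ S x∉S))
        (trans (cong ∣_∣ (⊆-antisym (∪⁅⁆⊆ (p∩q⊆p σ (∁ ⁅ x ⁆)) x∈σ) σ⊆S∪x)) (size vσ))

      -- The element `x` outside τ is traded for some `y` of τ, which brings σ closer to τ.
      new = augment M (down-closed (indep M) (p∩q⊆p σ (∁ ⁅ x ⁆)) (independent vσ)) (independent vτ)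
              (ℕ.≤-reflexive (trans suc∣S∣ (sym (size vτ))))

      y = proj₁ new

      y∈τ : y ∈ τ
      y∈τ = proj₁ (proj₂ new)

      y∉S : y ∉ S
      y∉S = proj₁ (proj₂ (proj₂ new))

      σ' = S ∪ ⁅ y ⁆

      y∉σ : y ∉ σ
      y∉σ y∈σ = y∉S (x∈p∩q⁺ (y∈σ , x∉p⇒x∈∁p λ y∈x → x∉τ (subst (_∈ τ) (x∈⁅y⁆⇒x≡y x y∈x) y∈τ)))

      σ'⊆F : σ' ⊆ F
      σ'⊆F = ∪⁅⁆⊆ (λ z∈S → σ⊆F (p∩q⊆p σ (∁ ⁅ x ⁆) z∈S)) (τ⊆F y∈τ)

      vσ' : RGVertex C M k σ'
      vσ' = record { independent = proj₂ (proj₂ (proj₂ new)) ; simplex = down-closed C σ'⊆F fF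
                   ; size = trans (∣p∪⁅x⁆∣ S y∉S) suc∣S∣ }

      ∪≡ : σ ∪ σ' ≡ σ ∪ ⁅ y ⁆
      ∪≡ = ⊆-antisym
        (λ z∈ → [ p⊆p∪q ⁅ y ⁆ , (λ z∈σ' → [ (λ z∈S → p⊆p∪q ⁅ y ⁆ (p∩q⊆p σ (∁ ⁅ x ⁆) z∈S)) , q⊆p∪q σ ⁅ y ⁆ ]′
                                             (x∈p∪q⁻ S ⁅ y ⁆ z∈σ')) ]′ (x∈p∪q⁻ σ σ' z∈))
        (∪⁅⁆⊆ (p⊆p∪q σ') (q⊆p∪q σ σ' (q⊆p∪q S ⁅ y ⁆ (x∈⁅x⁆ y))))

      edge : RGAdjacent C M k σ σ'
      edge = record
        { source = vσ ; target = vσ'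
        ; union-face = down-closed C (λ z∈ → [ (λ z∈σ → σ⊆F z∈σ) , (λ z∈σ' → σ'⊆F z∈σ') ]′ (x∈p∪q⁻ σ σ' z∈)) fF
        ; union-size = trans (cong ∣_∣ ∪≡) (trans (∣p∪⁅x⁆∣ σ y∉σ) (trans (cong suc (size vσ)) (ℕ.+-comm 1 k))) }

      decrease : ∣ σ' ∩ ∁ τ ∣ ℕ.< ∣ σ ∩ ∁ τ ∣
      decrease = p⊂q⇒∣p∣<∣q∣ (sub , x , x∈p∩q⁺ (x∈σ , x∉p⇒x∈∁p x∉τ) ,
        λ x∈ → [ x∉S , (λ x∈y → x∉τ (subst (_∈ τ) (sym (x∈⁅y⁆⇒x≡y y x∈y)) y∈τ)) ]′
                 (x∈p∪q⁻ S ⁅ y ⁆ (p∩q⊆p σ' (∁ τ) x∈)))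
        where
        sub : σ' ∩ ∁ τ ⊆ σ ∩ ∁ τ
        sub {z} z∈ with x∈p∩q⁻ σ' (∁ τ) z∈
        ... | z∈σ' , z∈∁τ with x∈p∪q⁻ S ⁅ y ⁆ z∈σ'
        ...   | inj₁ z∈S = x∈p∩q⁺ (p∩q⊆p σ (∁ ⁅ x ⁆) z∈S , z∈∁τ)
        ...   | inj₂ z∈y = contradiction (subst (_∈ τ) (sym (x∈⁅y⁆⇒x≡y y z∈y)) y∈τ) (x∈∁p⇒x∉p z∈∁τ)

      exchange : ∀ d → ∣ σ ∩ ∁ τ ∣ ≤ d → Star (RGAdjacent C M k) σ τ
      exchange zero    ≤0 = contradiction (ℕ.<-≤-trans decrease ≤0) λ ()
      exchange (suc d) ≤d = edge ◅ go d σ'⊆F vσ' (ℕ.≤-pred (ℕ.<-≤-trans decrease ≤d))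

homological-theorem : (C : Complex n) (M : Matroid n) (k : ℕ) → 1 ≤ k → k ≤ rank (indep M) →
                      HomologicalHypothesis C M k → RGConnected C M k
homological-theorem {n} C M k 1≤k k≤rank hyp = vertex-exists , λ {σ} {τ} → connected σ τ
  where
  open Spanning M k
  open Reconfiguration C M k
  open Colourful dual C (dual-nonempty C M k 1≤k k≤rank hyp) (C-nonempty C M k 1≤k k≤rank hyp)

  fill : ∀ e → e ≤ 1 → Fillable dual C e
  fill e e≤1 I t size = fillable C M k 1≤k k≤rank hyp I (t + e) (λ I≡0 → contradiction (trans (sym I≡0) size) λ ())
    (ℕ.≤-trans (ℕ.+-monoʳ-≤ t e≤1) (ℕ.≤-reflexive (trans (ℕ.+-comm t 1) (sym size))))

  base-vertex : ∀ {A} → Face C A → (s : Spans A) → RGVertex C M k (proj₁ s)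
  base-vertex f (Z , fZ , Z⊆A , size) =
    record { independent = fZ ; simplex = down-closed C Z⊆A f ; size = size }

  vertex-exists : ∃ (RGVertex C M k)
  vertex-exists with rainbow-exists (fill 0 ℕ.z≤n)
  ... | A , spans , f = proj₁ spans , base-vertex f' spans
    where
    f' : Face C (∁ (∁ A))
    f' = subst (Face C) (sym (∁-involutive A)) f

  labels = component-labels _≟ˢ_ adjacent? adjacent-sym (List.cartesianProduct (subsets n) (subsets n))

  ℓ = proj₁ labels

  ℓ-star : ∀ {σ τ} → Star (RGAdjacent C M k) σ τ → ℓ σ ≡ ℓ τ
  ℓ-star nil      = refl
  ℓ-star (r ◅ rs) = trans (proj₁ (proj₂ labels) (∈-cartesianProduct⁺ (∈-subsets _) (∈-subsets _)) r) (ℓ-star rs)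

  -- A rainbow simplex is a face containing a basis, possibly many; by `connected-in-simplex` the
  -- component does not depend on the choice. ⊥ is a placeholder for sets without a basis.
  base : Subset n → Subset n
  base A with spans? A
  ... | yes (Z , _) = Z
  ... | no  _       = ⊥

  base-spec : ∀ {A} → Face C A → Spans A → RGVertex C M k (base A) × base A ⊆ A
  base-spec {A} f s with spans? A
  ... | yes s'@(Z , _ , Z⊆A , _) = base-vertex f s' , Z⊆A
  ... | no  ¬s                   = contradiction s ¬s

  module _ (σ τ : Subset n) (vσ : RGVertex C M k σ) (vτ : RGVertex C M k τ) where

    open RGVertex

    -- The indicator of the component of `σ`; the labels `ℓ` make membership decidable.
    χ : Subset n → ℚ
    χ A = if does (ℓ (base A) ≟ˢ ℓ σ) then 1ℚ else 0ℚ

    χ-invariant : ∀ {ρ A} → ρ ⊆ A → Face C A → Face dual (∁ ρ) → χ ρ ≡ χ A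
    χ-invariant {ρ} {A} ρ⊆A f s = cong (λ c → if does (c ≟ˢ ℓ σ) then 1ℚ else 0ℚ)
      (ℓ-star (connected-in-simplex f (λ x∈ → ρ⊆A (proj₂ specρ x∈)) (proj₂ specA) (proj₁ specρ) (proj₁ specA)))
      where
      sρ : Spans ρ
      sρ = subst Spans (∁-involutive ρ) s

      specρ = base-spec (down-closed C ρ⊆A f) sρ
      specA = base-spec f (Spans-mono ρ⊆A sρ)

    spans-self : ∀ {σ} → RGVertex C M k σ → Spans σ
    spans-self {σ} v = σ , independent v , id , size v

    rainbow : ∀ {σ} → RGVertex C M k σ → Rainbow σ
    rainbow {σ} v = subst Spans (sym (∁-involutive σ)) (spans-self v) , simplex v

    base-self : ∀ {σ} → RGVertex C M k σ → base σ ≡ σ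
    base-self v with base-spec (simplex v) (spans-self v)
    ... | v' , ⊆σ = p⊆q∧∣q∣≤∣p∣⇒p≡q ⊆σ (ℕ.≤-reflexive (trans (size v) (sym (size v'))))

    same : χ σ ≡ χ τ → ℓ σ ≡ ℓ τ
    same eq with ℓ (base σ) ≟ˢ ℓ σ | ℓ (base τ) ≟ˢ ℓ σ
    ... | _      | yes τ~σ = trans (sym τ~σ) (cong ℓ (base-self vτ))
    ... | no σ≁σ | no _    = contradiction (cong ℓ (base-self vσ)) σ≁σ
    ... | yes _  | no _    = contradiction eq λ ()

    connected : Star (RGAdjacent C M k) σ τ
    connected = proj₂ (proj₂ labels) σ τ
      (same (rainbow-invariant (fill 1 ℕ.≤-refl) χ χ-invariant (rainbow vσ) (rainbow vτ)))

-- Ordered chains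

private
  variable
    A B : Set

-- Ordered simplicial chains are handled dually: an operator on chains of
-- tuples acts on functions of tuples by precomposition, so d φ t = φ (∂ t).
d : (Vec A m → ℚ) → Vec A (suc m) → ℚ
d {m = zero}  φ (p ∷ []) = φ []
d {m = suc m} φ (p ∷ t)  = φ t ℚ.- d (λ u → φ (p ∷ u)) t

d-cong : {φ ψ : Vec A m → ℚ} → (∀ t → φ t ≡ ψ t) → ∀ t → d φ t ≡ d ψ t
d-cong {m = zero}  φ≗ψ (p ∷ []) = φ≗ψ []
d-cong {m = suc m} φ≗ψ (p ∷ t)  = cong₂ ℚ._-_ (φ≗ψ t) (d-cong (λ u → φ≗ψ (p ∷ u)) t)

sub-swap : ∀ a b c d → (a ℚ.- b) ℚ.- (c ℚ.- d) ≡ (a ℚ.- c) ℚ.- (b ℚ.- d)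
sub-swap = solve 4 (λ a b c d → (a :- b) :- (c :- d) := (a :- c) :- (b :- d)) refl

d-sub : (φ ψ : Vec A m → ℚ) → ∀ t → d (λ u → φ u ℚ.- ψ u) t ≡ d φ t ℚ.- d ψ t
d-sub {m = zero}  φ ψ (p ∷ []) = refl
d-sub {m = suc m} φ ψ (p ∷ t)  = trans
  (cong (λ x → φ t ℚ.- ψ t ℚ.- x) (d-sub (λ u → φ (p ∷ u)) (λ u → ψ (p ∷ u)) t))
  (sub-swap (φ t) (ψ t) (d (λ u → φ (p ∷ u)) t) (d (λ u → ψ (p ∷ u)) t))

d-0 : {φ : Vec A m → ℚ} → ∀ t → (∀ u → (∀ {p} → p Vec.∈ u → p Vec.∈ t) → φ u ≡ 0ℚ) → d φ t ≡ 0ℚ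
d-0 {m = zero}  (p ∷ []) h = h [] λ ()
d-0 {m = suc m} (p ∷ t)  h = cong₂ ℚ._-_ (h t AnyV.there)
  (d-0 t λ u u⊆t → h (p ∷ u) λ { (AnyV.here eq) → AnyV.here eq ; (AnyV.there q∈u) → AnyV.there (u⊆t q∈u) })

d-map : (f : A → B) (φ : Vec B m → ℚ) → ∀ t → d (φ ∘ Vec.map f) t ≡ d φ (Vec.map f t)
d-map {m = zero}  f φ (p ∷ []) = refl
d-map {m = suc m} f φ (p ∷ t)  = cong (λ x → φ (Vec.map f t) ℚ.- x) (d-map f (λ u → φ (f p ∷ u)) t)

dd≡0 : (φ : Vec A m → ℚ) → ∀ t → d (d φ) t ≡ 0ℚ
dd≡0 {m = zero}  φ (p ∷ q ∷ []) = ℚ.+-inverseʳ (φ [])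
dd≡0 {m = suc m} φ (p ∷ t) = trans
  (cong (λ x → d φ t ℚ.- x) (trans (d-sub φ (d (λ u → φ (p ∷ u))) t)
    (cong (λ x → d φ t ℚ.- x) (dd≡0 (λ u → φ (p ∷ u)) t))))
  (solve 1 (λ x → x :- (x :- con 0ℚ) := con 0ℚ) refl (d φ t))

-- Congruence has to be listed in the absence of function extensionality. Subtraction suffices
-- because `d` is built from differences alone.
Additive : (Chain n → ℚ) → Set
Additive {n} T = (∀ {c c' : Chain n} → (∀ σ → c σ ≡ c' σ) → T c ≡ T c') ×
                 (∀ c c' → T (λ σ → c σ ℚ.- c' σ) ≡ T c ℚ.- T c')

∂ʳ-additive : ∀ (τ : Subset n) → Additive (λ c → ∂ʳ c τ)
∂ʳ-additive τ = (λ eq → ∂ʳ-cong eq τ) , λ c c' →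
  trans (∂ʳ-cong (λ σ → -≡lin (c σ) (c' σ)) τ)
    (trans (∂ʳ-linear 1ℚ (ℚ.- 1ℚ) c c' τ) (sym (-≡lin (∂ʳ c τ) (∂ʳ c' τ))))

wedge-additive : ∀ v (τ : Subset n) → Additive (λ c → wedge v c τ)
wedge-additive v τ = (λ eq → wedge-cong v eq τ) , λ c c' →
  trans (wedge-cong v (λ σ → -≡lin (c σ) (c' σ)) τ)
    (trans (wedge-linear v 1ℚ (ℚ.- 1ℚ) c c' τ) (sym (-≡lin (wedge v c τ) (wedge v c' τ))))

additive-d : {T : Chain n → ℚ} → Additive T → (φ : Vec A m → Chain n) → ∀ t →
             T (λ τ → d (λ u → φ u τ) t) ≡ d (λ u → T (φ u)) t
additive-d {m = zero}  add φ (p ∷ []) = refl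
additive-d {m = suc m} {T} add φ (p ∷ t) = trans
  (proj₂ add (φ t) (λ τ → d (λ u → φ (p ∷ u) τ) t))
  (cong (λ x → T (φ t) ℚ.- x) (additive-d add (λ u → φ (p ∷ u)) t))

-- The exterior product of the vertices: reordering a tuple changes signs, and a repeated vertex
-- gives 0, as the chain map of a simplicial map requires.
⟦_⟧ : Vec (Fin n) m → Chain n
⟦ [] ⟧    = unit
⟦ v ∷ t ⟧ = wedge v ⟦ t ⟧

∂⟦⟧ : ∀ (t : Vec (Fin n) (suc m)) τ → ∂ʳ ⟦ t ⟧ τ ≡ d (λ u → ⟦ u ⟧ τ) t
∂⟦⟧ (v ∷ [])    τ = cycle-∂-wedge v {unit} ∂ʳ-unit τ
∂⟦⟧ (v ∷ w ∷ t) τ = trans (∂-wedge v ⟦ w ∷ t ⟧ τ)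
  (cong (λ x → ⟦ w ∷ t ⟧ τ ℚ.- x)
    (trans (wedge-cong v (∂⟦⟧ (w ∷ t)) τ) (additive-d (wedge-additive v τ) ⟦_⟧ (w ∷ t))))

⟦⟧-0 : ∀ (t : Vec (Fin n) m) τ → ¬ (∣ τ ∣ ≡ m × (∀ {w} → w ∈ τ → w Vec.∈ t)) → ⟦ t ⟧ τ ≡ 0ℚ
⟦⟧-0 []      τ h = unit-0 τ λ τ≡0 → h (τ≡0 , λ {w} w∈τ → contradiction
  (ℕ.≤-trans (ℕ.≤-reflexive (sym (∣⁅x⁆∣≡1 w)))
    (ℕ.≤-trans (p⊆q⇒∣p∣≤∣q∣ (λ x∈w → subst (_∈ τ) (sym (x∈⁅y⁆⇒x≡y w x∈w)) w∈τ)) (ℕ.≤-reflexive τ≡0))) λ ())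
⟦⟧-0 (v ∷ t) τ h = wedge-0 v ⟦ t ⟧ τ λ ρ τ≡ size → ⟦⟧-0 t ρ λ { (∣ρ∣ , ρ⊆t) →
  h (trans size (cong suc ∣ρ∣) , λ {w} w∈τ →
    [ (λ w∈ρ → AnyV.there (ρ⊆t w∈ρ)) , (λ w∈v → AnyV.here (x∈⁅y⁆⇒x≡y v w∈v)) ]′
    (x∈p∪q⁻ ρ ⁅ v ⁆ (subst (w ∈_) τ≡ w∈τ))) }

-- The value of ψ on the chain c, each simplex being listed in increasing order.
pair : ∀ n m → (Fin n → A) → Chain n → (Vec A m → ℚ) → ℚ
pair zero    zero    e c ψ = c [] ℚ.* ψ []
pair zero    (suc m) e c ψ = 0ℚ
pair (suc n) zero    e c ψ = pair n zero (e ∘ suc) (c ∘ (outside ∷_)) ψ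
pair (suc n) (suc m) e c ψ = pair n (suc m) (e ∘ suc) (c ∘ (outside ∷_)) ψ ℚ.+
                             pair n m (e ∘ suc) (c ∘ (inside ∷_)) (λ t → ψ (e zero ∷ t))

pair-congˡ : ∀ n m (e : Fin n → A) {c c' : Chain n} → (∀ σ → c σ ≡ c' σ) → ∀ ψ → pair n m e c ψ ≡ pair n m e c' ψ
pair-congˡ zero    zero    e eq ψ = cong (ℚ._* ψ []) (eq [])
pair-congˡ zero    (suc m) e eq ψ = refl
pair-congˡ (suc n) zero    e eq ψ = pair-congˡ n zero (e ∘ suc) (eq ∘ (outside ∷_)) ψ
pair-congˡ (suc n) (suc m) e eq ψ = cong₂ ℚ._+_ (pair-congˡ n (suc m) (e ∘ suc) (eq ∘ (outside ∷_)) ψ)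
  (pair-congˡ n m (e ∘ suc) (eq ∘ (inside ∷_)) (λ t → ψ (e zero ∷ t)))

pair-congʳ : ∀ n m (e : Fin n → A) c {ψ ψ' : Vec A m → ℚ} → (∀ t → ψ t ≡ ψ' t) → pair n m e c ψ ≡ pair n m e c ψ'
pair-congʳ zero    zero    e c eq = cong (c [] ℚ.*_) (eq [])
pair-congʳ zero    (suc m) e c eq = refl
pair-congʳ (suc n) zero    e c eq = pair-congʳ n zero (e ∘ suc) (c ∘ (outside ∷_)) eq
pair-congʳ (suc n) (suc m) e c eq = cong₂ ℚ._+_ (pair-congʳ n (suc m) (e ∘ suc) (c ∘ (outside ∷_)) eq)
  (pair-congʳ n m (e ∘ suc) (c ∘ (inside ∷_)) λ t → eq (e zero ∷ t))

add-sub-swap : ∀ a b c d → (a ℚ.- b) ℚ.+ (c ℚ.- d) ≡ (a ℚ.+ c) ℚ.- (b ℚ.+ d)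
add-sub-swap = solve 4 (λ a b c d → (a :- b) :+ (c :- d) := (a :+ c) :- (b :+ d)) refl

pair-subʳ : ∀ n m (e : Fin n → A) c (ψ ψ' : Vec A m → ℚ) →
            pair n m e c (λ t → ψ t ℚ.- ψ' t) ≡ pair n m e c ψ ℚ.- pair n m e c ψ'
pair-subʳ zero    zero    e c ψ ψ' = solve 3 (λ c x y → c :* (x :- y) := c :* x :- c :* y) refl (c []) (ψ []) (ψ' [])
pair-subʳ zero    (suc m) e c ψ ψ' = refl
pair-subʳ (suc n) zero    e c ψ ψ' = pair-subʳ n zero (e ∘ suc) (c ∘ (outside ∷_)) ψ ψ'
pair-subʳ (suc n) (suc m) e c ψ ψ' = trans
  (cong₂ ℚ._+_ (pair-subʳ n (suc m) (e ∘ suc) c₀ ψ ψ') (pair-subʳ n m (e ∘ suc) c₁ (λ t → ψ (e zero ∷ t)) (λ t → ψ' (e zero ∷ t))))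
  (add-sub-swap (pair n (suc m) (e ∘ suc) c₀ ψ) (pair n (suc m) (e ∘ suc) c₀ ψ')
    (pair n m (e ∘ suc) c₁ (λ t → ψ (e zero ∷ t))) (pair n m (e ∘ suc) c₁ (λ t → ψ' (e zero ∷ t))))
  where
  c₀ = c ∘ (outside ∷_)
  c₁ = c ∘ (inside ∷_)

pair-linearˡ : ∀ n m (e : Fin n → A) a b (c c' : Chain n) ψ →
               pair n m e (λ σ → a ℚ.* c σ ℚ.+ b ℚ.* c' σ) ψ ≡ a ℚ.* pair n m e c ψ ℚ.+ b ℚ.* pair n m e c' ψ
pair-linearˡ zero zero e a b c c' ψ =
  solve 5 (λ a b x y p → (a :* x :+ b :* y) :* p := a :* (x :* p) :+ b :* (y :* p)) refl a b (c []) (c' []) (ψ [])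
pair-linearˡ zero (suc m) e a b c c' ψ = lin-0 a b
pair-linearˡ (suc n) zero e a b c c' ψ = pair-linearˡ n zero (e ∘ suc) a b (c ∘ (outside ∷_)) (c' ∘ (outside ∷_)) ψ
pair-linearˡ (suc n) (suc m) e a b c c' ψ = trans
  (cong₂ ℚ._+_ (pair-linearˡ n (suc m) (e ∘ suc) a b (c ∘ (outside ∷_)) (c' ∘ (outside ∷_)) ψ)
               (pair-linearˡ n m (e ∘ suc) a b (c ∘ (inside ∷_)) (c' ∘ (inside ∷_)) ψ₁))
  (lin-+
    a b (pair n (suc m) (e ∘ suc) (c ∘ (outside ∷_)) ψ) (pair n (suc m) (e ∘ suc) (c' ∘ (outside ∷_)) ψ)
    (pair n m (e ∘ suc) (c ∘ (inside ∷_)) ψ₁) (pair n m (e ∘ suc) (c' ∘ (inside ∷_)) ψ₁))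
  where
  ψ₁ = λ t → ψ (e zero ∷ t)

pair-0 : ∀ n m (e : Fin n → A) (c : Chain n) (ψ : Vec A m → ℚ) →
         (∀ σ t → ∣ σ ∣ ≡ m → (∀ {x} → x Vec.∈ t → ∃[ y ] y ∈ σ × e y ≡ x) → c σ ℚ.* ψ t ≡ 0ℚ) → pair n m e c ψ ≡ 0ℚ
pair-0 zero    zero    e c ψ h = h [] [] refl λ ()
pair-0 zero    (suc m) e c ψ h = refl
pair-0 (suc n) zero    e c ψ h = pair-0 n zero (e ∘ suc) (c ∘ (outside ∷_)) ψ λ { σ [] size _ → h (outside ∷ σ) [] size λ () }
pair-0 (suc n) (suc m) e c ψ h = cong₂ ℚ._+_
  (pair-0 n (suc m) (e ∘ suc) (c ∘ (outside ∷_)) ψ λ σ t size t⊆σ → h (outside ∷ σ) t size (shift t⊆σ))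
  (pair-0 n m (e ∘ suc) (c ∘ (inside ∷_)) (λ t → ψ (e zero ∷ t)) λ σ t size t⊆σ → h (inside ∷ σ) (e zero ∷ t) (cong suc size)
    λ { (AnyV.here refl) → zero , here , refl ; (AnyV.there x∈t) → shift t⊆σ x∈t })
  where
  shift : ∀ {s σ x l} {t : Vec _ l} → (∀ {x} → x Vec.∈ t → ∃[ y ] y ∈ σ × e (suc y) ≡ x) → x Vec.∈ t →
          ∃[ y ] y ∈ (s ∷ σ) × e y ≡ x
  shift t⊆σ x∈t = suc (proj₁ (t⊆σ x∈t)) , there (proj₁ (proj₂ (t⊆σ x∈t))) , proj₂ (proj₂ (t⊆σ x∈t))

-- Stokes' formula: on increasing tuples `d` is the adjoint of `∂ʳ`.
pair-∂ : ∀ n m (e : Fin n → A) (c : Chain n) (ψ : Vec A m → ℚ) → pair n m e (∂ʳ c) ψ ≡ pair n (suc m) e c (d ψ)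
pair-∂ zero    zero    e c ψ = ℚ.*-zeroˡ (ψ [])
pair-∂ zero    (suc m) e c ψ = refl
pair-∂ (suc n) zero    e c ψ = begin
  pair n zero e' (λ σ → c₁ σ ℚ.+ ∂ʳ c₀ σ) ψ
    ≡⟨ pair-congˡ n zero e' (λ σ → +≡lin (c₁ σ) (∂ʳ c₀ σ)) ψ ⟩
  pair n zero e' (λ σ → 1ℚ ℚ.* c₁ σ ℚ.+ 1ℚ ℚ.* ∂ʳ c₀ σ) ψ
    ≡⟨ pair-linearˡ n zero e' 1ℚ 1ℚ c₁ (∂ʳ c₀) ψ ⟩
  1ℚ ℚ.* pair n zero e' c₁ ψ ℚ.+ 1ℚ ℚ.* pair n zero e' (∂ʳ c₀) ψ
    ≡⟨ solve 2 (λ x y → con 1ℚ :* x :+ con 1ℚ :* y := y :+ x) refl (pair n zero e' c₁ ψ) (pair n zero e' (∂ʳ c₀) ψ) ⟩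
  pair n zero e' (∂ʳ c₀) ψ ℚ.+ pair n zero e' c₁ ψ
    ≡⟨ cong₂ ℚ._+_ (pair-∂ n zero e' c₀ ψ) (pair-congʳ n zero e' c₁ λ { [] → refl }) ⟩
  pair (suc n) 1 e c (d ψ) ∎
  where
  open ≡-Reasoning
  e' = e ∘ suc
  c₀ = c ∘ (outside ∷_)
  c₁ = c ∘ (inside ∷_)
pair-∂ (suc n) (suc m) e c ψ = begin
  pair n (suc m) e' (λ σ → c₁ σ ℚ.+ ∂ʳ c₀ σ) ψ ℚ.+ pair n m e' (λ σ → ℚ.- ∂ʳ c₁ σ) ψ₁
    ≡⟨ cong₂ ℚ._+_ (trans (pair-congˡ n (suc m) e' (λ σ → +≡lin (c₁ σ) (∂ʳ c₀ σ)) ψ)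
                          (pair-linearˡ n (suc m) e' 1ℚ 1ℚ c₁ (∂ʳ c₀) ψ))
                   (trans (pair-congˡ n m e' (λ σ → neg≡lin (∂ʳ c₁ σ)) ψ₁)
                          (pair-linearˡ n m e' (ℚ.- 1ℚ) 0ℚ (∂ʳ c₁) (∂ʳ c₁) ψ₁)) ⟩
  (1ℚ ℚ.* x ℚ.+ 1ℚ ℚ.* pair n (suc m) e' (∂ʳ c₀) ψ) ℚ.+
  (ℚ.- 1ℚ ℚ.* pair n m e' (∂ʳ c₁) ψ₁ ℚ.+ 0ℚ ℚ.* pair n m e' (∂ʳ c₁) ψ₁)
    ≡⟨ cong₂ (λ y w → (1ℚ ℚ.* x ℚ.+ 1ℚ ℚ.* y) ℚ.+ (ℚ.- 1ℚ ℚ.* w ℚ.+ 0ℚ ℚ.* w))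
             (pair-∂ n (suc m) e' c₀ ψ) (pair-∂ n m e' c₁ ψ₁) ⟩
  (1ℚ ℚ.* x ℚ.+ 1ℚ ℚ.* y) ℚ.+ (ℚ.- 1ℚ ℚ.* w ℚ.+ 0ℚ ℚ.* w)
    ≡⟨ solve 3 (λ x y w → (con 1ℚ :* x :+ con 1ℚ :* y) :+ (con (ℚ.- 1ℚ) :* w :+ con 0ℚ :* w) := y :+ (x :- w)) refl x y w ⟩
  y ℚ.+ (x ℚ.- w)
    ≡⟨ cong (y ℚ.+_) (sym (pair-subʳ n (suc m) e' c₁ ψ (d ψ₁))) ⟩
  pair (suc n) (suc (suc m)) e c (d ψ) ∎
  where
  open ≡-Reasoning
  e' = e ∘ suc
  c₀ = c ∘ (outside ∷_)
  c₁ = c ∘ (inside ∷_)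
  ψ₁ = λ t → ψ (e zero ∷ t)
  x = pair n (suc m) e' c₁ ψ
  y = pair n (suc (suc m)) e' c₀ (d ψ)
  w = pair n (suc m) e' c₁ (d ψ₁)

pair-map : ∀ n m (f : A → B) (e : Fin n → A) c (ψ : Vec B m → ℚ) →
           pair n m (f ∘ e) c ψ ≡ pair n m e c (ψ ∘ Vec.map f)
pair-map zero    zero    f e c ψ = refl
pair-map zero    (suc m) f e c ψ = refl
pair-map (suc n) zero    f e c ψ = pair-map n zero f (e ∘ suc) (c ∘ (outside ∷_)) ψ
pair-map (suc n) (suc m) f e c ψ = cong₂ ℚ._+_ (pair-map n (suc m) f (e ∘ suc) (c ∘ (outside ∷_)) ψ)
  (pair-map n m f (e ∘ suc) (c ∘ (inside ∷_)) (λ t → ψ (f (e zero) ∷ t)))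

pair-0ʳ : ∀ n m (e : Fin n → A) c {ψ : Vec A m → ℚ} → (∀ t → ψ t ≡ 0ℚ) → pair n m e c ψ ≡ 0ℚ
pair-0ʳ n m e c {ψ} h = pair-0 n m e c ψ λ σ t _ _ → trans (cong (c σ ℚ.*_) (h t)) (ℚ.*-zeroʳ (c σ))

⟦map-suc⟧-outside : ∀ (t : Vec (Fin n) m) τ → ⟦ Vec.map suc t ⟧ (outside ∷ τ) ≡ ⟦ t ⟧ τ
⟦map-suc⟧-outside []      τ = refl
⟦map-suc⟧-outside (v ∷ t) τ = wedge-cong v (⟦map-suc⟧-outside t) τ

⟦map-suc⟧-inside : ∀ (t : Vec (Fin n) m) τ → ⟦ Vec.map suc t ⟧ (inside ∷ τ) ≡ 0ℚ
⟦map-suc⟧-inside []      τ = refl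
⟦map-suc⟧-inside (v ∷ t) τ = cong ℚ.-_ (wedge-0 v _ τ λ ρ _ _ → ⟦map-suc⟧-inside t ρ)

pair-⟦⟧ : ∀ n m (c : Chain n) → (∀ σ → ∣ σ ∣ ≢ m → c σ ≡ 0ℚ) → ∀ τ → pair n m id c (λ t → ⟦ t ⟧ τ) ≡ c τ
pair-⟦⟧ zero    zero    c size []            = ℚ.*-identityʳ (c [])
pair-⟦⟧ zero    (suc m) c size []            = sym (size [] λ ())
pair-⟦⟧ (suc n) zero    c size (outside ∷ τ) = trans
  (pair-map n zero suc id (c ∘ (outside ∷_)) (λ t → ⟦ t ⟧ (outside ∷ τ)))
  (trans (pair-congʳ n zero id (c ∘ (outside ∷_)) (λ t → ⟦map-suc⟧-outside t τ))
         (pair-⟦⟧ n zero (c ∘ (outside ∷_)) (size ∘ (outside ∷_)) τ))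
pair-⟦⟧ (suc n) zero    c size (inside ∷ τ)  = trans
  (pair-0ʳ n zero suc (c ∘ (outside ∷_)) λ { [] → refl }) (sym (size (inside ∷ τ) λ ()))
pair-⟦⟧ (suc n) (suc m) c size (outside ∷ τ) = trans
  (cong₂ ℚ._+_
    (trans (pair-map n (suc m) suc id (c ∘ (outside ∷_)) (λ t → ⟦ t ⟧ (outside ∷ τ)))
      (trans (pair-congʳ n (suc m) id (c ∘ (outside ∷_)) (λ t → ⟦map-suc⟧-outside t τ))
             (pair-⟦⟧ n (suc m) (c ∘ (outside ∷_)) (size ∘ (outside ∷_)) τ)))
    (pair-0ʳ n m suc (c ∘ (inside ∷_)) λ t → refl))
  (ℚ.+-identityʳ (c (outside ∷ τ)))
pair-⟦⟧ (suc n) (suc m) c size (inside ∷ τ)  = trans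
  (cong₂ ℚ._+_
    (trans (pair-map n (suc m) suc id (c ∘ (outside ∷_)) (λ t → ⟦ t ⟧ (inside ∷ τ)))
           (pair-0ʳ n (suc m) id (c ∘ (outside ∷_)) λ t → ⟦map-suc⟧-inside t τ))
    (trans (pair-map n m suc id (c ∘ (inside ∷_)) (λ t → ⟦ t ⟧ (outside ∷ τ)))
      (trans (pair-congʳ n m id (c ∘ (inside ∷_)) (λ t → ⟦map-suc⟧-outside t τ))
             (pair-⟦⟧ n m (c ∘ (inside ∷_)) (λ σ ≢m → size (inside ∷ σ) (≢m ∘ ℕ.suc-injective)) τ))))
  (ℚ.+-identityˡ (c (inside ∷ τ)))

∂ʳ-pair : ∀ k m (e : Fin k → A) (c : Chain k) (φ : Vec A m → Chain n) τ →
          ∂ʳ (λ σ → pair k m e c (λ t → φ t σ)) τ ≡ pair k m e c (λ t → ∂ʳ (φ t) τ)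
∂ʳ-pair zero zero e c φ τ = trans (∂ʳ-cong (λ σ → c*≡ (φ [] σ)) τ)
  (trans (∂ʳ-linear (c []) 0ℚ (φ []) (φ []) τ) (sym (c*≡ (∂ʳ (φ []) τ))))
  where
  c*≡ : ∀ x → c [] ℚ.* x ≡ c [] ℚ.* x ℚ.+ 0ℚ ℚ.* x
  c*≡ x = solve 2 (λ c x → c :* x := c :* x :+ con 0ℚ :* x) refl (c []) x
∂ʳ-pair zero    (suc m) e c φ τ = ∂ʳ-0 (λ _ → refl) τ
∂ʳ-pair (suc k) zero    e c φ τ = ∂ʳ-pair k zero (e ∘ suc) (c ∘ (outside ∷_)) φ τ
∂ʳ-pair (suc k) (suc m) e c φ τ = trans
  (∂ʳ-cong (λ σ → +≡lin (x σ) (y σ)) τ)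
  (trans (∂ʳ-linear 1ℚ 1ℚ x y τ)
    (trans (sym (+≡lin (∂ʳ x τ) (∂ʳ y τ)))
      (cong₂ ℚ._+_ (∂ʳ-pair k (suc m) (e ∘ suc) (c ∘ (outside ∷_)) φ τ)
                   (∂ʳ-pair k m (e ∘ suc) (c ∘ (inside ∷_)) (λ t → φ (e zero ∷ t)) τ))))
  where
  x = λ σ → pair k (suc m) (e ∘ suc) (c ∘ (outside ∷_)) (λ t → φ t σ)
  y = λ σ → pair k m (e ∘ suc) (c ∘ (inside ∷_)) (λ t → φ (e zero ∷ t) σ)

-- Rational arithmetic

-- Most estimates below name the difference as an evidently nonnegative `r` and leave the identity
-- to the ring solver.
≤-by : ∀ {p q} r → q ≡ p ℚ.+ r → 0ℚ ℚ.≤ r → p ℚ.≤ q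
≤-by {p} {q} r eq 0≤r = subst (p ℚ.≤_) (sym eq)
  (subst (ℚ._≤ p ℚ.+ r) (ℚ.+-identityʳ p) (ℚ.+-monoʳ-≤ p 0≤r))

p≤q⇒0≤q-p : ∀ {p q} → p ℚ.≤ q → 0ℚ ℚ.≤ q ℚ.- p
p≤q⇒0≤q-p {p} {q} p≤q = subst (ℚ._≤ q ℚ.- p) (ℚ.+-inverseʳ p) (ℚ.+-monoˡ-≤ (ℚ.- p) p≤q)

0≤+ : ∀ {p q} → 0ℚ ℚ.≤ p → 0ℚ ℚ.≤ q → 0ℚ ℚ.≤ p ℚ.+ q
0≤+ = ℚ.+-mono-≤ {0ℚ} {_} {0ℚ} {_}

0≤* : ∀ {p q} → 0ℚ ℚ.≤ p → 0ℚ ℚ.≤ q → 0ℚ ℚ.≤ p ℚ.* q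
0≤* {p} {q} 0≤p 0≤q = subst (ℚ._≤ p ℚ.* q) (ℚ.*-zeroʳ p)
  (ℚ.*-monoˡ-≤-nonNeg p {{ℚ.nonNegative 0≤p}} 0≤q)

0<* : ∀ {p q} → 0ℚ ℚ.< p → 0ℚ ℚ.< q → 0ℚ ℚ.< p ℚ.* q
0<* {p} {q} 0<p 0<q = subst (ℚ._< p ℚ.* q) (ℚ.*-zeroʳ p)
  (ℚ.*-monoʳ-<-pos p {{ℚ.positive 0<p}} 0<q)

0<½ : 0ℚ ℚ.< ½
0<½ = ℚ.positive⁻¹ ½

0≤½ : 0ℚ ℚ.≤ ½
0≤½ = ℚ.<⇒≤ 0<½

0≤1 : 0ℚ ℚ.≤ 1ℚ
0≤1 = ℚ.nonNegative⁻¹ 1ℚ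

2⁻ : ℕ → ℚ
2⁻ zero    = 1ℚ
2⁻ (suc m) = ½ ℚ.* 2⁻ m

0<2⁻ : ∀ m → 0ℚ ℚ.< 2⁻ m
0<2⁻ zero    = ℚ.positive⁻¹ 1ℚ
0<2⁻ (suc m) = 0<* 0<½ (0<2⁻ m)

0≤2⁻ : ∀ m → 0ℚ ℚ.≤ 2⁻ m
0≤2⁻ m = ℚ.<⇒≤ (0<2⁻ m)

2⁻≤1 : ∀ m → 2⁻ m ℚ.≤ 1ℚ
2⁻≤1 zero    = ℚ.≤-refl
2⁻≤1 (suc m) = ≤-by (½ ℚ.* (1ℚ ℚ.- 2⁻ m) ℚ.+ ½)
  (solve 1 (λ x → con 1ℚ := con ½ :* x :+ (con ½ :* (con 1ℚ :- x) :+ con ½)) refl (2⁻ m))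
  (0≤+ (0≤* 0≤½ (p≤q⇒0≤q-p (2⁻≤1 m))) 0≤½)

fromℕ : ℕ → ℚ
fromℕ zero    = 0ℚ
fromℕ (suc m) = 1ℚ ℚ.+ fromℕ m

0≤fromℕ : ∀ m → 0ℚ ℚ.≤ fromℕ m
0≤fromℕ zero    = ℚ.≤-refl
0≤fromℕ (suc m) = 0≤+ 0≤1 (0≤fromℕ m)

-- This lets `2⁻ m` stand in for 1/m in the estimates below.
fromℕ*2⁻≤1 : ∀ m → fromℕ m ℚ.* 2⁻ m ℚ.≤ 1ℚ
fromℕ*2⁻≤1 zero    = ℚ.nonNegative⁻¹ 1ℚ
fromℕ*2⁻≤1 (suc m) = ≤-by (½ ℚ.* (1ℚ ℚ.- 2⁻ m) ℚ.+ ½ ℚ.* (1ℚ ℚ.- fromℕ m ℚ.* 2⁻ m))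
  (solve 2 (λ f x → con 1ℚ := (con 1ℚ :+ f) :* (con ½ :* x) :+ (con ½ :* (con 1ℚ :- x) :+ con ½ :* (con 1ℚ :- f :* x)))
    refl (fromℕ m) (2⁻ m))
  (0≤+ (0≤* 0≤½ (p≤q⇒0≤q-p (2⁻≤1 m))) (0≤* 0≤½ (p≤q⇒0≤q-p (fromℕ*2⁻≤1 m))))

toℚᵘ-fromℕ : ∀ m → ℚ.toℚᵘ (fromℕ m) ℚᵘ.≃ ℚᵘ.mkℚᵘ (ℤ.+ m) 0
toℚᵘ-fromℕ zero    = ℚᵘ.≃-refl
toℚᵘ-fromℕ (suc m) = ℚᵘ.≃-trans (ℚ.toℚᵘ-homo-+ 1ℚ (fromℕ m))
  (ℚᵘ.≃-trans (ℚᵘ.+-congʳ ℚᵘ.1ℚᵘ (toℚᵘ-fromℕ m))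
    (ℚᵘ.*≡* (cong (ℤ._* ℤ.+ 1) (cong (ℤ._+_ (ℤ.+ 1)) (ℤ.*-identityʳ (ℤ.+ m))))))

archimedean : ∀ x → 0ℚ ℚ.< x → ∃[ m ] 1ℚ ℚ.≤ fromℕ m ℚ.* x
-- For a positive fraction the denominator is a large enough multiple.
archimedean x@(ℚ.mkℚ (ℤ.+ suc a) b-1 _) 0<x = suc b-1 , ℚ.toℚᵘ-cancel-≤ (ℚᵘ.≤-trans (ℚᵘ.*≤* {p = ℚᵘ.1ℚᵘ} {q = ℚᵘ.mkℚᵘ (ℤ.+ suc b-1) 0 ℚᵘ.* ℚ.toℚᵘ x} bound)
  (ℚᵘ.≤-reflexive (ℚᵘ.≃-sym (ℚᵘ.≃-trans (ℚ.toℚᵘ-homo-* (fromℕ (suc b-1)) x)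
                                          (ℚᵘ.*-congʳ (toℚᵘ-fromℕ (suc b-1)))))))
  where
  bound : ℤ.1ℤ ℤ.* ℚᵘ.↧ (ℚᵘ.mkℚᵘ (ℤ.+ suc b-1) 0 ℚᵘ.* ℚ.toℚᵘ x) ℤ.≤ ℚᵘ.↥ (ℚᵘ.mkℚᵘ (ℤ.+ suc b-1) 0 ℚᵘ.* ℚ.toℚᵘ x) ℤ.* ℤ.1ℤ
  bound = ℤ.≤-trans (ℤ.≤-reflexive (ℤ.*-identityˡ _))
    (ℤ.≤-trans (ℤ.+≤+ (ℕ.s≤s (ℕ.≤-trans (ℕ.≤-reflexive (ℕ.+-identityʳ b-1))
                       (ℕ.≤-trans (ℕ.m≤m*n b-1 (suc a)) (ℕ.m≤n+m (b-1 ℕ.* suc a) a)))))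
      (ℤ.≤-reflexive (sym (ℤ.*-identityʳ _))))
archimedean (ℚ.mkℚ (ℤ.+ zero) b-1 _) 0<x = contradiction (ℚ.drop-*<* 0<x) (ℤ.<-irrefl refl)
archimedean (ℚ.mkℚ (ℤ.-[1+ a ]) b-1 _) 0<x = contradiction (ℚ.drop-*<* 0<x) λ ()

-- Subdivision and Sperner labellings

Point : ℕ → Set
Point k = Fin k → ℚ

mid : ∀ {k} → Point k → Point k → Point k
mid p q v = ½ ℚ.* (p v ℚ.+ q v)

Convex : ∀ {k} → (Point k → Set) → Set
Convex Q = ∀ {p q} → Q p → Q q → Q (mid p q)

Near : ∀ {k} → ℚ → Point k → Point k → Set
Near D p q = ∀ v → p v ℚ.≤ q v ℚ.+ D

Spread : ∀ {k} → ℚ → Vec (Point k) m → Set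
Spread D t = ∀ {p q} → p Vec.∈ t → q Vec.∈ t → Near D p q

-- An interior point of the simplex t. It is not the barycentre: any point
-- strictly inside will do for the subdivision, and this one needs only halving.
centre : ∀ {k} → Vec (Point k) (suc m) → Point k
centre (p ∷ [])    = p
centre (p ∷ q ∷ t) = mid p (centre (q ∷ t))

centre-convex : ∀ {k} {Q : Point k → Set} → Convex Q → (t : Vec (Point k) (suc m)) →
                (∀ {p} → p Vec.∈ t → Q p) → Q (centre t)
centre-convex cvx (p ∷ [])    h = h (AnyV.here refl)
centre-convex cvx (p ∷ q ∷ t) h = cvx (h (AnyV.here refl)) (centre-convex cvx (q ∷ t) (h ∘ AnyV.there))

-- The transpose of the recursion sd t = centre t * sd (∂ t).
sd : ∀ {k} m → (Vec (Point k) m → ℚ) → Vec (Point k) m → ℚ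
sd zero    φ t = φ t
sd (suc m) φ t = d (sd m (λ u → φ (centre t ∷ u))) t

module _ {k : ℕ} where

  sd-cong : ∀ m {φ ψ : Vec (Point k) m → ℚ} → (∀ t → φ t ≡ ψ t) → ∀ t → sd m φ t ≡ sd m ψ t
  sd-cong zero    φ≗ψ t = φ≗ψ t
  sd-cong (suc m) φ≗ψ t = d-cong (sd-cong m (λ u → φ≗ψ (centre t ∷ u))) t

  sd-sub : ∀ m (φ ψ : Vec (Point k) m → ℚ) t → sd m (λ u → φ u ℚ.- ψ u) t ≡ sd m φ t ℚ.- sd m ψ t
  sd-sub zero    φ ψ t = refl
  sd-sub (suc m) φ ψ t = trans (d-cong (sd-sub m (λ u → φ (centre t ∷ u)) (λ u → ψ (centre t ∷ u))) t)
    (d-sub (sd m (λ u → φ (centre t ∷ u))) (sd m (λ u → ψ (centre t ∷ u))) t)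

  -- Subdivision is a chain map: the boundary of the cone from the centre is its base minus the cone
  -- over sd (∂ ∂ t), which is 0.
  sd-d : ∀ m (φ : Vec (Point k) m → ℚ) t → sd (suc m) (d φ) t ≡ d (sd m φ) t
  sd-d zero    φ (p ∷ []) = refl
  sd-d (suc m) φ t = begin
    d (sd (suc m) (λ u → φ u ℚ.- d ψ u)) t
      ≡⟨ d-cong (sd-sub (suc m) φ (d ψ)) t ⟩
    d (λ u → sd (suc m) φ u ℚ.- sd (suc m) (d ψ) u) t
      ≡⟨ d-sub (sd (suc m) φ) (sd (suc m) (d ψ)) t ⟩
    d (sd (suc m) φ) t ℚ.- d (sd (suc m) (d ψ)) t
      ≡⟨ cong (λ x → d (sd (suc m) φ) t ℚ.- x) (trans (d-cong (sd-d m ψ) t) (dd≡0 (sd m ψ) t)) ⟩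
    d (sd (suc m) φ) t ℚ.- 0ℚ
      ≡⟨ ℚ.+-identityʳ _ ⟩
    d (sd (suc m) φ) t ∎
    where
    open ≡-Reasoning
    ψ : Vec (Point k) m → ℚ
    ψ u = φ (centre t ∷ u)

  additive-sd : {T : Chain n → ℚ} → Additive T → ∀ m (φ : Vec (Point k) m → Chain n) t →
                T (λ τ → sd m (λ u → φ u τ) t) ≡ sd m (λ u → T (φ u)) t
  additive-sd add zero    φ t = refl
  additive-sd add (suc m) φ t = trans
    (additive-d add (λ u τ → sd m (λ w → φ (centre t ∷ w) τ) u) t)
    (d-cong (additive-sd add m (λ w → φ (centre t ∷ w))) t)

sdⁿ : ∀ {k} → ℕ → ∀ m → (Vec (Point k) m → ℚ) → Vec (Point k) m → ℚ
sdⁿ zero    m φ = φ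
sdⁿ (suc N) m φ = sd m (sdⁿ N m φ)

module _ {k : ℕ} where

  sdⁿ-cong : ∀ N m {φ ψ : Vec (Point k) m → ℚ} → (∀ t → φ t ≡ ψ t) → ∀ t → sdⁿ N m φ t ≡ sdⁿ N m ψ t
  sdⁿ-cong zero    m φ≗ψ = φ≗ψ
  sdⁿ-cong (suc N) m φ≗ψ = sd-cong m (sdⁿ-cong N m φ≗ψ)

  sdⁿ-d : ∀ N m (φ : Vec (Point k) m → ℚ) t → sdⁿ N (suc m) (d φ) t ≡ d (sdⁿ N m φ) t
  sdⁿ-d zero    m φ t = refl
  sdⁿ-d (suc N) m φ t = trans (sd-cong (suc m) (sdⁿ-d N m φ) t) (sd-d m (sdⁿ N m φ) t)

  additive-sdⁿ : {T : Chain n → ℚ} → Additive T → ∀ N m (φ : Vec (Point k) m → Chain n) t →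
                 T (λ τ → sdⁿ N m (λ u → φ u τ) t) ≡ sdⁿ N m (λ u → T (φ u)) t
  additive-sdⁿ add zero    m φ t = refl
  additive-sdⁿ add (suc N) m φ t = trans
    (additive-sd add m (λ u τ → sdⁿ N m (λ w → φ w τ) u) t)
    (sd-cong m (additive-sdⁿ add N m φ) t)

-- The least weight of a vertex in the `centre` of m + 1 points is `2⁻ m`, so the centre is within
-- (1 - `2⁻ m`) D of every vertex.
mesh : ℕ → ℚ → ℚ
mesh m D = D ℚ.- 2⁻ m ℚ.* D

mesh-suc : ∀ m D → mesh (suc m) D ≡ ½ ℚ.* (D ℚ.+ mesh m D)
mesh-suc m D = solve 2 (λ h D → D :- (con ½ :* h) :* D := con ½ :* (D :+ (D :- h :* D))) refl (2⁻ m) D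

0≤mesh : ∀ m {D} → 0ℚ ℚ.≤ D → 0ℚ ℚ.≤ mesh m D
0≤mesh m {D} 0≤D = subst (0ℚ ℚ.≤_) (solve 2 (λ h D → (con 1ℚ :- h) :* D := D :- h :* D) refl (2⁻ m) D)
  (0≤* (p≤q⇒0≤q-p (2⁻≤1 m)) 0≤D)

mesh≤ : ∀ m {D} → 0ℚ ℚ.≤ D → mesh m D ℚ.≤ D
mesh≤ m {D} 0≤D = ≤-by (2⁻ m ℚ.* D) (solve 2 (λ D x → D := (D :- x) :+ x) refl D (2⁻ m ℚ.* D)) (0≤* (0≤2⁻ m) 0≤D)

mesh-mono : ∀ {l m} → l ≤ m → ∀ {D} → 0ℚ ℚ.≤ D → mesh l D ℚ.≤ mesh m D
mesh-mono l≤m {D} 0≤D = go (ℕ.≤⇒≤′ l≤m)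
  where
  go : ∀ {l m} → l ℕ.≤′ m → mesh l D ℚ.≤ mesh m D
  go ℕ.≤′-refl = ℚ.≤-refl
  go {l} {suc m} (ℕ.≤′-step l≤m) = ℚ.≤-trans (go l≤m)
    (≤-by (½ ℚ.* (2⁻ m ℚ.* D)) (solve 2 (λ D h → D :- (con ½ :* h) :* D := (D :- h :* D) :+ con ½ :* (h :* D)) refl D (2⁻ m))
      (0≤* 0≤½ (0≤* (0≤2⁻ m) 0≤D)))

mid-near : ∀ {k} (p q r : Point k) {a b c} → ½ ℚ.* (a ℚ.+ b) ≡ c → Near a p r → Near b q r → Near c (mid p q) r
mid-near p q r {a} {b} refl p≤ q≤ v = ≤-by (½ ℚ.* ((r v ℚ.+ a ℚ.- p v) ℚ.+ (r v ℚ.+ b ℚ.- q v)))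
  (solve 5 (λ p q x a b → x :+ con ½ :* (a :+ b) := con ½ :* (p :+ q) :+ con ½ :* ((x :+ a :- p) :+ (x :+ b :- q)))
    refl (p v) (q v) (r v) a b)
  (0≤* 0≤½ (0≤+ (p≤q⇒0≤q-p (p≤ v)) (p≤q⇒0≤q-p (q≤ v))))

near-mid : ∀ {k} (p q r : Point k) {a b c} → ½ ℚ.* (a ℚ.+ b) ≡ c → Near a r p → Near b r q → Near c r (mid p q)
near-mid p q r {a} {b} refl p≤ q≤ v = ≤-by (½ ℚ.* ((p v ℚ.+ a ℚ.- r v) ℚ.+ (q v ℚ.+ b ℚ.- r v)))
  (solve 5 (λ p q x a b → con ½ :* (p :+ q) :+ con ½ :* (a :+ b) := x :+ con ½ :* ((p :+ a :- x) :+ (q :+ b :- x)))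
    refl (p v) (q v) (r v) a b)
  (0≤* 0≤½ (0≤+ (p≤q⇒0≤q-p (p≤ v)) (p≤q⇒0≤q-p (q≤ v))))

meshⁿ : ℕ → ℕ → ℚ → ℚ
meshⁿ M zero    D = D
meshⁿ M (suc N) D = meshⁿ M N (mesh M D)

p≤p+q : ∀ p {q} → 0ℚ ℚ.≤ q → p ℚ.≤ p ℚ.+ q
p≤p+q p {q} = ≤-by q refl

module _ {k : ℕ} where

  NearBoth : ℚ → Point k → Point k → Set
  NearBoth D p q = Near D p q × Near D q p

  NearBoth-convex : ∀ D q → Convex (NearBoth D q)
  NearBoth-convex D q {p} {p'} (h₁ , h₁') (h₂ , h₂') = near-mid p p' q half h₁ h₂ , mid-near p p' q half h₁' h₂'
    where
    half : ½ ℚ.* (D ℚ.+ D) ≡ D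
    half = solve 1 (λ D → con ½ :* (D :+ D) := D) refl D

  NearBoth-mono : ∀ {D D' p q} → D ℚ.≤ D' → NearBoth D p q → NearBoth D' p q
  NearBoth-mono {p = p} {q} D≤D' (h , h') =
    (λ v → ℚ.≤-trans (h v) (ℚ.+-monoʳ-≤ (q v) D≤D')) , (λ v → ℚ.≤-trans (h' v) (ℚ.+-monoʳ-≤ (p v) D≤D'))

  centre-near : (t : Vec (Point k) (suc m)) → ∀ {D} → 0ℚ ℚ.≤ D → Spread D t → ∀ {p} → p Vec.∈ t →
                NearBoth (mesh m D) (centre t) p
  centre-near {m = zero}  (p ∷ []) {D} 0≤D spread (AnyV.here refl) =
    (λ v → p≤p+q (p v) (0≤mesh 0 0≤D)) , (λ v → p≤p+q (p v) (0≤mesh 0 0≤D))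
  centre-near {m = suc m} (p ∷ q ∷ t) {D} 0≤D spread (AnyV.here refl) =
    mid-near p c p eq self (proj₂ hull) , near-mid p c p eq self (proj₁ hull)
    where
    c = centre (q ∷ t)

    hull : NearBoth D p c
    hull = centre-convex (NearBoth-convex D p) (q ∷ t)
      λ r∈ → spread (AnyV.here refl) (AnyV.there r∈) , spread (AnyV.there r∈) (AnyV.here refl)

    self : Near (mesh m D) p p
    self v = p≤p+q (p v) (0≤mesh m 0≤D)

    eq : ½ ℚ.* (mesh m D ℚ.+ D) ≡ mesh (suc m) D
    eq = trans (cong (½ ℚ.*_) (ℚ.+-comm (mesh m D) D)) (sym (mesh-suc m D))
  centre-near {m = suc m} (p ∷ q ∷ t) {D} 0≤D spread {r} (AnyV.there r∈) =
    mid-near p c r eq (spread (AnyV.here refl) (AnyV.there r∈)) (proj₁ ih) ,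
    near-mid p c r eq (spread (AnyV.there r∈) (AnyV.here refl)) (proj₂ ih)
    where
    c = centre (q ∷ t)
    ih = centre-near (q ∷ t) 0≤D (λ a b → spread (AnyV.there a) (AnyV.there b)) r∈

    eq : ½ ℚ.* (D ℚ.+ mesh m D) ≡ mesh (suc m) D
    eq = sym (mesh-suc m D)

  -- The induction strengthens the convex condition `Q` by closeness to the centre just chosen, so
  -- that a small simplex together with that centre still has the required spread.
  sd-0 : ∀ {M} m → m ≤ suc M → ∀ {D} → 0ℚ ℚ.≤ D → {Q : Point k → Set} → Convex Q → (φ : Vec (Point k) m → ℚ) →
         (∀ u → (∀ {p} → p Vec.∈ u → Q p) → Spread (mesh M D) u → φ u ≡ 0ℚ) →
         ∀ t → (∀ {p} → p Vec.∈ t → Q p) → Spread D t → sd m φ t ≡ 0ℚ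
  sd-0 zero m≤ 0≤D cvx φ h [] t∈Q _ = h [] t∈Q λ ()
  sd-0 {M} (suc m) m≤ {D} 0≤D {Q} cvx φ h t t∈Q spread = d-0 {φ = sd m (λ w → φ (centre t ∷ w))} t λ u u⊆t →
    sd-0 {M} m (ℕ.≤-trans (ℕ.n≤1+n m) m≤) 0≤D {λ p → Q p × NearBoth (mesh M D) (centre t) p}
      (λ (q₁ , n₁) (q₂ , n₂) → cvx q₁ q₂ , NearBoth-convex (mesh M D) (centre t) n₁ n₂)
      (λ w → φ (centre t ∷ w))
      (λ w w∈ w-spread → h (centre t ∷ w)
        (λ { (AnyV.here refl) → centre-convex cvx t t∈Q ; (AnyV.there p∈) → proj₁ (w∈ p∈) })
        (λ { (AnyV.here refl) (AnyV.here refl) v → p≤p+q (centre t v) (0≤mesh M 0≤D)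
           ; (AnyV.here refl) (AnyV.there q∈) → proj₁ (proj₂ (w∈ q∈))
           ; (AnyV.there p∈) (AnyV.here refl) → proj₂ (proj₂ (w∈ p∈))
           ; (AnyV.there p∈) (AnyV.there q∈) → w-spread p∈ q∈ }))
      u
      (λ p∈u → t∈Q (u⊆t p∈u) ,
               NearBoth-mono (mesh-mono (ℕ.≤-pred m≤) 0≤D) (centre-near t 0≤D spread (u⊆t p∈u)))
      (λ p∈ q∈ → spread (u⊆t p∈) (u⊆t q∈))

  sdⁿ-0 : ∀ N {M} m → m ≤ suc M → ∀ {D} → 0ℚ ℚ.≤ D → {Q : Point k → Set} → Convex Q → (φ : Vec (Point k) m → ℚ) →
          (∀ u → (∀ {p} → p Vec.∈ u → Q p) → Spread (meshⁿ M N D) u → φ u ≡ 0ℚ) →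
          ∀ t → (∀ {p} → p Vec.∈ t → Q p) → Spread D t → sdⁿ N m φ t ≡ 0ℚ
  sdⁿ-0 zero        m m≤ 0≤D cvx φ h t = h t
  sdⁿ-0 (suc N) {M} m m≤ 0≤D cvx φ h = sd-0 m m≤ 0≤D cvx (sdⁿ N m φ) (sdⁿ-0 N m m≤ (0≤mesh M 0≤D) cvx φ h)

0≤meshⁿ : ∀ M N {D} → 0ℚ ℚ.≤ D → 0ℚ ℚ.≤ meshⁿ M N D
0≤meshⁿ M zero    0≤D = 0≤D
0≤meshⁿ M (suc N) 0≤D = 0≤meshⁿ M N (0≤mesh M 0≤D)

meshⁿ≤ : ∀ M N {D} → 0ℚ ℚ.≤ D → meshⁿ M N D ℚ.≤ D
meshⁿ≤ M zero    0≤D = ℚ.≤-refl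
meshⁿ≤ M (suc N) 0≤D = ℚ.≤-trans (meshⁿ≤ M N (0≤mesh M 0≤D)) (mesh≤ M 0≤D)

-- Bernoulli's inequality for (1 - h)^N.
meshⁿ-decay : ∀ M N {D} → 0ℚ ℚ.≤ D → meshⁿ M N D ℚ.* (1ℚ ℚ.+ fromℕ N ℚ.* 2⁻ M) ℚ.≤ D
meshⁿ-decay M zero {D} 0≤D = ℚ.≤-reflexive
  (solve 2 (λ D h → D :* (con 1ℚ :+ con 0ℚ :* h) := D) refl D (2⁻ M))
meshⁿ-decay M (suc N) {D} 0≤D = ≤-by
  ((mesh M D ℚ.- r ℚ.* (1ℚ ℚ.+ f ℚ.* h)) ℚ.+ h ℚ.* (D ℚ.- r))
  (solve 4 (λ D h f r → D := r :* (con 1ℚ :+ (con 1ℚ :+ f) :* h) :+ ((D :- h :* D :- r :* (con 1ℚ :+ f :* h)) :+ h :* (D :- r)))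
    refl D h f r)
  (0≤+ (p≤q⇒0≤q-p (meshⁿ-decay M N (0≤mesh M 0≤D)))
       (0≤* (0≤2⁻ M) (p≤q⇒0≤q-p (meshⁿ≤ M (suc N) 0≤D))))
  where
  h = 2⁻ M
  f = fromℕ N
  r = meshⁿ M N (mesh M D)

meshⁿ-small : ∀ M δ → 0ℚ ℚ.< δ → ∃[ N ] meshⁿ M N 1ℚ ℚ.≤ δ
-- With N `2⁻ M` δ at least 1, a mesh above δ would violate the Bernoulli bound.
meshⁿ-small M δ 0<δ with archimedean (2⁻ M ℚ.* δ) (0<* (0<2⁻ M) 0<δ)
... | N , 1≤ = N , ℚ.≮⇒≥ λ δ<r → ℚ.<-irrefl (refl {x = 1ℚ}) (ℚ.<-≤-trans (strict δ<r) (meshⁿ-decay M N 0≤1))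
  where
  r = meshⁿ M N 1ℚ

  strict : δ ℚ.< r → 1ℚ ℚ.< r ℚ.* (1ℚ ℚ.+ fromℕ N ℚ.* 2⁻ M)
  strict δ<r = begin-strict
    1ℚ                                          ≡⟨ sym (ℚ.+-identityˡ 1ℚ) ⟩
    0ℚ ℚ.+ 1ℚ                                   <⟨ ℚ.+-monoˡ-< 1ℚ (ℚ.<-trans 0<δ δ<r) ⟩
    r ℚ.+ 1ℚ                                    ≤⟨ ℚ.+-monoʳ-≤ r 1≤ ⟩
    r ℚ.+ fromℕ N ℚ.* (2⁻ M ℚ.* δ)              ≤⟨ ≤-by (fromℕ N ℚ.* 2⁻ M ℚ.* (r ℚ.- δ))
      (solve 4 (λ r f h δ → r :* (con 1ℚ :+ f :* h) := (r :+ f :* (h :* δ)) :+ (f :* h) :* (r :- δ)) refl r (fromℕ N) (2⁻ M) δ)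
      (0≤* (0≤* (0≤fromℕ N) (0≤2⁻ M)) (p≤q⇒0≤q-p (ℚ.<⇒≤ δ<r))) ⟩
    r ℚ.* (1ℚ ℚ.+ fromℕ N ℚ.* 2⁻ M)             ∎
    where open ℚ.≤-Reasoning

module Labelling {k : ℕ} (Λ : Point k → Fin n) where

  -- The image of the N-fold subdivision of `t` under the simplicial map given by the labels.
  X : ℕ → Vec (Point k) m → Chain n
  X N t τ = sdⁿ N _ (λ u → ⟦ Vec.map Λ u ⟧ τ) t

  ∂X : ∀ N (t : Vec (Point k) (suc m)) τ → ∂ʳ (X N t) τ ≡ d (λ u → X N u τ) t
  ∂X {m} N t τ = trans (additive-sdⁿ (∂ʳ-additive τ) N (suc m) (λ u → ⟦ Vec.map Λ u ⟧) t)
    (trans (sdⁿ-cong N (suc m) (λ u → trans (∂⟦⟧ (Vec.map Λ u) τ) (sym (d-map Λ (λ w → ⟦ w ⟧ τ) u))) t)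
           (sdⁿ-d N m (λ u → ⟦ Vec.map Λ u ⟧ τ) t))

  setOf : Vec (Fin n) m → Subset n
  setOf []      = ⊥
  setOf (v ∷ t) = setOf t ∪ ⁅ v ⁆

  ∈-setOf : ∀ {t : Vec (Fin n) m} {v} → v Vec.∈ t → v ∈ setOf t
  ∈-setOf {t = w ∷ t} (AnyV.here refl) = q⊆p∪q (setOf t) ⁅ w ⁆ (x∈⁅x⁆ w)
  ∈-setOf {t = w ∷ t} (AnyV.there v∈t) = p⊆p∪q ⁅ w ⁆ (∈-setOf v∈t)

  ∣setOf∣≤ : (t : Vec (Fin n) m) → ∣ setOf t ∣ ≤ m
  ∣setOf∣≤ []      = ℕ.≤-reflexive (∣⊥∣≡0 n)
  ∣setOf∣≤ {suc m} (v ∷ t) = ℕ.≤-trans (∣p∪q∣≤∣p∣+∣q∣ (setOf t) ⁅ v ⁆)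
    (ℕ.≤-trans (ℕ.+-mono-≤ (∣setOf∣≤ t) (ℕ.≤-reflexive (∣⁅x⁆∣≡1 v))) (ℕ.≤-reflexive (ℕ.+-comm m 1)))

  label-of : ∀ {u : Vec (Point k) m} {w} → w Vec.∈ Vec.map Λ u → ∃[ p ] p Vec.∈ u × Λ p ≡ w
  label-of {u = p ∷ u} (AnyV.here refl) = p , AnyV.here refl , refl
  label-of {u = p ∷ u} (AnyV.there w∈)  with label-of {u = u} w∈
  ... | q , q∈ , eq = q , AnyV.there q∈ , eq

  module _ (e : Fin n → Point k) (Q : Subset n → Point k → Set) (Q-convex : ∀ S → Convex (Q S))
    (Q-vertex : ∀ {S v} → v ∈ S → Q S (e v)) (Q-label : ∀ {S p} → Q S p → Λ p ∈ S)
    (e-spread : ∀ v w → Near 1ℚ (e v) (e w)) where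

    from-map : ∀ {m} {t : Vec (Fin n) m} {p} → p Vec.∈ Vec.map e t → ∃[ v ] v Vec.∈ t × e v ≡ p
    from-map {t = v ∷ t} (AnyV.here refl) = v , AnyV.here refl , refl
    from-map {t = v ∷ t} (AnyV.there p∈) with from-map {t = t} p∈
    ... | w , w∈ , eq = w , AnyV.there w∈ , eq

    -- By induction on the facets the difference `Y` of the two sides is a cycle. It lives on (m +
    -- 1)-element subsets of a set with at most m + 1 elements, so its cone from the vertex `v` of
    -- that set is 0; but the boundary of this cone is `Y`.
    sperner : ∀ N (t : Vec (Fin n) m) τ → X N (Vec.map e t) τ ≡ ⟦ t ⟧ τ
    sperner {zero} zero    [] τ = refl
    sperner {zero} (suc N) [] τ = sperner N [] τ
    sperner {suc m} N t@(v ∷ t') τ = begin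
      x τ                       ≡⟨ solve 2 (λ a b → a := (a :- b) :+ b) refl (x τ) (⟦ t ⟧ τ) ⟩
      Y τ ℚ.+ ⟦ t ⟧ τ           ≡⟨ cong (ℚ._+ ⟦ t ⟧ τ) Y≡0 ⟩
      0ℚ ℚ.+ ⟦ t ⟧ τ            ≡⟨ ℚ.+-identityˡ (⟦ t ⟧ τ) ⟩
      ⟦ t ⟧ τ                   ∎
      where
      open ≡-Reasoning
      x : Chain n
      x = X N (Vec.map e t)

      Y : Chain n
      Y σ = x σ ℚ.- ⟦ t ⟧ σ

      S = setOf t

      x-0 : ∀ σ → ¬ (∣ σ ∣ ≡ suc m × σ ⊆ S) → x σ ≡ 0ℚ
      x-0 σ h = sdⁿ-0 N {m} (suc m) ℕ.≤-refl 0≤1 (Q-convex S) (λ u → ⟦ Vec.map Λ u ⟧ σ)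
        (λ u u∈Q _ → ⟦⟧-0 (Vec.map Λ u) σ λ { (size , σ⊆) → h (size , λ {w} w∈σ →
          let p , p∈u , Λp≡w = label-of {u = u} (σ⊆ w∈σ) in subst (_∈ S) Λp≡w (Q-label (u∈Q p∈u))) })
        (Vec.map e t)
        (λ p∈ → let w , w∈ , eq = from-map {t = t} p∈ in subst (Q S) eq (Q-vertex (∈-setOf w∈)))
        (λ p∈ q∈ → let w , w∈ , eq = from-map {t = t} p∈
                       w' , w'∈ , eq' = from-map {t = t} q∈ in subst₂ (Near 1ℚ) eq eq' (e-spread w w'))

      Y-0 : ∀ σ → ¬ (∣ σ ∣ ≡ suc m × σ ⊆ S) → Y σ ≡ 0ℚ
      Y-0 σ h = cong₂ ℚ._-_ (x-0 σ h) (⟦⟧-0 t σ λ { (size , σ⊆t) → h (size , λ w∈σ → ∈-setOf (σ⊆t w∈σ)) })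

      ∂Y≡0 : ∀ σ → ∂ʳ Y σ ≡ 0ℚ
      ∂Y≡0 σ = trans (proj₂ (∂ʳ-additive σ) x ⟦ t ⟧) (trans
        (cong₂ ℚ._-_ (trans (∂X N (Vec.map e t) σ) (sym (d-map e (λ u → X N u σ) t))) (∂⟦⟧ t σ))
        (trans (cong (λ y → y ℚ.- d (λ u → ⟦ u ⟧ σ) t) (d-cong (λ u → sperner N u σ) t))
               (ℚ.+-inverseʳ (d (λ u → ⟦ u ⟧ σ) t))))

      wedge≡0 : ∀ σ → wedge v Y σ ≡ 0ℚ
      wedge≡0 σ = wedge-0 v Y σ λ ρ eq size → Y-0 ρ λ { (∣ρ∣ , ρ⊆S) → ℕ.<-irrefl (refl {x = suc m})
        (ℕ.≤-trans (ℕ.≤-reflexive (sym (trans size (cong suc ∣ρ∣))))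
          (ℕ.≤-trans (p⊆q⇒∣p∣≤∣q∣ {p = σ} (subst (_⊆ S) (sym eq) (∪⁅⁆⊆ ρ⊆S (∈-setOf {t = t} (AnyV.here refl)))))
                     (∣setOf∣≤ t))) }

      Y≡0 : Y τ ≡ 0ℚ
      Y≡0 = trans (sym (cycle-∂-wedge v ∂Y≡0 τ)) (∂ʳ-0 wedge≡0 τ)

-- Pushing small coordinates to zero

⊓-mono-+ : ∀ p p' q q' e → p ℚ.≤ q ℚ.+ e → p' ℚ.≤ q' ℚ.+ e → p ℚ.⊓ p' ℚ.≤ (q ℚ.⊓ q') ℚ.+ e
⊓-mono-+ p p' q q' e h h' with ℚ.⊓-sel q q'
... | inj₁ eq = subst (λ x → p ℚ.⊓ p' ℚ.≤ x ℚ.+ e) (sym eq) (ℚ.≤-trans (ℚ.p⊓q≤p p p') h)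
... | inj₂ eq = subst (λ x → p ℚ.⊓ p' ℚ.≤ x ℚ.+ e) (sym eq) (ℚ.≤-trans (ℚ.p⊓q≤q p p') h')

⊔-mono-+ : ∀ p p' q q' e → p ℚ.≤ q ℚ.+ e → p' ℚ.≤ q' ℚ.+ e → p ℚ.⊔ p' ℚ.≤ (q ℚ.⊔ q') ℚ.+ e
⊔-mono-+ p p' q q' e h h' with ℚ.⊔-sel p p'
... | inj₁ eq = subst (ℚ._≤ q ℚ.⊔ q' ℚ.+ e) (sym eq) (ℚ.≤-trans h (ℚ.+-monoˡ-≤ e (ℚ.p≤p⊔q q q')))
... | inj₂ eq = subst (ℚ._≤ q ℚ.⊔ q' ℚ.+ e) (sym eq) (ℚ.≤-trans h' (ℚ.+-monoˡ-≤ e (ℚ.p≤q⊔p q q')))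

-- Pour the amount r greedily into containers of capacities y.
pour : ∀ {k} → ℚ → Point k → Point k
pour r y zero    = r ℚ.⊓ y zero
pour r y (suc v) = pour (0ℚ ℚ.⊔ (r ℚ.- y zero)) (y ∘ suc) v

pour≤ : ∀ {k} r (y : Point k) v → pour r y v ℚ.≤ y v
pour≤ r y zero    = ℚ.p⊓q≤q r (y zero)
pour≤ r y (suc v) = pour≤ (0ℚ ℚ.⊔ (r ℚ.- y zero)) (y ∘ suc) v

0≤pour : ∀ {k} {r} (y : Point k) → 0ℚ ℚ.≤ r → (∀ v → 0ℚ ℚ.≤ y v) → ∀ v → 0ℚ ℚ.≤ pour r y v
0≤pour {r = r} y 0≤r 0≤y zero    = ℚ.⊓-glb 0≤r (0≤y zero)
0≤pour {r = r} y 0≤r 0≤y (suc v) = 0≤pour (y ∘ suc) (ℚ.p≤p⊔q 0ℚ (r ℚ.- y zero)) (0≤y ∘ suc) v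

0≤sum : ∀ {k} (y : Point k) → (∀ v → 0ℚ ℚ.≤ y v) → 0ℚ ℚ.≤ sum y
0≤sum {zero}  y h = ℚ.≤-refl
0≤sum {suc k} y h = 0≤+ (h zero) (0≤sum (y ∘ suc) (h ∘ suc))

⊓+⊔ : ∀ r y → (r ℚ.⊓ y) ℚ.+ (0ℚ ℚ.⊔ (r ℚ.- y)) ≡ r
⊓+⊔ r y with ℚ.≤-total r y
... | inj₁ r≤y = trans (cong₂ ℚ._+_ (ℚ.p≤q⇒p⊓q≡p r≤y) (ℚ.p≥q⇒p⊔q≡p r-y≤0)) (ℚ.+-identityʳ r)
  where
  r-y≤0 : r ℚ.- y ℚ.≤ 0ℚ
  r-y≤0 = subst (r ℚ.- y ℚ.≤_) (ℚ.+-inverseʳ y) (ℚ.+-monoˡ-≤ (ℚ.- y) r≤y)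
... | inj₂ y≤r = trans (cong₂ ℚ._+_ (ℚ.p≥q⇒p⊓q≡q y≤r) (ℚ.p≤q⇒p⊔q≡q (p≤q⇒0≤q-p y≤r)))
  (solve 2 (λ r y → y :+ (r :- y) := r) refl r y)

sum-pour : ∀ {k} r (y : Point k) → 0ℚ ℚ.≤ r → (∀ v → 0ℚ ℚ.≤ y v) → r ℚ.≤ sum y → sum (pour r y) ≡ r
sum-pour {zero}  r y 0≤r 0≤y r≤ = ℚ.≤-antisym 0≤r r≤
sum-pour {suc k} r y 0≤r 0≤y r≤ = trans
  (cong (r ℚ.⊓ y zero ℚ.+_) (sum-pour (0ℚ ℚ.⊔ (r ℚ.- y zero)) (y ∘ suc) (ℚ.p≤p⊔q 0ℚ (r ℚ.- y zero)) (0≤y ∘ suc)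
    (ℚ.⊔-lub {sum (y ∘ suc)} {0ℚ} {r ℚ.- y zero} (0≤sum (y ∘ suc) (0≤y ∘ suc))
      (≤-by (y zero ℚ.+ sum (y ∘ suc) ℚ.- r)
        (solve 3 (λ s y r → s := (r :- y) :+ (y :+ s :- r)) refl (sum (y ∘ suc)) (y zero) r) (p≤q⇒0≤q-p r≤)))))
  (⊓+⊔ r (y zero))

-- Each container changes the error in the remaining amount by at most a further `b`, so the error
-- grows linearly along the list.
pour-lipschitz : ∀ {k} {r r' a b} (y y' : Point k) → 0ℚ ℚ.≤ a → 0ℚ ℚ.≤ b → r ℚ.≤ r' ℚ.+ a → r' ℚ.≤ r ℚ.+ a →
                 Near b y y' → Near b y' y → ∀ v → pour r y v ℚ.≤ pour r' y' v ℚ.+ (a ℚ.+ fromℕ k ℚ.* b)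
pour-lipschitz {suc k} {r} {r'} {a} {b} y y' 0≤a 0≤b h h' g g' zero = ⊓-mono-+ r (y zero) r' (y' zero) (a ℚ.+ fromℕ (suc k) ℚ.* b)
  (ℚ.≤-trans h (≤-by (fromℕ (suc k) ℚ.* b) (sym (ℚ.+-assoc r' a (fromℕ (suc k) ℚ.* b))) (0≤* (0≤fromℕ (suc k)) 0≤b)))
  (ℚ.≤-trans (g zero) (≤-by (a ℚ.+ fromℕ k ℚ.* b)
    (solve 4 (λ y a b f → y :+ (a :+ (con 1ℚ :+ f) :* b) := (y :+ b) :+ (a :+ f :* b)) refl (y' zero) a b (fromℕ k))
    (0≤+ 0≤a (0≤* (0≤fromℕ k) 0≤b))))
pour-lipschitz {suc k} {r} {r'} {a} {b} y y' 0≤a 0≤b h h' g g' (suc v) = subst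
  (λ x → pour s (y ∘ suc) v ℚ.≤ pour s' (y' ∘ suc) v ℚ.+ x)
  (solve 3 (λ a b f → (a :+ b) :+ f :* b := a :+ (con 1ℚ :+ f) :* b) refl a b (fromℕ k))
  (pour-lipschitz (y ∘ suc) (y' ∘ suc) 0≤a+b 0≤b (step r r' (y zero) (y' zero) h (g' zero)) (step r' r (y' zero) (y zero) h' (g zero)) (g ∘ suc) (g' ∘ suc) v)
  where
  s = 0ℚ ℚ.⊔ (r ℚ.- y zero)
  s' = 0ℚ ℚ.⊔ (r' ℚ.- y' zero)

  0≤a+b : 0ℚ ℚ.≤ a ℚ.+ b
  0≤a+b = 0≤+ 0≤a 0≤b

  step : ∀ r r' x x' → r ℚ.≤ r' ℚ.+ a → x' ℚ.≤ x ℚ.+ b → 0ℚ ℚ.⊔ (r ℚ.- x) ℚ.≤ 0ℚ ℚ.⊔ (r' ℚ.- x') ℚ.+ (a ℚ.+ b)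
  step r r' x x' h g = ⊔-mono-+ 0ℚ (r ℚ.- x) 0ℚ (r' ℚ.- x') (a ℚ.+ b) (≤-by (a ℚ.+ b) refl 0≤a+b)
    (≤-by ((r' ℚ.+ a ℚ.- r) ℚ.+ (x ℚ.+ b ℚ.- x'))
      (solve 6 (λ r r' x x' a b → (r' :- x') :+ (a :+ b) := (r :- x) :+ ((r' :+ a :- r) :+ (x :+ b :- x'))) refl r r' x x' a b)
      (0≤+ (p≤q⇒0≤q-p h) (p≤q⇒0≤q-p g)))

3ℚ : ℚ
3ℚ = 1ℚ ℚ.+ (1ℚ ℚ.+ 1ℚ)

0≤3 : 0ℚ ℚ.≤ 3ℚ
0≤3 = ℚ.nonNegative⁻¹ 3ℚ

-- Coordinates at most 5 unit⁻ are killed by the retraction.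
unit⁻ : ℕ → ℚ
unit⁻ k = ½ ℚ.* (½ ℚ.* (½ ℚ.* (½ ℚ.* 2⁻ k)))

0<unit⁻ : ∀ k → 0ℚ ℚ.< unit⁻ k
0<unit⁻ k = 0<* 0<½ (0<* 0<½ (0<* 0<½ (0<* 0<½ (0<2⁻ k))))

-- The factor 3 leaves total capacity at least 1: subtracting `2⁻ k` in k places costs at most 1,
-- and the coordinates are to sum to at least 2/3. The cut at 3 p v = `2⁻ k` lies above p v = 5
-- `unit⁻`, where 3 p v is 15/16 of it.
clip : ∀ {k} → Point k → Point k
clip {k} p v = 0ℚ ℚ.⊔ (3ℚ ℚ.* p v ℚ.- 2⁻ k)

-- Pouring the amount 1 normalises the total without division and makes no zero capacity positive.
retract : ∀ {k} → Point k → Point k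
retract p = pour 1ℚ (clip p)

0≤clip : ∀ {k} (p : Point k) v → 0ℚ ℚ.≤ clip p v
0≤clip {k} p v = ℚ.p≤p⊔q 0ℚ (3ℚ ℚ.* p v ℚ.- 2⁻ k)

0≤retract : ∀ {k} (p : Point k) v → 0ℚ ℚ.≤ retract p v
0≤retract p = 0≤pour (clip p) 0≤1 (0≤clip p)

4ℚ 5ℚ : ℚ
4ℚ = 1ℚ ℚ.+ 3ℚ
5ℚ = 1ℚ ℚ.+ 4ℚ

retract-kills : ∀ {k} (p : Point k) v → p v ℚ.≤ 5ℚ ℚ.* unit⁻ k → retract p v ≡ 0ℚ
retract-kills {k} p v small = ℚ.≤-antisym
  (ℚ.≤-trans (pour≤ 1ℚ (clip p) v) (ℚ.≤-reflexive (ℚ.p≥q⇒p⊔q≡p {0ℚ} {3ℚ ℚ.* p v ℚ.- 2⁻ k}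
    (≤-by (3ℚ ℚ.* (5ℚ ℚ.* unit⁻ k ℚ.- p v) ℚ.+ unit⁻ k)
      (solve 2 (λ x h → con 0ℚ := (con 3ℚ :* x :- h) :+
          (con 3ℚ :* (con 5ℚ :* (con ½ :* (con ½ :* (con ½ :* (con ½ :* h)))) :- x) :+ con ½ :* (con ½ :* (con ½ :* (con ½ :* h)))))
        refl (p v) (2⁻ k))
      (0≤+ (0≤* 0≤3 (p≤q⇒0≤q-p small)) (ℚ.<⇒≤ (0<unit⁻ k)))))))
  (0≤retract p v)

sum-mono : ∀ {k} {f g : Point k} → (∀ v → f v ℚ.≤ g v) → sum f ℚ.≤ sum g
sum-mono {zero}  h = ℚ.≤-refl
sum-mono {suc k} h = ℚ.+-mono-≤ (h zero) (sum-mono (h ∘ suc))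

sum-affine : ∀ {k} a b (p : Point k) → sum (λ v → a ℚ.* p v ℚ.- b) ≡ a ℚ.* sum p ℚ.- fromℕ k ℚ.* b
sum-affine {zero}  a b p = solve 2 (λ a b → con 0ℚ := a :* con 0ℚ :- con 0ℚ :* b) refl a b
sum-affine {suc k} a b p = trans (cong (a ℚ.* p zero ℚ.- b ℚ.+_) (sum-affine a b (p ∘ suc)))
  (solve 5 (λ a b x s f → (a :* x :- b) :+ (a :* s :- f :* b) := a :* (x :+ s) :- (con 1ℚ :+ f) :* b) refl
    a b (p zero) (sum (p ∘ suc)) (fromℕ k))

⅓ : ℚ
⅓ = ℤ.+ 1 ℚ./ 3

sum-retract : ∀ {k} (p : Point k) → 1ℚ ℚ.≤ sum p ℚ.+ ⅓ → sum (retract p) ≡ 1ℚ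
sum-retract {k} p h = sum-pour 1ℚ (clip p) 0≤1 (0≤clip p) (ℚ.≤-trans
  (≤-by (3ℚ ℚ.* (sum p ℚ.+ ⅓ ℚ.- 1ℚ) ℚ.+ (1ℚ ℚ.- fromℕ k ℚ.* 2⁻ k))
    (solve 2 (λ s x → con 3ℚ :* s :- x := con 1ℚ :+ (con 3ℚ :* (s :+ con ⅓ :- con 1ℚ) :+ (con 1ℚ :- x))) refl
      (sum p) (fromℕ k ℚ.* 2⁻ k))
    (0≤+ (0≤* 0≤3 (p≤q⇒0≤q-p h)) (p≤q⇒0≤q-p (fromℕ*2⁻≤1 k))))
  (ℚ.≤-trans (ℚ.≤-reflexive (sym (sum-affine 3ℚ (2⁻ k) p)))
    (sum-mono λ v → ℚ.p≤q⊔p 0ℚ (3ℚ ℚ.* p v ℚ.- 2⁻ k))))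

lip : ℕ → ℚ → ℚ
lip k D = fromℕ k ℚ.* (3ℚ ℚ.* D)

retract-lipschitz : ∀ {k} {D} (p q : Point k) → 0ℚ ℚ.≤ D → Near D p q → Near D q p → Near (lip k D) (retract p) (retract q)
retract-lipschitz {k} {D} p q 0≤D h h' v = subst (λ x → retract p v ℚ.≤ retract q v ℚ.+ x) (ℚ.+-identityˡ (lip k D))
  (pour-lipschitz {a = 0ℚ} (clip p) (clip q) ℚ.≤-refl (0≤* 0≤3 0≤D) ℚ.≤-refl ℚ.≤-refl (clip-near p q h) (clip-near q p h') v)
  where
  clip-near : ∀ (p q : Point k) → Near D p q → Near (3ℚ ℚ.* D) (clip p) (clip q)
  clip-near p q h v = ⊔-mono-+ 0ℚ (3ℚ ℚ.* p v ℚ.- 2⁻ k) 0ℚ (3ℚ ℚ.* q v ℚ.- 2⁻ k) (3ℚ ℚ.* D) (≤-by (3ℚ ℚ.* D) refl (0≤* 0≤3 0≤D))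
    (≤-by (3ℚ ℚ.* (q v ℚ.+ D ℚ.- p v))
      (solve 4 (λ p q D h → (con 3ℚ :* q :- h) :+ con 3ℚ :* D := (con 3ℚ :* p :- h) :+ con 3ℚ :* (q :+ D :- p)) refl
        (p v) (q v) D (2⁻ k))
      (0≤* 0≤3 (p≤q⇒0≤q-p (h v))))

-- The factor 1/4 absorbs the 3 in `lip`, and `2⁻ k` absorbs its k.
lip⁻ : ℕ → ℚ → ℚ
lip⁻ k ε = ½ ℚ.* (½ ℚ.* (2⁻ k ℚ.* ε))

0<lip⁻ : ∀ k {ε} → 0ℚ ℚ.< ε → 0ℚ ℚ.< lip⁻ k ε
0<lip⁻ k 0<ε = 0<* 0<½ (0<* 0<½ (0<* (0<2⁻ k) 0<ε))

lip-lip⁻ : ∀ k {ε} → 0ℚ ℚ.≤ ε → lip k (lip⁻ k ε) ℚ.≤ ε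
lip-lip⁻ k {ε} 0≤ε = ≤-by (3ℚ ℚ.* (½ ℚ.* (½ ℚ.* ((1ℚ ℚ.- fromℕ k ℚ.* 2⁻ k) ℚ.* ε))) ℚ.+ ½ ℚ.* (½ ℚ.* ε))
  (solve 3 (λ f h e → e := f :* (con 3ℚ :* (con ½ :* (con ½ :* (h :* e)))) :+
                          (con 3ℚ :* (con ½ :* (con ½ :* ((con 1ℚ :- f :* h) :* e))) :+ con ½ :* (con ½ :* e))) refl
    (fromℕ k) (2⁻ k) ε)
  (0≤+ (0≤* 0≤3 (0≤* 0≤½ (0≤* 0≤½ (0≤* (p≤q⇒0≤q-p (fromℕ*2⁻≤1 k)) 0≤ε)))) (0≤* 0≤½ (0≤* 0≤½ 0≤ε)))

-- Real numbers

Eventually : (ℕ → Set) → Set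
Eventually P = ∃[ N ] ∀ k → N ≤ k → P k

ev-map : {P Q : ℕ → Set} → (∀ k → P k → Q k) → Eventually P → Eventually Q
ev-map f (N , h) = N , λ k N≤k → f k (h k N≤k)

ev-map₂ : {P Q R : ℕ → Set} → (∀ k → P k → Q k → R k) → Eventually P → Eventually Q → Eventually R
ev-map₂ f (N , h) (N' , h') = N ℕ.⊔ N' , λ k le →
  f k (h k (ℕ.m⊔n≤o⇒m≤o N N' le)) (h' k (ℕ.m⊔n≤o⇒n≤o N N' le))

ev-all : {P : Fin n → ℕ → Set} → (∀ v → Eventually (P v)) → Eventually (λ k → ∀ v → P v k)
ev-all {zero}  h = 0 , λ _ _ ()
ev-all {suc n} h = ev-map₂ (λ { k p ps zero → p ; k p ps (suc v) → ps v }) (h zero) (ev-all (h ∘ suc))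

ev-const : {P : Set} → Eventually (λ _ → P) → P
ev-const (N , h) = h N ℕ.≤-refl

p≤∣p∣ : ∀ p → p ℚ.≤ ℚ.∣ p ∣
p≤∣p∣ p with ℚ.∣p∣≡p∨∣p∣≡-p p
... | inj₁ eq = ℚ.≤-reflexive (sym eq)
... | inj₂ eq = ℚ.≤-trans
  (subst (ℚ._≤ 0ℚ) (solve 1 (λ p → :- (:- p) := p) refl p) (ℚ.neg-antimono-≤ (subst (0ℚ ℚ.≤_) eq (ℚ.0≤∣p∣ p))))
  (ℚ.0≤∣p∣ p)

∣p-q∣≤⇒p≤q+ : ∀ p q {ε} → ℚ.∣ p ℚ.- q ∣ ℚ.≤ ε → p ℚ.≤ q ℚ.+ ε
∣p-q∣≤⇒p≤q+ p q {ε} h = ≤-by (ε ℚ.- (p ℚ.- q)) (solve 3 (λ p q e → q :+ e := p :+ (e :- (p :- q))) refl p q ε)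
  (p≤q⇒0≤q-p (ℚ.≤-trans (p≤∣p∣ (p ℚ.- q)) h))

∣p-q∣≤⇒q≤p+ : ∀ p q {ε} → ℚ.∣ p ℚ.- q ∣ ℚ.≤ ε → q ℚ.≤ p ℚ.+ ε
∣p-q∣≤⇒q≤p+ p q {ε} h = ∣p-q∣≤⇒p≤q+ q p (subst (ℚ._≤ ε)
  (trans (sym (ℚ.∣-p∣≡∣p∣ (p ℚ.- q))) (cong ℚ.∣_∣ (solve 2 (λ p q → :- (p :- q) := q :- p) refl p q))) h)

≤⇒∣p-q∣≤ : ∀ p q {ε} → p ℚ.≤ q ℚ.+ ε → q ℚ.≤ p ℚ.+ ε → ℚ.∣ p ℚ.- q ∣ ℚ.≤ ε
≤⇒∣p-q∣≤ p q {ε} h h' with ℚ.∣p∣≡p∨∣p∣≡-p (p ℚ.- q)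
... | inj₁ eq = subst (ℚ._≤ ε) (sym eq)
  (≤-by (q ℚ.+ ε ℚ.- p) (solve 3 (λ p q e → e := (p :- q) :+ (q :+ e :- p)) refl p q ε) (p≤q⇒0≤q-p h))
... | inj₂ eq = subst (ℚ._≤ ε) (sym eq)
  (≤-by (p ℚ.+ ε ℚ.- q) (solve 3 (λ p q e → e := :- (p :- q) :+ (p :+ e :- q)) refl p q ε) (p≤q⇒0≤q-p h'))

0<½* : ∀ {ε} → 0ℚ ℚ.< ε → 0ℚ ℚ.< ½ ℚ.* ε
0<½* = 0<* 0<½

½+½ : ∀ ε → ½ ℚ.* ε ℚ.+ ½ ℚ.* ε ≡ ε
½+½ = solve 1 (λ e → con ½ :* e :+ con ½ :* e := e) refl

≤-+-trans : ∀ {p q r a b} → p ℚ.≤ q ℚ.+ a → q ℚ.≤ r ℚ.+ b → p ℚ.≤ r ℚ.+ (a ℚ.+ b)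
≤-+-trans {p} {q} {r} {a} {b} h h' = ≤-by ((q ℚ.+ a ℚ.- p) ℚ.+ (r ℚ.+ b ℚ.- q))
  (solve 5 (λ p q r a b → r :+ (a :+ b) := p :+ ((q :+ a :- p) :+ (r :+ b :- q))) refl p q r a b)
  (0≤+ (p≤q⇒0≤q-p h) (p≤q⇒0≤q-p h'))

≤ᴿ-eventually : ∀ {x y} → Eventually (λ k → seq x k ℚ.≤ seq y k) → x ≤ᴿ y
≤ᴿ-eventually {x} {y} h ε 0<ε = ev-map (λ k le → ℚ.≤-trans le (≤-by ε refl (ℚ.<⇒≤ 0<ε))) h

≤ᴿ-pointwise : ∀ {x y} → (∀ k → seq x k ℚ.≤ seq y k) → x ≤ᴿ y
≤ᴿ-pointwise {x} {y} h = ≤ᴿ-eventually {x} {y} (0 , λ k _ → h k)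

≤ᴿ-refl : ∀ {x} → x ≤ᴿ x
≤ᴿ-refl {x} = ≤ᴿ-pointwise {x} {x} λ k → ℚ.≤-refl

≤ᴿ-trans : ∀ {x y z} → x ≤ᴿ y → y ≤ᴿ z → x ≤ᴿ z
≤ᴿ-trans {x} {y} {z} h h' ε 0<ε = ev-map₂
  (λ k p q → subst (λ e → seq x k ℚ.≤ seq z k ℚ.+ e) (½+½ ε) (≤-+-trans {seq x k} {seq y k} {seq z k} p q))
  (h (½ ℚ.* ε) (0<½* 0<ε)) (h' (½ ℚ.* ε) (0<½* 0<ε))

≈ᴿ-refl : ∀ {x} → x ≈ᴿ x
≈ᴿ-refl {x} = ≤ᴿ-refl {x} , ≤ᴿ-refl {x}

≈ᴿ-sym : ∀ {x y} → x ≈ᴿ y → y ≈ᴿ x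
≈ᴿ-sym (h , h') = h' , h

≈ᴿ-trans : ∀ {x y z} → x ≈ᴿ y → y ≈ᴿ z → x ≈ᴿ z
≈ᴿ-trans {x} {y} {z} (h , h') (g , g') = ≤ᴿ-trans {x} {y} {z} h g , ≤ᴿ-trans {z} {y} {x} g' h'

≤ᴿ-+-trans : ∀ {x y z a b} → x ≤ᴿ y +ᴿ fromℚ a → y ≤ᴿ z +ᴿ fromℚ b → x ≤ᴿ z +ᴿ fromℚ (a ℚ.+ b)
≤ᴿ-+-trans {x} {y} {z} {a} {b} h h' ε 0<ε = ev-map₂
  (λ k p q → ≤-by ((seq y k ℚ.+ a ℚ.+ ½ ℚ.* ε ℚ.- seq x k) ℚ.+ (seq z k ℚ.+ b ℚ.+ ½ ℚ.* ε ℚ.- seq y k))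
    (solve 6 (λ x y z a b e → (z :+ (a :+ b)) :+ e :=
                              x :+ ((y :+ a :+ con ½ :* e :- x) :+ (z :+ b :+ con ½ :* e :- y))) refl
      (seq x k) (seq y k) (seq z k) a b ε)
    (0≤+ (p≤q⇒0≤q-p p) (p≤q⇒0≤q-p q)))
  (h (½ ℚ.* ε) (0<½* 0<ε)) (h' (½ ℚ.* ε) (0<½* 0<ε))

≤ᴿ-+-weaken : ∀ {x y a} → 0ℚ ℚ.≤ a → x ≤ᴿ y → x ≤ᴿ y +ᴿ fromℚ a
≤ᴿ-+-weaken {x} {y} {a} 0≤a h = ≤ᴿ-trans {x} {y} {y +ᴿ fromℚ a} h
  (≤ᴿ-pointwise {y} {y +ᴿ fromℚ a} λ k → ≤-by a refl 0≤a)

Within-sym : ∀ {x y : Fin n → ℝ} {a} → Within a x y → Within a y x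
Within-sym h v = proj₂ (h v) , proj₁ (h v)

≈⇒Within : ∀ {x y : Fin n → ℝ} {a} → 0ℚ ℚ.≤ a → (∀ v → x v ≈ᴿ y v) → Within a x y
≈⇒Within {x = x} {y} 0≤a h v =
  ≤ᴿ-+-weaken {x v} {y v} 0≤a (proj₁ (h v)) , ≤ᴿ-+-weaken {y v} {x v} 0≤a (proj₂ (h v))

≤ᴿ-from-all : ∀ {x y} → (∀ ε → 0ℚ ℚ.< ε → x ≤ᴿ y +ᴿ fromℚ ε) → x ≤ᴿ y
≤ᴿ-from-all {x} {y} h ε 0<ε = ev-map
  (λ k le → subst (seq x k ℚ.≤_) (trans (ℚ.+-assoc (seq y k) (½ ℚ.* ε) (½ ℚ.* ε)) (cong (seq y k ℚ.+_) (½+½ ε))) le)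
  (h (½ ℚ.* ε) (0<½* 0<ε) (½ ℚ.* ε) (0<½* 0<ε))

map-respects : ∀ {K : Complex m} {L : Complex n} (f : ContinuousMap K L) x y →
               (∀ v → coord x v ≈ᴿ coord y v) → ∀ v → coord (apply f x) v ≈ᴿ coord (apply f y) v
map-respects f x y x≈y v =
  ≤ᴿ-from-all {coord (apply f x) v} {coord (apply f y) v} (λ ε 0<ε → proj₁ (near ε 0<ε)) ,
  ≤ᴿ-from-all {coord (apply f y) v} {coord (apply f x) v} (λ ε 0<ε → proj₂ (near ε 0<ε))
  where
  near : ∀ ε → 0ℚ ℚ.< ε → _
  near ε 0<ε with continuous f ε 0<ε
  ... | δ , 0<δ , h = h x y (≈⇒Within {x = coord x} {coord y} (ℚ.<⇒≤ 0<δ) x≈y) v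

approx : ∀ x ε → 0ℚ ℚ.< ε → ∃[ q ] x ≤ᴿ fromℚ (q ℚ.+ ε) × fromℚ q ≤ᴿ x +ᴿ fromℚ ε
approx x ε 0<ε with cauchy x ε 0<ε
... | N , h = seq x N ,
  ≤ᴿ-eventually {x} {fromℚ (seq x N ℚ.+ ε)} (N , λ k le → ∣p-q∣≤⇒p≤q+ (seq x k) (seq x N) (h k N le ℕ.≤-refl)) ,
  ≤ᴿ-eventually {fromℚ (seq x N)} {x +ᴿ fromℚ ε} (N , λ k le → ∣p-q∣≤⇒q≤p+ (seq x k) (seq x N) (h k N le ℕ.≤-refl))

fromℚ-cancel : ∀ {p q} → fromℚ p ≤ᴿ fromℚ q → p ℚ.≤ q
fromℚ-cancel {p} {q} h = ℚ.≮⇒≥ λ q<p →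
  let r , q<r , r<p = ℚ.<-dense q<p
      0<r-q = subst (ℚ._< r ℚ.- q) (ℚ.+-inverseʳ q) (ℚ.+-monoˡ-< (ℚ.- q) q<r)
      p≤r = subst (p ℚ.≤_) (solve 2 (λ q r → q :+ (r :- q) := r) refl q r) (ev-const (h (r ℚ.- q) 0<r-q))
  in ℚ.<-irrefl refl (ℚ.<-≤-trans r<p p≤r)

fromℚ-mono : ∀ {p q} → p ℚ.≤ q → fromℚ p ≤ᴿ fromℚ q
fromℚ-mono {p} {q} h = ≤ᴿ-pointwise {fromℚ p} {fromℚ q} λ _ → h

0<ᴿ-intro : ∀ {x a} → 0ℚ ℚ.< a → fromℚ a ≤ᴿ x → 0ᴿ <ᴿ x
0<ᴿ-intro {x} {a} 0<a h = ½ ℚ.* a , 0<½* 0<a , ev-map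
  (λ k le → ≤-by (seq x k ℚ.+ ½ ℚ.* a ℚ.- a)
    (solve 2 (λ x a → x := (con 0ℚ :+ con ½ :* a) :+ (x :+ con ½ :* a :- a)) refl (seq x k) a) (p≤q⇒0≤q-p le))
  (h (½ ℚ.* a) (0<½* 0<a))

0<ᴿ-elim : ∀ {x} → 0ᴿ <ᴿ x → ∃[ a ] 0ℚ ℚ.< a × fromℚ a ≤ᴿ x
0<ᴿ-elim {x} (a , 0<a , ev) = a , 0<a , ≤ᴿ-eventually {fromℚ a} {x} (ev-map (λ k le → subst (ℚ._≤ seq x k) (ℚ.+-identityˡ a) le) ev)

<ᴿ-≤ᴿ-trans : ∀ {x y} → 0ᴿ <ᴿ x → x ≤ᴿ y → 0ᴿ <ᴿ y
<ᴿ-≤ᴿ-trans {x} {y} 0<x x≤y with 0<ᴿ-elim {x} 0<x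
... | a , 0<a , a≤x = 0<ᴿ-intro {y} 0<a (≤ᴿ-trans {fromℚ a} {x} {y} a≤x x≤y)

≤0⇒≯0 : ∀ {x} → x ≤ᴿ 0ᴿ → ¬ (0ᴿ <ᴿ x)
≤0⇒≯0 {x} x≤0 0<x with 0<ᴿ-elim {x} 0<x
... | a , 0<a , a≤x = ℚ.<-irrefl refl (ℚ.<-≤-trans 0<a (fromℚ-cancel (≤ᴿ-trans {fromℚ a} {x} {0ᴿ} a≤x x≤0)))

fromℚ-shift : ∀ {x} q η → fromℚ q ≤ᴿ x +ᴿ fromℚ η → fromℚ (q ℚ.- η) ≤ᴿ x
fromℚ-shift {x} q η h ε 0<ε = ev-map (λ k le → shift (seq x k) le) (h ε 0<ε)
  where
  shift : ∀ y → q ℚ.≤ y ℚ.+ η ℚ.+ ε → q ℚ.- η ℚ.≤ y ℚ.+ ε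
  shift y le = ≤-by (y ℚ.+ η ℚ.+ ε ℚ.- q)
    (solve 4 (λ y q h e → y :+ e := (q :- h) :+ (y :+ h :+ e :- q)) refl y q η ε) (p≤q⇒0≤q-p le)

-- The case distinction is made on a rational approximation, where the order is decidable; an
-- approximation well above 0 would make `x` positive.
≯0⇒≤0 : ∀ {x} → ¬ (0ᴿ <ᴿ x) → x ≤ᴿ 0ᴿ
≯0⇒≤0 {x} x≯0 = ≤ᴿ-from-all {x} {0ᴿ} λ ε 0<ε →
  subst (λ e → x ≤ᴿ 0ᴿ +ᴿ fromℚ e) (½+½ ε) (small (½ ℚ.* ε) (0<½* 0<ε))
  where
  small : ∀ η → 0ℚ ℚ.< η → x ≤ᴿ 0ᴿ +ᴿ fromℚ (η ℚ.+ η)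
  small η 0<η = compare (approx x η 0<η)
    where
    compare : ∃[ q ] x ≤ᴿ fromℚ (q ℚ.+ η) × fromℚ q ≤ᴿ x +ᴿ fromℚ η → x ≤ᴿ 0ᴿ +ᴿ fromℚ (η ℚ.+ η)
    compare (q , x≤q+ , q≤x+) with q ℚ.≤? η
    ... | yes q≤η = ≤ᴿ-trans {x} {fromℚ (q ℚ.+ η)} {0ᴿ +ᴿ fromℚ (η ℚ.+ η)} x≤q+
      (≤ᴿ-pointwise {fromℚ (q ℚ.+ η)} {0ᴿ +ᴿ fromℚ (η ℚ.+ η)} λ _ →
        subst (q ℚ.+ η ℚ.≤_) (sym (ℚ.+-identityˡ (η ℚ.+ η))) (ℚ.+-monoˡ-≤ η q≤η))
    ... | no q≰η = ⊥-elim (x≯0 (0<ᴿ-intro {x} {q ℚ.- η}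
      (subst (ℚ._< q ℚ.- η) (ℚ.+-inverseʳ η) (ℚ.+-monoˡ-< (ℚ.- η) (ℚ.≰⇒> q≰η))) (fromℚ-shift {x} q η q≤x+)))

seq-sum : ∀ (x : Fin n → ℝ) k → seq (sumᴿ x) k ≡ sum (λ v → seq (x v) k)
seq-sum {zero}  x k = refl
seq-sum {suc n} x k = cong (seq (x zero) k ℚ.+_) (seq-sum (x ∘ suc) k)

+ᴿ-mono : ∀ {x y z w} → x ≤ᴿ y → z ≤ᴿ w → x +ᴿ z ≤ᴿ y +ᴿ w
+ᴿ-mono {x} {y} {z} {w} h h' ε 0<ε = ev-map₂ (λ k → halves (seq x k) (seq y k) (seq z k) (seq w k))
  (h (½ ℚ.* ε) (0<½* 0<ε)) (h' (½ ℚ.* ε) (0<½* 0<ε))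
  where
  halves : ∀ a b c d → a ℚ.≤ b ℚ.+ ½ ℚ.* ε → c ℚ.≤ d ℚ.+ ½ ℚ.* ε → a ℚ.+ c ℚ.≤ b ℚ.+ d ℚ.+ ε
  halves a b c d p q = ≤-by ((b ℚ.+ ½ ℚ.* ε ℚ.- a) ℚ.+ (d ℚ.+ ½ ℚ.* ε ℚ.- c))
    (solve 5 (λ a b c d e → (b :+ d) :+ e := (a :+ c) :+ ((b :+ con ½ :* e :- a) :+ (d :+ con ½ :* e :- c))) refl
      a b c d ε)
    (0≤+ (p≤q⇒0≤q-p p) (p≤q⇒0≤q-p q))

sumᴿ-mono : ∀ (x y : Fin n → ℝ) → (∀ v → x v ≤ᴿ y v) → sumᴿ x ≤ᴿ sumᴿ y
sumᴿ-mono {zero}  x y h = ≤ᴿ-refl {0ᴿ}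
sumᴿ-mono {suc n} x y h = +ᴿ-mono {x zero} {y zero} {sumᴿ (x ∘ suc)} {sumᴿ (y ∘ suc)}
                              (h zero) (sumᴿ-mono (x ∘ suc) (y ∘ suc) (h ∘ suc))

sumᴿ-cong : ∀ (x y : Fin n → ℝ) → (∀ v → x v ≈ᴿ y v) → sumᴿ x ≈ᴿ sumᴿ y
sumᴿ-cong x y h = sumᴿ-mono x y (proj₁ ∘ h) , sumᴿ-mono y x (proj₂ ∘ h)

module _ {k : ℕ} where

  cauchy-all : (x : Fin k → ℝ) → ∀ ε → 0ℚ ℚ.< ε →
               ∃[ N ] ∀ i j → N ≤ i → N ≤ j → ∀ v → seq (x v) i ℚ.≤ seq (x v) j ℚ.+ ε
  cauchy-all x ε 0<ε = proj₁ all , λ i j N≤i N≤j v → lemma v i j (proj₂ all i N≤i v) (proj₂ all j N≤j v)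
    where
    all = ev-all {P = λ v i → proj₁ (cauchy (x v) ε 0<ε) ≤ i} λ v → proj₁ (cauchy (x v) ε 0<ε) , λ _ le → le

    lemma : ∀ v i j → proj₁ (cauchy (x v) ε 0<ε) ≤ i → proj₁ (cauchy (x v) ε 0<ε) ≤ j →
            seq (x v) i ℚ.≤ seq (x v) j ℚ.+ ε
    lemma v i j hi hj = ∣p-q∣≤⇒p≤q+ (seq (x v) i) (seq (x v) j) (proj₂ (cauchy (x v) ε 0<ε) i j hi hj)

  at : (Fin k → ℝ) → ℕ → Point k
  at x i v = seq (x v) i

  retractᴿ : (Fin k → ℝ) → Fin k → ℝ
  retractᴿ x v .seq i = retract (at x i) v
  retractᴿ x v .cauchy ε 0<ε = proj₁ modulus , λ i j N≤i N≤j →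
    ≤⇒∣p-q∣≤ (retract (at x i) v) (retract (at x j) v) (one i j N≤i N≤j) (one j i N≤j N≤i)
    where
    modulus = cauchy-all x (lip⁻ k ε) (0<lip⁻ k 0<ε)

    one : ∀ i j → proj₁ modulus ≤ i → proj₁ modulus ≤ j → retract (at x i) v ℚ.≤ retract (at x j) v ℚ.+ ε
    one i j N≤i N≤j = ℚ.≤-trans
      (retract-lipschitz {D = lip⁻ k ε} (at x i) (at x j) (ℚ.<⇒≤ (0<lip⁻ k 0<ε))
        (proj₂ modulus i j N≤i N≤j) (proj₂ modulus j i N≤j N≤i) v)
      (ℚ.+-monoʳ-≤ (retract (at x j) v) (lip-lip⁻ k (ℚ.<⇒≤ 0<ε)))

  retractᴿ-nonneg : ∀ x v → 0ᴿ ≤ᴿ retractᴿ x v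
  retractᴿ-nonneg x v = ≤ᴿ-pointwise {0ᴿ} {retractᴿ x v} λ i → 0≤retract (at x i) v

  -- The approximants of a point sum to 1 only in the limit. The tolerance ⅓ of `sum-retract`
  -- absorbs this, and the retracted approximants sum to exactly 1 from some stage on.
  retractᴿ-total : ∀ x → 1ᴿ ≤ᴿ sumᴿ x → sumᴿ (retractᴿ x) ≈ᴿ 1ᴿ
  retractᴿ-total x h = ≤ᴿ-eventually {sumᴿ (retractᴿ x)} {1ᴿ} (ev-map (λ i eq → ℚ.≤-reflexive eq) ev) ,
                       ≤ᴿ-eventually {1ᴿ} {sumᴿ (retractᴿ x)} (ev-map (λ i eq → ℚ.≤-reflexive (sym eq)) ev)
    where
    ev : Eventually (λ i → seq (sumᴿ (retractᴿ x)) i ≡ 1ℚ)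
    ev = ev-map (λ i le → trans (seq-sum (retractᴿ x) i)
                    (sum-retract (at x i) (subst (λ s → 1ℚ ℚ.≤ s ℚ.+ ⅓) (seq-sum x i) le)))
                (h ⅓ (ℚ.positive⁻¹ ⅓))

  retractᴿ-kills : ∀ x v → x v ≤ᴿ fromℚ (4ℚ ℚ.* unit⁻ k) → retractᴿ x v ≤ᴿ 0ᴿ
  retractᴿ-kills x v h = ≤ᴿ-eventually {retractᴿ x v} {0ᴿ}
    (ev-map (λ i le → ℚ.≤-reflexive (retract-kills (at x i) v
               (subst (seq (x v) i ℚ.≤_) (solve 1 (λ u → con 4ℚ :* u :+ u := con 5ℚ :* u) refl (unit⁻ k)) le)))
      (h (unit⁻ k) (0<unit⁻ k)))

  -- At a stage where the coordinate is at most 5 `unit⁻` its retraction is 0, so positivity forces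
  -- this uniform lower bound.
  retractᴿ-positive : ∀ x v → 0ᴿ <ᴿ retractᴿ x v → 0ᴿ <ᴿ x v
  retractᴿ-positive x v (a , 0<a , ev) = 5ℚ ℚ.* unit⁻ k , 0<* (ℚ.positive⁻¹ 5ℚ) (0<unit⁻ k) , ev-map
    (λ i le → subst (ℚ._≤ seq (x v) i) (sym (ℚ.+-identityˡ (5ℚ ℚ.* unit⁻ k)))
      (ℚ.<⇒≤ (ℚ.≰⇒> λ small → ℚ.<-irrefl refl (ℚ.<-≤-trans 0<a
        (subst₂ ℚ._≤_ (ℚ.+-identityˡ a) (retract-kills (at x i) v small) le))))) ev

  retractᴿ-Within : ∀ x y δ → 0ℚ ℚ.≤ δ → Within δ x y → Within (lip k δ) (retractᴿ x) (retractᴿ y)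
  retractᴿ-Within x y δ 0≤δ h v = one x y (λ u → proj₁ (h u)) (λ u → proj₂ (h u)) , one y x (λ u → proj₂ (h u)) (λ u → proj₁ (h u))
    where
    one : ∀ x y → (∀ u → x u ≤ᴿ y u +ᴿ fromℚ δ) → (∀ u → y u ≤ᴿ x u +ᴿ fromℚ δ) → retractᴿ x v ≤ᴿ retractᴿ y v +ᴿ fromℚ (lip k δ)
    one x y h h' ε 0<ε = ev-map₂ {P = λ i → ∀ u → seq (x u) i ℚ.≤ seq (y u) i ℚ.+ δ ℚ.+ η}
                                 {Q = λ i → ∀ u → seq (y u) i ℚ.≤ seq (x u) i ℚ.+ δ ℚ.+ η} step
      (ev-all λ u → h u η 0<η) (ev-all λ u → h' u η 0<η)
      where
      η = lip⁻ k ε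

      0<η : 0ℚ ℚ.< η
      0<η = 0<lip⁻ k 0<ε

      absorb : ∀ r → r ℚ.+ lip k (δ ℚ.+ η) ℚ.≤ r ℚ.+ lip k δ ℚ.+ ε
      absorb r = ≤-by (ε ℚ.- lip k η)
        (solve 5 (λ r f d h e → (r :+ f :* (con 3ℚ :* d)) :+ e :=
                                (r :+ f :* (con 3ℚ :* (d :+ h))) :+ (e :- f :* (con 3ℚ :* h))) refl
          r (fromℕ k) δ η ε)
        (p≤q⇒0≤q-p (lip-lip⁻ k (ℚ.<⇒≤ 0<ε)))

      step : ∀ i → (∀ u → seq (x u) i ℚ.≤ seq (y u) i ℚ.+ δ ℚ.+ η) → (∀ u → seq (y u) i ℚ.≤ seq (x u) i ℚ.+ δ ℚ.+ η) →
             retract (at x i) v ℚ.≤ retract (at y i) v ℚ.+ lip k δ ℚ.+ ε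
      step i p q = ℚ.≤-trans
        (retract-lipschitz {D = δ ℚ.+ η} (at x i) (at y i) (0≤+ 0≤δ (ℚ.<⇒≤ 0<η))
          (λ u → subst (seq (x u) i ℚ.≤_) (ℚ.+-assoc (seq (y u) i) δ η) (p u))
          (λ u → subst (seq (y u) i ℚ.≤_) (ℚ.+-assoc (seq (x u) i) δ η) (q u)) v)
        (absorb (retract (at y i) v))

-- Gluing continuous maps

≤ᴿ-fromℚ : ∀ {x p q} → p ℚ.≤ q → x ≤ᴿ fromℚ p → x ≤ᴿ fromℚ q
≤ᴿ-fromℚ {x} {p} {q} p≤q h = ≤ᴿ-trans {x} {fromℚ p} {fromℚ q} h (fromℚ-mono p≤q)

Within-mono : ∀ {x y : Fin n → ℝ} {a b} → a ℚ.≤ b → Within a x y → Within b x y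
Within-mono {x = x} {y} {a} {b} a≤b h v = one (x v) (y v) (proj₁ (h v)) , one (y v) (x v) (proj₂ (h v))
  where
  one : ∀ x y → x ≤ᴿ y +ᴿ fromℚ a → x ≤ᴿ y +ᴿ fromℚ b
  one x y h = ≤ᴿ-trans {x} {y +ᴿ fromℚ a} {y +ᴿ fromℚ b} h
    (≤ᴿ-pointwise {y +ᴿ fromℚ a} {y +ᴿ fromℚ b} λ k → ℚ.+-monoʳ-≤ (seq y k) a≤b)

Within-≈ : ∀ {x y z : Fin n → ℝ} {a} → Within a x y → (∀ v → y v ≈ᴿ z v) → Within a x z
Within-≈ {x = x} {y} {z} {a} h y≈z v =
  ≤ᴿ-trans {x v} {y v +ᴿ fromℚ a} {z v +ᴿ fromℚ a} (proj₁ (h v))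
    (+ᴿ-mono {y v} {z v} {fromℚ a} {fromℚ a} (proj₁ (y≈z v)) (≤ᴿ-refl {fromℚ a})) ,
  ≤ᴿ-trans {z v} {y v} {x v +ᴿ fromℚ a} (proj₂ (y≈z v)) (proj₂ (h v))

-- Gluing a map on L with a map on one further simplex σ. Constructively one
-- cannot decide whether a point lies in L, so both maps are precomposed with
-- the retraction, which moves a neighbourhood of L into L.
module Glue (L L' : Complex m) (K : Complex n) (σ : Subset m)
  (new : ∀ τ → Face L' τ → Face L τ ⊎ τ ≡ σ) (σ∉L : ¬ Face L σ)
  (F : ContinuousMap L K) (G : ContinuousMap (fullSimplex σ) K)
  (compatible : ∀ x y → (∀ v → coord x v ≈ᴿ coord y v) → ∀ v → coord (apply F x) v ≈ᴿ coord (apply G y) v)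
  where

  e : ℚ
  e = unit⁻ m

  0<e : 0ℚ ℚ.< e
  0<e = 0<unit⁻ m

  retract-total : ∀ {L : Complex m} (x : ‖ L ‖) → sumᴿ (retractᴿ (coord x)) ≈ᴿ 1ᴿ
  retract-total x = retractᴿ-total (coord x) (proj₂ (total x))

  toL : ∀ x v → v ∈ σ → coord x v ≤ᴿ fromℚ (4ℚ ℚ.* e) → ‖ L ‖
  toL x v v∈σ small = record
    { coord   = retractᴿ (coord x)
    ; nonneg  = retractᴿ-nonneg (coord x)
    ; total   = retract-total {L'} x
    ; support = λ τ pos → [ id , (λ τ≡σ → ⊥-elim (≤0⇒≯0 {retractᴿ (coord x) v} (retractᴿ-kills (coord x) v small)
                                                  (pos (subst (v ∈_) (sym τ≡σ) v∈σ)))) ]′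
                  (new τ (support x τ λ {u} u∈τ → retractᴿ-positive (coord x) u (pos u∈τ)))
    }

  -- The coordinates in σ are positive, so any set of positive coordinates forms together with σ a
  -- face of L'. It is not a face of L and must therefore be σ itself.
  toσ : ∀ x → (∀ v → v ∈ σ → fromℚ e ≤ᴿ coord x v) → ‖ fullSimplex σ ‖
  toσ x large = record
    { coord   = retractᴿ (coord x)
    ; nonneg  = retractᴿ-nonneg (coord x)
    ; total   = retract-total {L'} x
    ; support = λ τ pos → [ (λ f → ⊥-elim (σ∉L (down-closed L (q⊆p∪q τ σ) f)))
                          , (λ eq u∈τ → subst (_ ∈_) eq (p⊆p∪q σ u∈τ)) ]′
                  (new (τ ∪ σ) (support x (τ ∪ σ) λ {u} u∈ →
                    [ (λ u∈τ → retractᴿ-positive (coord x) u (pos u∈τ))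
                    , (λ u∈σ → 0<ᴿ-intro {coord x u} 0<e (large u u∈σ)) ]′ (x∈p∪q⁻ τ σ u∈)))
    }

  -- The conditions overlap between e and 3 e, so approximations with error e can always decide for
  -- one of them. Points are movable into L up to 4 e, which leaves room for neighbours of a small
  -- point.
  Small Large Branch : ‖ L' ‖ → Set
  Small x = ∃[ v ] v ∈ σ × coord x v ≤ᴿ fromℚ (3ℚ ℚ.* e)
  Large x = ∀ v → v ∈ σ → fromℚ e ≤ᴿ coord x v
  Branch x = Small x ⊎ Large x

  branch : ∀ x → Branch x
  branch x = decide (any? λ v → (v ∈? σ) ×-dec (q v ℚ.≤? e ℚ.+ e))
    where
    q : Fin m → ℚ
    q v = proj₁ (approx (coord x v) e 0<e)

    decide : Dec (∃[ v ] v ∈ σ × q v ℚ.≤ e ℚ.+ e) → Branch x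
    decide (yes (v , v∈σ , q≤)) = inj₁ (v , v∈σ ,
      ≤ᴿ-fromℚ {coord x v} {q v ℚ.+ e} {3ℚ ℚ.* e}
        (≤-by (e ℚ.+ e ℚ.- q v) (solve 2 (λ q e → con 3ℚ :* e := (q :+ e) :+ (e :+ e :- q)) refl (q v) e) (p≤q⇒0≤q-p q≤))
        (proj₁ (proj₂ (approx (coord x v) e 0<e))))
    decide (no none) = inj₂ λ v v∈σ →
      ≤ᴿ-trans {fromℚ e} {fromℚ (q v ℚ.- e)} {coord x v}
        (fromℚ-mono (≤-by (q v ℚ.- (e ℚ.+ e)) (solve 2 (λ q e → q :- e := e :+ (q :- (e :+ e))) refl (q v) e)
          (p≤q⇒0≤q-p (ℚ.<⇒≤ (ℚ.≰⇒> λ q≤ → none (v , v∈σ , q≤))))))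
        (fromℚ-shift {coord x v} (q v) e (proj₂ (proj₂ (approx (coord x v) e 0<e))))

  3e≤4e : ∀ {x} → x ≤ᴿ fromℚ (3ℚ ℚ.* e) → x ≤ᴿ fromℚ (4ℚ ℚ.* e)
  3e≤4e {x} = ≤ᴿ-fromℚ {x} {3ℚ ℚ.* e} {4ℚ ℚ.* e}
    (≤-by e (solve 1 (λ e → con 4ℚ :* e := con 3ℚ :* e :+ e) refl e) (ℚ.<⇒≤ 0<e))

  smallPoint : ∀ x → Small x → ‖ L ‖
  smallPoint x (v , v∈σ , small) = toL x v v∈σ (3e≤4e {coord x v} small)

  go : ∀ x → Branch x → ‖ K ‖
  go x (inj₁ small) = apply F (smallPoint x small)
  go x (inj₂ large) = apply G (toσ x large)

  -- All choices of branch are allowed, since `branch` may send nearby and even equal points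
  -- different ways.
  modulus : ∀ ε → 0ℚ ℚ.< ε → ∃[ η ] 0ℚ ℚ.< η × (∀ x y bx by → Within η (coord x) (coord y) →
            Within ε (coord (go x bx)) (coord (go y by)))
  modulus ε 0<ε = η , 0<η , near
    where
    δF = proj₁ (continuous F ε 0<ε)
    δG = proj₁ (continuous G ε 0<ε)

    0<δF : 0ℚ ℚ.< δF
    0<δF = proj₁ (proj₂ (continuous F ε 0<ε))

    0<δG : 0ℚ ℚ.< δG
    0<δG = proj₁ (proj₂ (continuous G ε 0<ε))

    η : ℚ
    η = e ℚ.⊓ (lip⁻ m δF ℚ.⊓ lip⁻ m δG)

    0<⊓ : ∀ {a b} → 0ℚ ℚ.< a → 0ℚ ℚ.< b → 0ℚ ℚ.< a ℚ.⊓ b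
    0<⊓ {a} {b} 0<a 0<b with ℚ.⊓-sel a b
    ... | inj₁ eq = subst (0ℚ ℚ.<_) (sym eq) 0<a
    ... | inj₂ eq = subst (0ℚ ℚ.<_) (sym eq) 0<b

    0<η : 0ℚ ℚ.< η
    0<η = 0<⊓ 0<e (0<⊓ (0<lip⁻ m 0<δF) (0<lip⁻ m 0<δG))

    ρ-near : ∀ (x y : Fin m → ℝ) ζ → 0ℚ ℚ.< ζ → η ℚ.≤ lip⁻ m ζ → Within η x y → Within ζ (retractᴿ x) (retractᴿ y)
    ρ-near x y ζ 0<ζ η≤ h = Within-mono {x = retractᴿ x} {retractᴿ y} (lip-lip⁻ m (ℚ.<⇒≤ 0<ζ))
      (retractᴿ-Within x y (lip⁻ m ζ) (ℚ.<⇒≤ (0<lip⁻ m 0<ζ)) (Within-mono {x = x} {y} η≤ h))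

    ρF : ∀ (x y : Fin m → ℝ) → Within η x y → Within δF (retractᴿ x) (retractᴿ y)
    ρF x y = ρ-near x y δF 0<δF (ℚ.≤-trans (ℚ.p⊓q≤q e (lip⁻ m δF ℚ.⊓ lip⁻ m δG)) (ℚ.p⊓q≤p (lip⁻ m δF) (lip⁻ m δG)))

    ρG : ∀ (x y : Fin m → ℝ) → Within η x y → Within δG (retractᴿ x) (retractᴿ y)
    ρG x y = ρ-near x y δG 0<δG (ℚ.≤-trans (ℚ.p⊓q≤q e (lip⁻ m δF ℚ.⊓ lip⁻ m δG)) (ℚ.p⊓q≤q (lip⁻ m δF) (lip⁻ m δG)))

    -- The second point is within e of a small one, so it too can be moved into L, where
    -- compatibility identifies the values of F and G.
    mixed : ∀ x y small large → Within η (coord x) (coord y) →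
            Within ε (coord (go x (inj₁ small))) (coord (go y (inj₂ large)))
    mixed x y small@(v , v∈σ , x≤3e) large h = Within-≈
      {x = coord (go x (inj₁ small))} {coord (apply F y')} {coord (go y (inj₂ large))}
      (proj₂ (proj₂ (continuous F ε 0<ε)) (smallPoint x small) y' (ρF (coord x) (coord y) h))
      (compatible y' (toσ y large) λ u → ≈ᴿ-refl {retractᴿ (coord y) u})
      where
      y≤4e : coord y v ≤ᴿ fromℚ (4ℚ ℚ.* e)
      y≤4e = ≤ᴿ-trans {coord y v} {coord x v +ᴿ fromℚ e} {fromℚ (4ℚ ℚ.* e)}
        (proj₂ (Within-mono {x = coord x} {coord y} (ℚ.p⊓q≤p e (lip⁻ m δF ℚ.⊓ lip⁻ m δG)) h v))
        (≤ᴿ-trans {coord x v +ᴿ fromℚ e} {fromℚ (3ℚ ℚ.* e) +ᴿ fromℚ e} {fromℚ (4ℚ ℚ.* e)}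
          (+ᴿ-mono {coord x v} {fromℚ (3ℚ ℚ.* e)} {fromℚ e} {fromℚ e} x≤3e (≤ᴿ-refl {fromℚ e}))
          (≤ᴿ-pointwise {fromℚ (3ℚ ℚ.* e) +ᴿ fromℚ e} {fromℚ (4ℚ ℚ.* e)} λ _ →
            ℚ.≤-reflexive (solve 1 (λ e → con 3ℚ :* e :+ e := con 4ℚ :* e) refl e)))

      y' = toL y v v∈σ y≤4e

    near : ∀ x y bx by → Within η (coord x) (coord y) → Within ε (coord (go x bx)) (coord (go y by))
    near x y (inj₁ sx) (inj₁ sy) h = proj₂ (proj₂ (continuous F ε 0<ε)) (smallPoint x sx) (smallPoint y sy) (ρF (coord x) (coord y) h)
    near x y (inj₂ lx) (inj₂ ly) h = proj₂ (proj₂ (continuous G ε 0<ε)) (toσ x lx) (toσ y ly) (ρG (coord x) (coord y) h)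
    near x y (inj₁ sx) (inj₂ ly) h = mixed x y sx ly h
    near x y (inj₂ lx) (inj₁ sy) h = Within-sym {x = coord (go y (inj₁ sy))} {coord (go x (inj₂ lx))}
      (mixed y x sy lx (Within-sym {x = coord x} {coord y} h))

  glued : ContinuousMap L' K
  glued .apply x = go x (branch x)
  glued .continuous ε 0<ε = proj₁ (modulus ε 0<ε) , proj₁ (proj₂ (modulus ε 0<ε)) ,
    λ x y → proj₂ (proj₂ (modulus ε 0<ε)) x y (branch x) (branch y)

  glued-near-L : ∀ x v → v ∈ σ → coord x v ≤ᴿ 0ᴿ → (P : (Fin n → ℝ) → Set) →
                 (∀ (y : ‖ L ‖) → coord y ≡ retractᴿ (coord x) → P (coord (apply F y))) → P (coord (apply glued x))
  glued-near-L x v v∈σ x≤0 P h = from (branch x)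
    where
    from : ∀ b → P (coord (go x b))
    from (inj₁ small) = h (smallPoint x small) refl
    from (inj₂ large) = ⊥-elim (≤0⇒≯0 {coord x v} x≤0 (0<ᴿ-intro {coord x v} 0<e (large v v∈σ)))

-- Maps from a cone

-- A listing in increasing order, used to identify the simplex on `σ` with a standard simplex.
data Enumeration : Subset m → ℕ → Set where
  done : Enumeration [] 0
  skip : ∀ {σ : Subset m} {N} → Enumeration σ N → Enumeration (outside ∷ σ) N
  take : ∀ {σ : Subset m} {N} → Enumeration σ N → Enumeration (inside ∷ σ) (suc N)

enumerate : (σ : Subset m) → Enumeration σ ∣ σ ∣
enumerate []            = done
enumerate (outside ∷ σ) = skip (enumerate σ)
enumerate (inside ∷ σ)  = take (enumerate σ)

elem : ∀ {σ : Subset m} {N} → Enumeration σ N → Fin N → Fin m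
elem (skip E) i       = suc (elem E i)
elem (take E) zero    = zero
elem (take E) (suc i) = suc (elem E i)

elem∈ : ∀ {σ : Subset m} {N} (E : Enumeration σ N) i → elem E i ∈ σ
elem∈ (skip E) i       = there (elem∈ E i)
elem∈ (take E) zero    = here
elem∈ (take E) (suc i) = there (elem∈ E i)

index : ∀ {σ : Subset m} {N} (E : Enumeration σ N) {u} → u ∈ σ → ∃[ i ] elem E i ≡ u
index (skip E) (there u∈) = proj₁ (index E u∈) , cong suc (proj₂ (index E u∈))
index (take E) here       = zero , refl
index (take E) (there u∈) = suc (proj₁ (index E u∈)) , cong suc (proj₂ (index E u∈))

push : ∀ {σ : Subset m} {N} → Enumeration σ N → (Fin N → ℝ) → Fin m → ℝ
push (skip E) x zero    = 0ᴿ
push (skip E) x (suc u) = push E x u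
push (take E) x zero    = x zero
push (take E) x (suc u) = push E (x ∘ suc) u

push-elem : ∀ {σ : Subset m} {N} (E : Enumeration σ N) x i → push E x (elem E i) ≡ x i
push-elem (skip E) x i       = push-elem E x i
push-elem (take E) x zero    = refl
push-elem (take E) x (suc i) = push-elem E (x ∘ suc) i

push-off : ∀ {σ : Subset m} {N} (E : Enumeration σ N) x {u} → u ∉ σ → push E x u ≡ 0ᴿ
push-off (skip E) x {zero}  u∉ = refl
push-off (skip E) x {suc u} u∉ = push-off E x (u∉ ∘ there)
push-off (take E) x {zero}  u∉ = contradiction here u∉
push-off (take E) x {suc u} u∉ = push-off E (x ∘ suc) (u∉ ∘ there)

push-ind : ∀ {σ : Subset m} {N} (E : Enumeration σ N) x (P : Fin m → ℝ → Set) →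
           (∀ i → P (elem E i) (x i)) → (∀ {u} → u ∉ σ → P u 0ᴿ) → ∀ u → P u (push E x u)
push-ind {σ = σ} E x P on off u with u ∈? σ
... | no  u∉σ = subst (P u) (sym (push-off E x u∉σ)) (off u∉σ)
... | yes u∈σ with index E u∈σ
...   | i , refl = subst (P u) (sym (push-elem E x i)) (on i)

≤ᴿ-reflexive : ∀ {x y} → x ≡ y → x ≤ᴿ y
≤ᴿ-reflexive {x} refl = ≤ᴿ-refl {x}

sum-push : ∀ {σ : Subset m} {N} (E : Enumeration σ N) x → sumᴿ (push E x) ≈ᴿ sumᴿ x
sum-push done     x = ≈ᴿ-refl {0ᴿ}
sum-push (skip E) x = ≈ᴿ-trans {0ᴿ +ᴿ sumᴿ (push E x)} {sumᴿ (push E x)} {sumᴿ x}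
  (≤ᴿ-pointwise {0ᴿ +ᴿ sumᴿ (push E x)} {sumᴿ (push E x)} (λ k → ℚ.≤-reflexive (ℚ.+-identityˡ (seq (sumᴿ (push E x)) k))) ,
   ≤ᴿ-pointwise {sumᴿ (push E x)} {0ᴿ +ᴿ sumᴿ (push E x)} (λ k → ℚ.≤-reflexive (sym (ℚ.+-identityˡ (seq (sumᴿ (push E x)) k)))))
  (sum-push E x)
sum-push (take E) x =
  +ᴿ-mono {x zero} {x zero} {sumᴿ (push E (x ∘ suc))} {sumᴿ (x ∘ suc)} (≤ᴿ-refl {x zero}) (proj₁ (sum-push E (x ∘ suc))) ,
  +ᴿ-mono {x zero} {x zero} {sumᴿ (x ∘ suc)} {sumᴿ (push E (x ∘ suc))} (≤ᴿ-refl {x zero}) (proj₂ (sum-push E (x ∘ suc)))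

module _ {σ : Subset m} {N} (E : Enumeration σ N) (y : ‖ fullSimplex σ ‖) where

  off-simplex : ∀ {u} → u ∉ σ → coord y u ≈ᴿ 0ᴿ
  off-simplex {u} u∉σ = ≯0⇒≤0 {coord y u} (λ 0<y → u∉σ (support y ⁅ u ⁆
    (λ v∈u → subst (λ v → 0ᴿ <ᴿ coord y v) (sym (x∈⁅y⁆⇒x≡y u v∈u)) 0<y) (x∈⁅x⁆ u))) , nonneg y u

  push-pull : ∀ u → coord y u ≈ᴿ push E (coord y ∘ elem E) u
  push-pull = push-ind E (coord y ∘ elem E) (λ u r → coord y u ≈ᴿ r) (λ i → ≈ᴿ-refl {coord y (elem E i)}) off-simplex

  sum-pull : sumᴿ (coord y ∘ elem E) ≈ᴿ 1ᴿ
  sum-pull = ≈ᴿ-trans {sumᴿ (coord y ∘ elem E)} {sumᴿ (push E (coord y ∘ elem E))} {1ᴿ}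
    (≈ᴿ-sym {sumᴿ (push E (coord y ∘ elem E))} {sumᴿ (coord y ∘ elem E)} (sum-push E (coord y ∘ elem E)))
    (≈ᴿ-trans {sumᴿ (push E (coord y ∘ elem E))} {sumᴿ (coord y)} {1ᴿ}
      (≈ᴿ-sym {sumᴿ (coord y)} {sumᴿ (push E (coord y ∘ elem E))} (sumᴿ-cong (coord y) (push E (coord y ∘ elem E)) push-pull))
      (total y))

sum₁ : (x : Fin 1 → ℝ) → sumᴿ x ≈ᴿ x zero
sum₁ x = ≤ᴿ-pointwise {sumᴿ x} {x zero} (λ k → ℚ.≤-reflexive (ℚ.+-identityʳ (seq (x zero) k))) ,
         ≤ᴿ-pointwise {x zero} {sumᴿ x} (λ k → ℚ.≤-reflexive (sym (ℚ.+-identityʳ (seq (x zero) k))))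

vertexPoint : (K : Complex n) (w : Fin n) → Face K ⁅ w ⁆ → ‖ K ‖
vertexPoint K w f = record
  { coord   = push E one
  ; nonneg  = push-ind E one (λ _ r → 0ᴿ ≤ᴿ r) (λ _ → fromℚ-mono 0≤1) (λ _ → ≤ᴿ-refl {0ᴿ})
  ; total   = ≈ᴿ-trans {sumᴿ (push E one)} {sumᴿ one} {1ᴿ} (sum-push E one) (sum₁ one)
  ; support = λ τ pos → down-closed K (λ u∈τ → on-vertex (pos u∈τ)) f
  }
  where
  one : Fin 1 → ℝ
  one _ = 1ᴿ

  E : Enumeration ⁅ w ⁆ 1
  E = subst (Enumeration ⁅ w ⁆) (∣⁅x⁆∣≡1 w) (enumerate ⁅ w ⁆)

  on-vertex : ∀ {u} → 0ᴿ <ᴿ push E one u → u ∈ ⁅ w ⁆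
  on-vertex {u} pos with u ∈? ⁅ w ⁆
  ... | yes u∈w = u∈w
  ... | no  u∉w = ⊥-elim (≤0⇒≯0 {push E one u} (≤ᴿ-reflexive (push-off E one u∉w)) pos)

Compatible : {L : Complex m} {K : Complex n} {σ : Subset m} → ContinuousMap L K → ContinuousMap (fullSimplex σ) K → Set
Compatible F G = ∀ x y → (∀ v → coord x v ≈ᴿ coord y v) → ∀ v → coord (apply F x) v ≈ᴿ coord (apply G y) v

module _ {L : Complex m} {K : Complex n} {σ : Subset m}
  (boundary : ∀ τ → τ ⊆ σ → τ ≢ σ → Face L τ) (σ∉L : ¬ Face L σ) (F : ContinuousMap L K) where

  -- The boundary of σ lies in L, so F gives a map from a sphere, which the connectivity of K
  -- extends over σ.
  extend-over : ∀ N → ConnectedAt homotopical K N → Enumeration σ (suc N) →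
                Σ[ G ∈ ContinuousMap (fullSimplex σ) K ] Compatible {L = L} {K} {σ} F G
  -- A one-element σ has empty boundary: a common point would have σ in its support and make it a
  -- face of L.
  extend-over zero (w , f) E = G , λ x y x≈y → ⊥-elim (σ∉L (support x σ λ {u} u∈σ →
      <ᴿ-≤ᴿ-trans {coord y u} {coord x u} (positive y u∈σ) (proj₂ (x≈y u))))
    where
    G : ContinuousMap (fullSimplex σ) K
    G .apply _ = vertexPoint K w f
    G .continuous ε 0<ε = ε , 0<ε , λ x y _ →
      ≈⇒Within {x = coord (vertexPoint K w f)} {coord (vertexPoint K w f)} (ℚ.<⇒≤ 0<ε)
        λ v → ≈ᴿ-refl {coord (vertexPoint K w f) v}

    positive : ∀ y {u} → u ∈ σ → 0ᴿ <ᴿ coord y u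
    positive y u∈σ with index E u∈σ
    ... | zero , refl = 0<ᴿ-intro {coord y (elem E zero)} (ℚ.positive⁻¹ 1ℚ)
      (≤ᴿ-trans {1ᴿ} {sumᴿ (coord y ∘ elem E)} {coord y (elem E zero)} (proj₂ (sum-pull E y)) (proj₁ (sum₁ (coord y ∘ elem E))))
  extend-over (suc j) spheres E = G , compatible
    where
    pushPoint : ‖ ∂Δ (suc j) ‖ → ‖ L ‖
    pushPoint x = record
      { coord   = push E (coord x)
      ; nonneg  = push-ind E (coord x) (λ _ r → 0ᴿ ≤ᴿ r) (nonneg x) (λ _ → ≤ᴿ-refl {0ᴿ})
      ; total   = ≈ᴿ-trans {sumᴿ (push E (coord x))} {sumᴿ (coord x)} {1ᴿ} (sum-push E (coord x)) (total x)
      ; support = λ τ pos → boundary τ (inside-σ τ pos) λ τ≡σ → proj₂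
          (support x ⊤ λ {i} _ → subst (0ᴿ <ᴿ_) (push-elem E (coord x) i) (pos (subst (elem E i ∈_) (sym τ≡σ) (elem∈ E i))))
          ∈⊤
      }
      where
      inside-σ : ∀ τ → (∀ {u} → u ∈ τ → 0ᴿ <ᴿ push E (coord x) u) → τ ⊆ σ
      inside-σ τ pos {u} u∈τ with u ∈? σ
      ... | yes u∈σ = u∈σ
      ... | no  u∉σ = ⊥-elim (≤0⇒≯0 {push E (coord x) u} (≤ᴿ-reflexive (push-off E (coord x) u∉σ)) (pos u∈τ))

    push-Within : ∀ {a} (x y : Fin (suc (suc j)) → ℝ) → 0ℚ ℚ.≤ a → Within a x y → Within a (push E x) (push E y)
    push-Within {a} x y 0≤a h = push-ind E x (λ u r → r ≤ᴿ push E y u +ᴿ fromℚ a × push E y u ≤ᴿ r +ᴿ fromℚ a)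
      (λ i → subst (λ r → x i ≤ᴿ r +ᴿ fromℚ a × r ≤ᴿ x i +ᴿ fromℚ a) (sym (push-elem E y i)) (h i))
      (λ u∉σ → subst (λ r → 0ᴿ ≤ᴿ r +ᴿ fromℚ a × r ≤ᴿ 0ᴿ +ᴿ fromℚ a) (sym (push-off E y u∉σ))
        (≤ᴿ-+-weaken {0ᴿ} {0ᴿ} 0≤a (≤ᴿ-refl {0ᴿ}) , ≤ᴿ-+-weaken {0ᴿ} {0ᴿ} 0≤a (≤ᴿ-refl {0ᴿ})))

    f : ContinuousMap (∂Δ (suc j)) K
    f .apply x = apply F (pushPoint x)
    f .continuous ε 0<ε with continuous F ε 0<ε
    ... | η , 0<η , h = η , 0<η , λ x y near →
      h (pushPoint x) (pushPoint y) (push-Within (coord x) (coord y) (ℚ.<⇒≤ 0<η) near)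

    g : ContinuousMap (Δ (suc j)) K
    g = proj₁ (spheres f)

    pullPoint : ‖ fullSimplex σ ‖ → ‖ Δ (suc j) ‖
    pullPoint y = record
      { coord = coord y ∘ elem E ; nonneg = nonneg y ∘ elem E ; total = sum-pull E y ; support = λ _ _ → _ }

    G : ContinuousMap (fullSimplex σ) K
    G .apply y = apply g (pullPoint y)
    G .continuous ε 0<ε with continuous g ε 0<ε
    ... | η , 0<η , h = η , 0<η , λ x y near → h (pullPoint x) (pullPoint y) (near ∘ elem E)

    compatible : Compatible {L = L} {K} {σ} F G
    compatible x y x≈y v = ≈ᴿ-trans {coord (apply F x) v} {coord (apply f p) v} {coord (apply G y) v}
      (map-respects F x (pushPoint p) (λ u → ≈ᴿ-trans {coord x u} {coord y u} {coord (pushPoint p) u} (x≈y u) (push-pull E y u)) v)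
      (≈ᴿ-trans {coord (apply f p) v} {coord (apply g (∂Δ⊆Δ p)) v} {coord (apply G y) v}
        (≈ᴿ-sym {coord (apply g (∂Δ⊆Δ p)) v} {coord (apply f p) v} (proj₂ (spheres f) p v))
        (map-respects g (∂Δ⊆Δ p) (pullPoint y) (λ i → ≈ᴿ-refl {coord y (elem E i)}) v))
      where
      missing : ∀ τ → (∀ {i} → i ∈ τ → 0ᴿ <ᴿ coord y (elem E i)) → Face (∂Δ (suc j)) τ
      missing τ pos with any? (λ i → ¬? (i ∈? τ))
      ... | yes found = found
      ... | no  none  = ⊥-elim (σ∉L (support x σ λ {u} u∈σ → <ᴿ-≤ᴿ-trans {coord y u} {coord x u} (positive u∈σ) (proj₂ (x≈y u))))
        where
        positive : ∀ {u} → u ∈ σ → 0ᴿ <ᴿ coord y u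
        positive u∈σ with index E u∈σ
        ... | i , refl with i ∈? τ
        ...   | yes i∈τ = pos i∈τ
        ...   | no  i∉τ = contradiction (i , i∉τ) none

      p : ‖ ∂Δ (suc j) ‖
      p = record { coord = coord y ∘ elem E ; nonneg = nonneg y ∘ elem E ; total = sum-pull E y ; support = missing }

restrict : {L L' : Complex m} {K : Complex n} → (∀ τ → Face L' τ → Face L τ) → ContinuousMap L K → ContinuousMap L' K
restrict {m} {n} {L} {L'} sub F = record { apply = apply F ∘ include ; continuous = cont }
  where
  include : ‖ L' ‖ → ‖ L ‖
  include x = record { coord = coord x ; nonneg = nonneg x ; total = total x ; support = λ τ pos → sub τ (support x τ pos) }

  cont : ∀ ε → 0ℚ ℚ.< ε → _
  cont ε 0<ε = proj₁ (continuous F ε 0<ε) , proj₁ (proj₂ (continuous F ε 0<ε)) ,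
    λ x y → proj₂ (proj₂ (continuous F ε 0<ε)) (include x) (include y)

-- The union of K and the cone over K ∩ Q; the apex is the vertex zero.
cone : Complex n → Complex n → Complex (suc n)
cone K Q .Face (outside ∷ τ) = Face K τ
cone K Q .Face (inside ∷ τ)  = Face K τ × Face Q τ
cone K Q .face? (outside ∷ τ) = face? K τ
cone K Q .face? (inside ∷ τ)  = face? K τ ×-dec face? Q τ
cone K Q .down-closed {outside ∷ σ} {outside ∷ τ} τ⊆σ f       = down-closed K (drop-∷-⊆ τ⊆σ) f
cone K Q .down-closed {outside ∷ σ} {inside ∷ τ}  τ⊆σ f       = contradiction (τ⊆σ here) λ ()
cone K Q .down-closed {inside ∷ σ}  {outside ∷ τ} τ⊆σ (f , _) = down-closed K (out-in τ⊆σ) f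
  where
  out-in : ∀ {σ τ : Subset n} → (outside ∷ τ) ⊆ (inside ∷ σ) → τ ⊆ σ
  out-in h x∈τ = drop-there (h (there x∈τ))
cone K Q .down-closed {inside ∷ σ}  {inside ∷ τ}  τ⊆σ (f , g) =
  down-closed K (drop-∷-⊆ τ⊆σ) f , down-closed Q (drop-∷-⊆ τ⊆σ) g

-- The list admits the simplices of size s one at a time, so that consecutive cones differ by at
-- most one simplex.
skeleton : ℕ → List (Subset n) → Complex n
skeleton s l .Face τ = ∣ τ ∣ ℕ.< s ⊎ (∣ τ ∣ ≡ s × τ List.∈ l)
skeleton s l .face? τ = (∣ τ ∣ ℕ.<? s) ⊎-dec ((∣ τ ∣ ℕ.≟ s) ×-dec DecMembership._∈?_ _≟ˢ_ τ l)
skeleton s l .down-closed τ⊆σ (inj₁ lt) = inj₁ (ℕ.≤-<-trans (p⊆q⇒∣p∣≤∣q∣ τ⊆σ) lt)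
skeleton s l .down-closed {σ} {τ} τ⊆σ (inj₂ (eq , σ∈l)) with ∣ τ ∣ ℕ.<? s
... | yes lt = inj₁ lt
... | no  ge = inj₂ (ℕ.≤-antisym (subst (∣ τ ∣ ≤_) eq (p⊆q⇒∣p∣≤∣q∣ τ⊆σ)) (ℕ.≮⇒≥ ge) ,
                     subst (List._∈ l) (sym (p⊆q∧∣q∣≤∣p∣⇒p≡q τ⊆σ (subst (_≤ ∣ τ ∣) (sym eq) (ℕ.≮⇒≥ ge)))) σ∈l)

-- A map from the partial cone whose restriction to the base does not enlarge supports.
record ConeMap (K Q : Complex n) : Set where
  field
    map     : ContinuousMap (cone K Q) K
    on-base : ∀ x → coord x zero ≤ᴿ 0ᴿ → ∀ v → coord x (suc v) ≤ᴿ 0ᴿ → coord (apply map x) v ≤ᴿ 0ᴿ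

open ConeMap

module _ (K : Complex n) where

  coneMap-restrict : {Q Q' : Complex n} → (∀ τ → Face K τ → Face Q' τ → Face Q τ) → ConeMap K Q → ConeMap K Q'
  coneMap-restrict {Q} {Q'} sub F = record
    { map     = restrict {L = cone K Q} {cone K Q'} {K} sub' (map F)
    ; on-base = λ x → on-base F _ }
    where
    sub' : ∀ τ → Face (cone K Q') τ → Face (cone K Q) τ
    sub' (outside ∷ τ) f       = f
    sub' (inside ∷ τ)  (f , g) = f , sub τ f g

  -- If `Q` has no faces, the apex belongs to no face of the cone. Its coordinate is 0 at every
  -- point, and dropping it gives a point of `K`.
  coneMap-empty : {Q : Complex n} → (∀ τ → ¬ Face Q τ) → ConeMap K Q
  coneMap-empty {Q} empty = record { map = record { apply = project ; continuous = λ ε 0<ε → ε , 0<ε , λ x y h v → h (suc v) }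
                                   ; on-base = λ x _ v h → h }
    where
    project : ‖ cone K Q ‖ → ‖ K ‖
    project x = record
      { coord   = coord x ∘ suc
      ; nonneg  = nonneg x ∘ suc
      ; total   = ≈ᴿ-trans {sumᴿ (coord x ∘ suc)} {sumᴿ (coord x)} {1ᴿ}
          (≤ᴿ-trans {sumᴿ (coord x ∘ suc)} {0ᴿ +ᴿ sumᴿ (coord x ∘ suc)} {sumᴿ (coord x)}
             (≤ᴿ-pointwise {sumᴿ (coord x ∘ suc)} {0ᴿ +ᴿ sumᴿ (coord x ∘ suc)} λ k → ℚ.≤-reflexive (sym (ℚ.+-identityˡ (rest k))))
             (+ᴿ-mono {0ᴿ} {coord x zero} {sumᴿ (coord x ∘ suc)} {sumᴿ (coord x ∘ suc)} (nonneg x zero) (≤ᴿ-refl {sumᴿ (coord x ∘ suc)})) ,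
           ≤ᴿ-trans {sumᴿ (coord x)} {0ᴿ +ᴿ sumᴿ (coord x ∘ suc)} {sumᴿ (coord x ∘ suc)}
             (+ᴿ-mono {coord x zero} {0ᴿ} {sumᴿ (coord x ∘ suc)} {sumᴿ (coord x ∘ suc)} apex≤0 (≤ᴿ-refl {sumᴿ (coord x ∘ suc)}))
             (≤ᴿ-pointwise {0ᴿ +ᴿ sumᴿ (coord x ∘ suc)} {sumᴿ (coord x ∘ suc)} λ k → ℚ.≤-reflexive (ℚ.+-identityˡ (rest k))))
          (total x)
      ; support = λ τ pos → support x (outside ∷ τ) λ { (there u∈τ) → pos u∈τ }
      }
      where
      rest : ℕ → ℚ
      rest k = seq (sumᴿ (coord x ∘ suc)) k

      apex≤0 : coord x zero ≤ᴿ 0ᴿ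
      apex≤0 = ≯0⇒≤0 {coord x zero} λ 0<x → empty ⊥ (proj₂ (support x ⁅ zero ⁆ λ u∈ →
        subst (λ u → 0ᴿ <ᴿ coord x u) (sym (x∈⁅y⁆⇒x≡y zero u∈)) 0<x))

  -- The simplex on the apex and `τ` has s + 1 vertices and its boundary is already present, so
  -- connectivity at index s is what extends the map.
  coneMap-add : ∀ {s l} τ → Face K τ → ∣ τ ∣ ≡ s → ¬ (τ List.∈ l) → ConnectedAt homotopical K s →
                ConeMap K (skeleton s l) → ConeMap K (skeleton s (τ ∷ l))
  coneMap-add {s} {l} τ fτ size τ∉l conn F = record { map = G.glued ; on-base = base }
    where
    σ = inside ∷ τ

    new : ∀ ρ → Face (cone K (skeleton s (τ ∷ l))) ρ → Face (cone K (skeleton s l)) ρ ⊎ ρ ≡ σ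
    new (outside ∷ ρ) f                              = inj₁ f
    new (inside ∷ ρ)  (f , inj₁ lt)                  = inj₁ (f , inj₁ lt)
    new (inside ∷ ρ)  (f , inj₂ (eq , here ρ≡τ))     = inj₂ (cong (inside ∷_) ρ≡τ)
    new (inside ∷ ρ)  (f , inj₂ (eq , there ρ∈l))    = inj₁ (f , inj₂ (eq , ρ∈l))

    σ∉ : ¬ Face (cone K (skeleton s l)) σ
    σ∉ (_ , inj₁ lt)        = ℕ.<-irrefl size lt
    σ∉ (_ , inj₂ (_ , τ∈l)) = τ∉l τ∈l

    boundary : ∀ ρ → ρ ⊆ σ → ρ ≢ σ → Face (cone K (skeleton s l)) ρ
    boundary (outside ∷ ρ) ρ⊆σ _   = down-closed K (λ x∈ρ → drop-there (ρ⊆σ (there x∈ρ))) fτ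
    boundary (inside ∷ ρ)  ρ⊆σ ρ≢σ = down-closed K (drop-∷-⊆ ρ⊆σ) fτ , inj₁ (subst (∣ ρ ∣ ℕ.<_) size
      (ℕ.≰⇒> λ τ≤ρ → ρ≢σ (cong (inside ∷_) (p⊆q∧∣q∣≤∣p∣⇒p≡q (drop-∷-⊆ ρ⊆σ) τ≤ρ))))

    extension = extend-over {L = cone K (skeleton s l)} {K} {σ} boundary σ∉ (map F) s conn
                  (take (subst (Enumeration τ) size (enumerate τ)))

    module G = Glue (cone K (skeleton s l)) (cone K (skeleton s (τ ∷ l))) K σ new σ∉ (map F)
                    (proj₁ extension) (proj₂ extension)

    base : ∀ x → coord x zero ≤ᴿ 0ᴿ → ∀ v → coord x (suc v) ≤ᴿ 0ᴿ → coord (apply G.glued x) v ≤ᴿ 0ᴿ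
    base x x₀≤0 v xᵥ≤0 = G.glued-near-L x zero here x₀≤0 (λ r → r v ≤ᴿ 0ᴿ) λ y y≡ →
      on-base F y (small y y≡ zero x₀≤0) v (small y y≡ (suc v) xᵥ≤0)
      where
      -- The retraction keeps zero coordinates at zero, so the property of `F` applies to the moved
      -- point.
      small : ∀ (y : ‖ cone K (skeleton s l) ‖) → coord y ≡ retractᴿ (coord x) → ∀ u → coord x u ≤ᴿ 0ᴿ → coord y u ≤ᴿ 0ᴿ
      small y y≡ u x≤0 = subst (λ r → r u ≤ᴿ 0ᴿ) (sym y≡) (retractᴿ-kills (coord x) u
        (≤ᴿ-fromℚ {coord x u} {0ℚ} {4ℚ ℚ.* unit⁻ (suc n)} (ℚ.<⇒≤ (0<* (ℚ.positive⁻¹ 4ℚ) (0<unit⁻ (suc n)))) x≤0))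

  coneMap : ∀ s → (∀ i → i ℕ.< s → ConnectedAt homotopical K i) → ConeMap K (skeleton s [])
  coneMap zero    conn = coneMap-empty λ { τ (inj₁ ()) ; τ (inj₂ (_ , ())) }
  coneMap (suc s) conn = coneMap-restrict (λ τ _ → λ { (inj₁ lt) → level τ (ℕ.≤-pred lt) ; (inj₂ (_ , ())) })
                                          (add-all (subsets n))
    where
    level : ∀ τ → ∣ τ ∣ ≤ s → Face (skeleton s (subsets n)) τ
    level τ τ≤s with ∣ τ ∣ ℕ.<? s
    ... | yes lt = inj₁ lt
    ... | no  ge = inj₂ (ℕ.≤-antisym τ≤s (ℕ.≮⇒≥ ge) , ∈-subsets τ)

    add-all : ∀ l → ConeMap K (skeleton s l)
    add-all []      = coneMap s λ i i<s → conn i (ℕ.m≤n⇒m≤1+n i<s)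
    add-all (τ ∷ l) = add (face? K τ) (∣ τ ∣ ℕ.≟ s) (DecMembership._∈?_ _≟ˢ_ τ l)
      where
      smaller : (Face K τ → ∣ τ ∣ ≡ s → τ List.∈ l) → ConeMap K (skeleton s (τ ∷ l))
      smaller old = coneMap-restrict
        (λ { ρ _ (inj₁ lt) → inj₁ lt
           ; ρ f (inj₂ (eq , here refl)) → inj₂ (eq , old f eq)
           ; ρ _ (inj₂ (eq , there ρ∈l)) → inj₂ (eq , ρ∈l) })
        (add-all l)

      add : Dec (Face K τ) → Dec (∣ τ ∣ ≡ s) → Dec (τ List.∈ l) → ConeMap K (skeleton s (τ ∷ l))
      add (yes f) (yes eq) (no τ∉l)  = coneMap-add τ f eq τ∉l (conn s ℕ.≤-refl) (add-all l)
      add (yes _) (yes _)  (yes τ∈l) = smaller λ _ _ → τ∈l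
      add (yes _) (no neq) _         = smaller λ _ eq → contradiction eq neq
      add (no ¬f) _        _         = smaller λ f → contradiction f ¬f

-- From homotopy to homology

basisPoint : ∀ {k} → Fin k → Point k
basisPoint zero    zero    = 1ℚ
basisPoint zero    (suc u) = 0ℚ
basisPoint (suc v) zero    = 0ℚ
basisPoint (suc v) (suc u) = basisPoint v u

sum-0 : ∀ k → sum {k} (λ _ → 0ℚ) ≡ 0ℚ
sum-0 zero    = refl
sum-0 (suc k) = trans (ℚ.+-identityˡ (sum {k} λ _ → 0ℚ)) (sum-0 k)

sum-basisPoint : ∀ {k} (v : Fin k) → sum (basisPoint v) ≡ 1ℚ
sum-basisPoint {suc k} zero    = cong (1ℚ ℚ.+_) (sum-0 k)
sum-basisPoint {suc k} (suc v) = trans (ℚ.+-identityˡ (sum (basisPoint v))) (sum-basisPoint v)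

0≤basisPoint : ∀ {k} (v u : Fin k) → 0ℚ ℚ.≤ basisPoint v u
0≤basisPoint zero    zero    = 0≤1
0≤basisPoint zero    (suc u) = ℚ.≤-refl
0≤basisPoint (suc v) zero    = ℚ.≤-refl
0≤basisPoint (suc v) (suc u) = 0≤basisPoint v u

basisPoint≤1 : ∀ {k} (v u : Fin k) → basisPoint v u ℚ.≤ 1ℚ
basisPoint≤1 zero    zero    = ℚ.≤-refl
basisPoint≤1 zero    (suc u) = 0≤1
basisPoint≤1 (suc v) zero    = 0≤1
basisPoint≤1 (suc v) (suc u) = basisPoint≤1 v u

basisPoint-off : ∀ {k} (v u : Fin k) → v ≢ u → basisPoint v u ≡ 0ℚ
basisPoint-off zero    zero    v≢u = contradiction refl v≢u
basisPoint-off zero    (suc u) v≢u = refl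
basisPoint-off (suc v) zero    v≢u = refl
basisPoint-off (suc v) (suc u) v≢u = basisPoint-off v u (v≢u ∘ cong suc)

basisPoint-near : ∀ {k} (v w : Fin k) → Near 1ℚ (basisPoint v) (basisPoint w)
basisPoint-near v w u = ℚ.≤-trans (basisPoint≤1 v u)
  (≤-by (basisPoint w u) (ℚ.+-comm (basisPoint w u) 1ℚ) (0≤basisPoint w u))

sum-mid : ∀ {k} (p q : Point k) → sum (mid p q) ≡ ½ ℚ.* (sum p ℚ.+ sum q)
sum-mid {zero}  p q = refl
sum-mid {suc k} p q = trans (cong (mid p q zero ℚ.+_) (sum-mid (p ∘ suc) (q ∘ suc)))
  (solve 4 (λ a b s t → con ½ :* (a :+ b) :+ con ½ :* (s :+ t) := con ½ :* ((a :+ s) :+ (b :+ t))) refl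
    (p zero) (q zero) (sum (p ∘ suc)) (sum (q ∘ suc)))

In : ∀ {k} → Subset k → Point k → Set
In S p = (∀ v → 0ℚ ℚ.≤ p v) × sum p ≡ 1ℚ × (∀ v → v ∉ S → p v ≡ 0ℚ)

In-convex : ∀ {k} (S : Subset k) → Convex (In S)
In-convex S {p} {q} (p≥0 , ∑p , p-off) (q≥0 , ∑q , q-off) =
  (λ v → 0≤* 0≤½ (0≤+ (p≥0 v) (q≥0 v))) ,
  trans (sum-mid p q) (cong₂ (λ a b → ½ ℚ.* (a ℚ.+ b)) ∑p ∑q) ,
  λ v v∉S → cong₂ (λ a b → ½ ℚ.* (a ℚ.+ b)) (p-off v v∉S) (q-off v v∉S)

In-basisPoint : ∀ {k} {S : Subset k} {v} → v ∈ S → In S (basisPoint v)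
In-basisPoint {S = S} {v} v∈S = 0≤basisPoint v , sum-basisPoint v ,
  λ u u∉S → basisPoint-off v u λ v≡u → u∉S (subst (_∈ S) v≡u v∈S)

-- Halving the target at each coordinate yields `2⁻ k` where averaging would yield 1/k.
pigeonhole : ∀ {k} s (p : Point k) → 0ℚ ℚ.< s → s ℚ.≤ sum p → ∃[ v ] 2⁻ k ℚ.* s ℚ.≤ p v
pigeonhole {zero}  s p 0<s s≤ = contradiction (ℚ.<-≤-trans 0<s s≤) (ℚ.<-irrefl refl)
pigeonhole {suc k} s p 0<s s≤ = decide (½ ℚ.* s ℚ.≤? p zero)
  where
  rest : ∀ a r → ¬ (½ ℚ.* s ℚ.≤ a) → s ℚ.≤ a ℚ.+ r → ½ ℚ.* s ℚ.≤ r
  rest a r ½s≰a s≤a+r = ≤-by ((½ ℚ.* s ℚ.- a) ℚ.+ (a ℚ.+ r ℚ.- s))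
    (solve 3 (λ s a r → r := con ½ :* s :+ ((con ½ :* s :- a) :+ (a :+ r :- s))) refl s a r)
    (0≤+ (p≤q⇒0≤q-p (ℚ.<⇒≤ (ℚ.≰⇒> ½s≰a))) (p≤q⇒0≤q-p s≤a+r))

  decide : Dec (½ ℚ.* s ℚ.≤ p zero) → ∃[ v ] 2⁻ (suc k) ℚ.* s ℚ.≤ p v
  decide (yes ½s≤) = zero , ℚ.≤-trans
    (≤-by (½ ℚ.* ((1ℚ ℚ.- 2⁻ k) ℚ.* s))
      (solve 2 (λ h s → con ½ :* s := con ½ :* h :* s :+ con ½ :* ((con 1ℚ :- h) :* s)) refl (2⁻ k) s)
      (0≤* 0≤½ (0≤* (p≤q⇒0≤q-p (2⁻≤1 k)) (ℚ.<⇒≤ 0<s)))) ½s≤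
  decide (no ½s≰) = suc (proj₁ found) , subst (ℚ._≤ p (suc (proj₁ found)))
    (solve 2 (λ h s → h :* (con ½ :* s) := con ½ :* h :* s) refl (2⁻ k) s) (proj₂ found)
    where
    found = pigeonhole (½ ℚ.* s) (p ∘ suc) (0<½* 0<s) (rest (p zero) (sum (p ∘ suc)) ½s≰ s≤)

-- An approximant with sum at least ½ has a coordinate of at least `2⁻ n` ½; half of this is given
-- up to the error of approximation.
θ : ℕ → ℚ
θ n = ½ ℚ.* (2⁻ n ℚ.* ½)

0<θ : ∀ n → 0ℚ ℚ.< θ n
0<θ n = 0<½* (0<* (0<2⁻ n) 0<½)

large-coordinate : {K : Complex n} (y : ‖ K ‖) → ∃[ v ] fromℚ (θ n) ≤ᴿ coord y v
large-coordinate {n} y = v , ≤ᴿ-trans {fromℚ (θ n)} {fromℚ (seq (coord y v) N ℚ.- θ n)} {coord y v}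
  (fromℚ-mono (≤-by (seq (coord y v) N ℚ.- 2⁻ n ℚ.* ½)
    (solve 2 (λ x h → x :- con ½ :* h := con ½ :* h :+ (x :- h)) refl (seq (coord y v) N) (2⁻ n ℚ.* ½))
    (p≤q⇒0≤q-p large)))
  (fromℚ-shift {coord y v} (seq (coord y v) N) (θ n)
    (≤ᴿ-eventually {fromℚ (seq (coord y v) N)} {coord y v +ᴿ fromℚ (θ n)}
      (N , λ i N≤i → proj₂ modulus N i (ℕ.m≤m⊔n N₁ N₂) (ℕ.≤-trans (ℕ.m≤m⊔n N₁ N₂) N≤i) v)))
  where
  modulus = cauchy-all (coord y) (θ n) (0<θ n)
  big = proj₂ (total y) ½ 0<½
  N₁ = proj₁ modulus
  N₂ = proj₁ big
  N = N₁ ℕ.⊔ N₂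

  ½≤sum : ½ ℚ.≤ sum (λ v → seq (coord y v) N)
  ½≤sum = subst (½ ℚ.≤_) (seq-sum (coord y) N) (≤-by (seq (sumᴿ (coord y)) N ℚ.+ ½ ℚ.- 1ℚ)
    (solve 1 (λ s → s := con ½ :+ (s :+ con ½ :- con 1ℚ)) refl (seq (sumᴿ (coord y)) N))
    (p≤q⇒0≤q-p (proj₂ big N (ℕ.m≤n⊔m N₁ N₂))))

  found = pigeonhole ½ (λ v → seq (coord y v) N) 0<½ ½≤sum
  v = proj₁ found

  large : 2⁻ n ℚ.* ½ ℚ.≤ seq (coord y v) N
  large = proj₂ found

-- The rational Hurewicz theorem: z is filled by the simplicial approximation of
-- a map from the cone over z, which is a Sperner labelling on the base.
module Hurewicz (K : Complex n) (j : ℕ) (conn : ∀ i → i ℕ.< suc (suc j) → ConnectedAt homotopical K i) where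

  private
    L : Complex (suc n)
    L = cone K (skeleton (suc (suc j)) [])

    F : ConeMap K (skeleton (suc (suc j)) [])
    F = coneMap K (suc (suc j)) conn

    v₀ : Fin n
    v₀ = proj₁ (conn 0 (ℕ.s≤s ℕ.z≤n))

    positive? : ∀ (p : Point (suc n)) v → Dec (0ℚ ℚ.< p v)
    positive? p v = 0ℚ ℚ.<? p v

    Valid : Point (suc n) → Set
    Valid p = (∀ v → 0ℚ ℚ.≤ p v) × sum p ≡ 1ℚ × Face L (comprehension (positive? p))

    valid? : ∀ p → Dec (Valid p)
    valid? p = all? (λ v → 0ℚ ℚ.≤? p v) ×-dec ((sum p ℚ.≟ 1ℚ) ×-dec face? L (comprehension (positive? p)))

    point : ∀ p → Valid p → ‖ L ‖
    point p (p≥0 , ∑p , f) = record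
      { coord   = fromℚ ∘ p
      ; nonneg  = λ v → fromℚ-mono (p≥0 v)
      ; total   = ≤ᴿ-pointwise {sumᴿ (fromℚ ∘ p)} {1ᴿ} (λ i → ℚ.≤-reflexive (trans (seq-sum (fromℚ ∘ p) i) ∑p)) ,
                  ≤ᴿ-pointwise {1ᴿ} {sumᴿ (fromℚ ∘ p)} (λ i → ℚ.≤-reflexive (sym (trans (seq-sum (fromℚ ∘ p) i) ∑p)))
      ; support = λ σ pos → down-closed L (λ {v} v∈σ → ∈-comprehension⁺ (positive? p) (positive v (pos v∈σ))) f
      }
      where
      positive : ∀ v → 0ᴿ <ᴿ fromℚ (p v) → 0ℚ ℚ.< p v
      positive v pos with 0<ᴿ-elim {fromℚ (p v)} pos
      ... | a , 0<a , a≤p = ℚ.<-≤-trans 0<a (fromℚ-cancel a≤p)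

    image : ∀ p → Valid p → ‖ K ‖
    image p V = apply (map F) (point p V)

    -- Labels are needed at every rational point, also outside L, and must still be Sperner labels
    -- on the base. A positive base coordinate serves there; `v₀` is a placeholder, never reached on
    -- the base.
    fallback : ∀ (p : Point (suc n)) → Dec (∃[ v ] 0ℚ ℚ.< p (suc v)) → Fin n
    fallback p (yes (v , _)) = v
    fallback p (no  _)       = v₀

    fallback? : ∀ (p : Point (suc n)) → Dec (∃[ v ] 0ℚ ℚ.< p (suc v))
    fallback? p = any? λ v → positive? p (suc v)

    -- A vertex whose open star contains the image, as in simplicial approximation.
    label : ∀ p → Dec (Valid p) → Fin n
    label p (yes V) = proj₁ (large-coordinate (image p V))
    label p (no  _) = fallback p (fallback? p)

    Λ : Point (suc n) → Fin n
    Λ p = label p (valid? p)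

    label-large : ∀ p (D : Dec (Valid p)) → Valid p → Σ[ V ∈ Valid p ] fromℚ (θ n) ≤ᴿ coord (image p V) (label p D)
    label-large p (yes V) _ = V , proj₂ (large-coordinate (image p V))
    label-large p (no ¬V) V = contradiction V ¬V

    label-on-base : ∀ {S} p D → In (outside ∷ S) p → label p D ∈ S
    label-on-base {S} p (yes V) (p≥0 , ∑p , off) = decide (proj₁ (large-coordinate (image p V)) ∈? S)
      where
      w = proj₁ (large-coordinate (image p V))

      decide : Dec (w ∈ S) → w ∈ S
      decide (yes w∈S) = w∈S
      decide (no  w∉S) = ⊥-elim (≤0⇒≯0 {coord (image p V) w}
        (on-base F (point p V) (fromℚ-mono (ℚ.≤-reflexive (off zero λ ()))) w
          (fromℚ-mono (ℚ.≤-reflexive (off (suc w) λ { (there w∈S) → w∉S w∈S }))))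
        (0<ᴿ-intro {coord (image p V) w} (0<θ n) (proj₂ (large-coordinate (image p V)))))
    label-on-base {S} p (no ¬V) (p≥0 , ∑p , off) = decide (fallback? p)
      where
      decide : (D : Dec (∃[ v ] 0ℚ ℚ.< p (suc v))) → fallback p D ∈ S
      decide (yes (v , 0<p)) with v ∈? S
      ... | yes v∈S = v∈S
      ... | no  v∉S = contradiction 0<p (ℚ.<-irrefl (sym (off (suc v) λ { (there v∈S) → v∉S v∈S })))
      decide (no none) = ⊥-elim (ℚ.<-irrefl refl (ℚ.<-≤-trans (ℚ.positive⁻¹ 1ℚ)
        (subst₂ ℚ._≤_ ∑p (sum-0 (suc n)) (sum-mono {f = p} {λ _ → 0ℚ} nonpos))))
        where
        nonpos : ∀ v → p v ℚ.≤ 0ℚ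
        nonpos zero    = ℚ.≤-reflexive (off zero λ ())
        nonpos (suc v) = ℚ.≮⇒≥ λ 0<p → none (v , 0<p)

    ½θ = ½ ℚ.* θ n

    modulus = continuous (map F) ½θ (0<½* (0<θ n))

    η : ℚ
    η = proj₁ modulus

    -- By the choice of η the images of the points of the tuple are within half of `θ n` of that of
    -- `p`. Every label is thus a positive coordinate of one point of K.
    labels-form-face : ∀ {m} (u : Vec (Point (suc n)) (suc m)) → (∀ {p} → p Vec.∈ u → Valid p) → Spread η u →
                       ∀ τ → (∀ {w} → w ∈ τ → w Vec.∈ Vec.map Λ u) → Face K τ
    labels-form-face (p ∷ u) valid spread τ τ⊆ = support (image p Vp) τ λ {w} w∈τ → positive w (Labelling.label-of Λ {u = p ∷ u} (τ⊆ w∈τ))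
      where
      Vp = valid (AnyV.here refl)

      positive : ∀ w → ∃[ q ] q Vec.∈ (p ∷ u) × Λ q ≡ w → 0ᴿ <ᴿ coord (image p Vp) w
      positive w (q , q∈ , refl) = from (label-large q (valid? q) (valid q∈))
        where
        from : Σ[ V ∈ Valid q ] fromℚ (θ n) ≤ᴿ coord (image q V) w → 0ᴿ <ᴿ coord (image p Vp) w
        from (Vq , θ≤) = 0<ᴿ-intro {coord (image p Vp) w} {θ n ℚ.- ½θ}
          (subst (0ℚ ℚ.<_) (solve 1 (λ t → con ½ :* t := t :- con ½ :* t) refl (θ n)) (0<½* (0<θ n)))
          (fromℚ-shift {coord (image p Vp) w} (θ n) ½θ
            (≤ᴿ-trans {fromℚ (θ n)} {coord (image q Vq) w} {coord (image p Vp) w +ᴿ fromℚ ½θ} θ≤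
              (proj₁ (proj₂ (proj₂ modulus) (point q Vq) (point p Vp) close w))))
          where
          near : ∀ p q → Near η p q → ∀ v → fromℚ (p v) ≤ᴿ fromℚ (q v) +ᴿ fromℚ η
          near p q h v = ≤ᴿ-pointwise {fromℚ (p v)} {fromℚ (q v) +ᴿ fromℚ η} λ _ → h v

          close : Within η (fromℚ ∘ q) (fromℚ ∘ p)
          close v = near q p (spread q∈ (AnyV.here refl)) v , near p q (spread (AnyV.here refl) q∈) v

    In⇒Valid : ∀ {S p} → Face L S → In S p → Valid p
    In⇒Valid {S} {p} f (p≥0 , ∑p , off) = p≥0 , ∑p , down-closed L sub f
      where
      sub : comprehension (positive? p) ⊆ S
      sub {v} v∈ with v ∈? S
      ... | yes v∈S = v∈S
      ... | no  v∉S = contradiction (∈-comprehension⁻ (positive? p) v∈) (ℚ.<-irrefl (sym (off v v∉S)))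

    open Labelling Λ

    N : ℕ
    N = proj₁ (meshⁿ-small (suc j) η (proj₁ (proj₂ modulus)))

    apex : Point (suc n)
    apex = basisPoint zero

    vertices : ∀ {m} → Vec (Fin n) m → Vec (Point (suc n)) m
    vertices = Vec.map (basisPoint ∘ suc)

    X-base : ∀ {m} (t : Vec (Fin n) m) τ → X N (vertices t) τ ≡ ⟦ t ⟧ τ
    X-base = sperner (basisPoint ∘ suc) (λ S → In (outside ∷ S)) (λ S → In-convex (outside ∷ S))
      (λ v∈S → In-basisPoint (there v∈S)) (λ {S} {p} → label-on-base p (valid? p))
      (λ v w → basisPoint-near (suc v) (suc w)) N

    -- The subdivision stays in the simplex on the apex and σ, hence in L, and is fine enough for
    -- `labels-form-face`.
    X-cone : ∀ {σ} (t : Vec (Fin n) (suc j)) τ → Face K σ → ∣ σ ∣ ≡ suc j → (∀ {x} → x Vec.∈ t → x ∈ σ) →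
             ¬ (Face K τ × ∣ τ ∣ ≡ suc (suc j)) → X N (apex ∷ vertices t) τ ≡ 0ℚ
    X-cone {σ} t τ f size t⊆σ ¬f = sdⁿ-0 N {suc j} (suc (suc j)) ℕ.≤-refl {1ℚ} 0≤1 {In (inside ∷ σ)} (In-convex (inside ∷ σ))
      (λ u → ⟦ Vec.map Λ u ⟧ τ)
      (λ u u∈ spread → ⟦⟧-0 (Vec.map Λ u) τ λ { (∣τ∣ , τ⊆) → ¬f (labels-form-face u
        (λ p∈ → In⇒Valid (f , inj₁ (ℕ.≤-reflexive (cong suc size))) (u∈ p∈))
        (λ {p} {q} p∈ q∈ v → ℚ.≤-trans (spread p∈ q∈ v)
          (ℚ.+-monoʳ-≤ (q v) (proj₂ (meshⁿ-small (suc j) η (proj₁ (proj₂ modulus))))))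
        τ τ⊆ , ∣τ∣) })
      (apex ∷ vertices t)
      (λ p∈ → let v , v∈ , eq = vertex p∈ in subst (In (inside ∷ σ)) eq (In-basisPoint v∈))
      (λ p∈ q∈ → let v , _ , eq = vertex p∈
                     w , _ , eq' = vertex q∈ in subst₂ (Near 1ℚ) eq eq' (basisPoint-near v w))
      where
      on-base′ : ∀ {m} {t : Vec (Fin n) m} {p} → p Vec.∈ vertices t → ∃[ v ] v Vec.∈ t × basisPoint (suc v) ≡ p
      on-base′ {t = v ∷ t} (AnyV.here eq)  = v , AnyV.here refl , sym eq
      on-base′ {t = v ∷ t} (AnyV.there p∈) with on-base′ {t = t} p∈
      ... | w , w∈ , eq = w , AnyV.there w∈ , eq

      vertex : ∀ {p} → p Vec.∈ (apex ∷ vertices t) → ∃[ v ] v ∈ (inside ∷ σ) × basisPoint v ≡ p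
      vertex (AnyV.here eq)  = zero , here , sym eq
      vertex (AnyV.there p∈) with on-base′ {t = t} p∈
      ... | w , w∈ , eq = suc w , there (t⊆σ w∈) , eq

  fills : Fills K (suc j)
  fills z z-on ∂z≡0 = b , b-on , ∂b≡z
    where
    b : Chain n
    b τ = pair n (suc j) id z (λ t → X N (apex ∷ vertices t) τ)

    b-on : IsChainOf K (suc (suc j)) b
    b-on τ ¬f = pair-0 n (suc j) id z (λ t → X N (apex ∷ vertices t) τ) λ σ t size t⊆σ →
      term σ t size (λ x∈t → let y , y∈σ , eq = t⊆σ x∈t in subst (_∈ σ) eq y∈σ) (face? K σ)
      where
      term : ∀ σ t → ∣ σ ∣ ≡ suc j → (∀ {x} → x Vec.∈ t → x ∈ σ) → Dec (Face K σ) → z σ ℚ.* X N (apex ∷ vertices t) τ ≡ 0ℚ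
      term σ t size t⊆σ (yes f) = trans (cong (z σ ℚ.*_) (X-cone t τ f size t⊆σ ¬f)) (ℚ.*-zeroʳ (z σ))
      term σ t size t⊆σ (no ¬g) = trans (cong (ℚ._* X N (apex ∷ vertices t) τ) (z-on σ (¬g ∘ proj₁)))
                                        (ℚ.*-zeroˡ (X N (apex ∷ vertices t) τ))

    -- The boundary of apex * t is t minus the cone over ∂ t. The bases add up to z by the Sperner
    -- property, and the cones cancel because ∂ z = 0.
    ∂b≡z : ∀ σ → ∂ʳ b σ ≡ z σ
    ∂b≡z σ = begin
      ∂ʳ b σ
        ≡⟨ ∂ʳ-pair n (suc j) id z (λ t → X N (apex ∷ vertices t)) σ ⟩
      pair n (suc j) id z (λ t → ∂ʳ (X N (apex ∷ vertices t)) σ)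
        ≡⟨ pair-congʳ n (suc j) id z (λ t → trans (∂X N (apex ∷ vertices t) σ)
             (cong₂ ℚ._-_ (X-base t σ) (sym (d-map (basisPoint ∘ suc) (λ u → X N (apex ∷ u) σ) t)))) ⟩
      pair n (suc j) id z (λ t → ⟦ t ⟧ σ ℚ.- d ψ t)
        ≡⟨ pair-subʳ n (suc j) id z (λ t → ⟦ t ⟧ σ) (d ψ) ⟩
      pair n (suc j) id z (λ t → ⟦ t ⟧ σ) ℚ.- pair n (suc j) id z (d ψ)
        ≡⟨ cong₂ ℚ._-_ (pair-⟦⟧ n (suc j) z (λ ρ ≢ → z-on ρ (≢ ∘ proj₂)) σ) cancel ⟩
      z σ ℚ.- 0ℚ
        ≡⟨ ℚ.+-identityʳ (z σ) ⟩
      z σ ∎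
      where
      open ≡-Reasoning
      ψ : Vec (Fin n) j → ℚ
      ψ t = X N (apex ∷ vertices t) σ

      cancel : pair n (suc j) id z (d ψ) ≡ 0ℚ
      cancel = trans (sym (pair-∂ n j id z ψ))
        (pair-0 n j id (∂ʳ z) ψ λ ρ t _ _ → trans (cong (ℚ._* ψ t) (∂z≡0 ρ)) (ℚ.*-zeroˡ (ψ t)))

fills-0 : (K : Complex n) → ∃[ v ] Face K ⁅ v ⁆ → Fills K 0
fills-0 K (v , f) = Fills-coloop K v 0 λ σ _ σ≡0 → down-closed K (∪⁅⁆⊆ (λ {x} x∈σ → contradiction
  (subst₂ _≤_ (∣⁅x⁆∣≡1 x) σ≡0 (p⊆q⇒∣p∣≤∣q∣ (λ y∈x → subst (_∈ σ) (sym (x∈⁅y⁆⇒x≡y x y∈x)) x∈σ))) λ ()) (x∈⁅x⁆ v)) f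

ReducedHomologyVanishes⇒Fills : (K : Complex n) → ∀ j → ReducedHomologyVanishes K j → Fills K (suc j)
ReducedHomologyVanishes⇒Fills K j vanishes z z-on ∂z≡0 with vanishes z z-on (λ τ → trans (∂≗∂ʳ z τ) (∂z≡0 τ))
... | b , b-on , ∂b≡z = b , b-on , λ σ → trans (sym (∂≗∂ʳ b σ)) (∂b≡z σ)

≤η⇒AcyclicBelow : ∀ κ (K : Complex n) a → a ≤η[ κ ] K → AcyclicBelow K a
≤η⇒AcyclicBelow κ K a conn = (λ 0<a → down-closed K (⊆-min _) (proj₂ (vertex κ (conn 0 0<a)))) , fills κ conn
  where
  vertex : ∀ κ → ConnectedAt κ K 0 → ∃[ v ] Face K ⁅ v ⁆
  vertex homotopical c = c
  vertex homological c = c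

  fills : ∀ κ → a ≤η[ κ ] K → ∀ p → p ℕ.< a → Fills K p
  fills κ           conn zero    0<a = fills-0 K (vertex κ (conn 0 0<a))
  -- Cycles of size j + 1 need the degrees -1 to j, which are the indices below j + 2.
  fills homotopical conn (suc j) j<a = Hurewicz.fills K j λ i i< → conn i (ℕ.<-≤-trans i< j<a)
  fills homological conn (suc j) j<a = ReducedHomologyVanishes⇒Fills K j (conn (suc j) j<a)

theorem5p2 : ∀ {n} (C : Complex n) (M : Matroid n) (k : ℕ) → 1 ≤ k → k ≤ rank (indep M) →
    (κ : Kind) →
    (∀ (X : Subset n) → IsFlat M (∁ X) → rank (indep M ↾ ∁ X) ≤ k ∸ 1 →
    η[ κ ] (C ↾ X) + rank (indep M ↾ ∁ X) ≥ (k + 1)) →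
    RGConnected C M k
theorem5p2 C M k 1≤k k≤rank κ hyp = homological-theorem C M k 1≤k k≤rank λ X flat rank≤ →
  let a , conn , ge = hyp X flat rank≤ in a , ≤η⇒AcyclicBelow κ (C ↾ X) a conn , ge
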